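{- In the extra-special case, the posets $(\mathrm{AN}(\Delta(1)),\le_{up})$ and $((\Delta_l)^\vee/\!\sim,\le)$ are naturally isomorphic; explicitly, the map sending $\Gamma\in\mathrm{AN}(\Delta(1))$ to the class of $w(\theta^\vee)$, for any $w\in W^0$ with $\min(\Delta(1)\setminus N(w))=\Gamma$, is a well-defined isomorphism.
   Context: Let $\mathfrak g$ be a complex simple Lie algebra with root system $\Delta$ in a real Euclidean space with $W$-invariant inner product $(\,,\,)$, positive roots $\Delta^+$, simple roots $\Pi$, Weyl group $W$, highest root $\theta$. For $\gamma\in\Delta$, $\gamma^\vee=2\gamma/(\gamma,\gamma)$; $\Pi^\vee=\{\alpha^\vee:\alpha\in\Pi\}$. Let $\Delta_l$ (resp. $\Delta_l^+$, $\Pi_l$) be the set of roots (resp. positive roots, simple roots) of the same length as $\theta$, and $(\Delta_l)^\vee=\{\gamma^\vee:\gamma\in\Delta_l\}$, ordered by $\nu\preccurlyeq\mu$ iff $\mu-\nu$ is a nonnegative integer combination of $\Pi^\vee$. Let $P_+=\{\gamma^\vee:\gamma\in\Delta_l^+\}$ and $P_-=-P_+$. $(\Delta_l)^\vee/\!\sim$ is obtained from $(\Delta_l)^\vee$ by identifying $\alpha^\vee$ with $-\alpha^\vee$ for each $\alpha\in\Pi_l$, with the partial order: for classes $x,y$, $x\le y$ iff either they have representatives in $P_+$ with $x\preccurlyeq y$, or representatives in $P_-$ with $x\preccurlyeq y$, or $x$ has a representative $x'\in P_-$ and $y$ a representative $y'\in P_+$ such that $x'\preccurlyeq-\alpha^\vee$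 and $\alpha^\vee\preccurlyeq y'$ for some $\alpha\in\Pi_l$ (i.e. the orders on $P_+$ and $P_-$ are kept and the two parts are glued along $\min P_+=\{\alpha^\vee:\alpha\in\Pi_l\}$ and $\max P_-=\{ -\alpha^\vee:\alpha\in\Pi_l\}$). Extra-special case: $\Delta(j)=\{\gamma\in\Delta:(\gamma,\theta^\vee)=j\}$, $\Delta(0)^+=\Delta(0)\cap\Delta^+$, $\Pi(0)=\Pi\cap\Delta(0)$; $\Delta(1)$ is partially ordered by $\mu\preccurlyeq\gamma$ iff $\gamma-\mu$ is a nonnegative integer combination of $\Pi(0)$. $W^0=\{w\in W:w(\alpha)\in\Delta^+\ \forall\alpha\in\Delta(0)^+\}$, $N(w)=\{\gamma\in\Delta^+:w(\gamma)\in-\Delta^+\}$. $\mathrm{AN}(\Delta(1))$ is the set of antichains of $\Delta(1)$, ordered by $\Gamma\le_{up}\Gamma'$ iff $I(\Gamma)\subset I(\Gamma')$, where $I(\Gamma)$ is the upper ideal generated by $\Gamma$. -}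

module Defs where

open import Data.Nat using (ℕ; zero; suc) renaming (_<_ to _<ℕ_)
open import Data.Integer using (ℤ; +_; _+_; _-_; _*_; -_; _≤_; _<_; 0ℤ; 1ℤ)
open import Data.Fin using (Fin; zero; suc; _≟_)
open import Data.Vec using (Vec; lookup; tabulate; map)
open import Data.List using (List; []; _∷_)
open import Data.Bool using (Bool; true; false; if_then_else_)
open import Data.Product using (Σ; ∃; _×_; _,_)
open import Data.Sum using (_⊎_)
open import Relation.Nullary using (¬_; ⌊_⌋)
open import Relation.Binary.PropositionalEquality using (_≡_; _≢_)

-- Vectors of integer coordinates (w.r.t. Π for roots, w.r.t. Π^∨ for coroots).
V : ℕ → Set
V n = Vec ℤ n

∑ : {n : ℕ} → (Fin n → ℤ) → ℤ
∑ {zero}  f = 0ℤ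
∑ {suc n} f = f zero + ∑ (λ i → f (suc i))

-- A Cartan matrix of a complex simple Lie algebra:
-- an indecomposable, symmetrizable generalized Cartan matrix whose
-- symmetrization is positive definite (= finite type).
-- Convention: A i j = ⟨α_j , α_i^∨⟩, and (α_i , α_j) = d_i * A i j,
-- so (α_i , α_i) = 2 d_i and α_i^∨ = α_i / d_i.
record CartanData (n : ℕ) : Set where
  field
    A        : Fin n → Fin n → ℤ
    d        : Fin n → ℕ
    d-pos    : ∀ i → 0 <ℕ d i
    diag     : ∀ i → A i i ≡ + 2
    offdiag  : ∀ i j → i ≢ j → A i j ≤ 0ℤ
    symm     : ∀ i j → + d i * A i j ≡ + d j * A j i
    posdef   : ∀ (x : Fin n → ℤ) → (∃ λ i → x i ≢ 0ℤ) →
               0ℤ < ∑ (λ i → ∑ (λ j → x i * (+ d i * A i j) * x j))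
    indecomp : ∀ (S : Fin n → Bool) → (∃ λ i → S i ≡ true) → (∃ λ j → S j ≡ false) →
               ∃ λ i → ∃ λ j → S i ≡ true × S j ≡ false × A i j ≢ 0ℤ

module RS {n : ℕ} (C : CartanData n) where
  open CartanData C

  -- the unit vector e_i (simple root α_i, resp. simple coroot α_i^∨)
  e : Fin n → V n
  e i = tabulate (λ k → if ⌊ k ≟ i ⌋ then 1ℤ else 0ℤ)

  neg : V n → V n
  neg = map (λ z → - z)

  -- W-invariant inner product on root coordinates
  inner : V n → V n → ℤ
  inner x y = ∑ (λ i → ∑ (λ j → lookup x i * (+ d i * A i j) * lookup y j))

  pairSimpleCo : V n → Fin n → ℤ
  pairSimpleCo x i = ∑ (λ k → A i k * lookup x k)

  -- pairing (γ , c) of γ (root coordinates) with c = Σ c_i α_i^∨ (coroot coordinates)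
  pair : V n → V n → ℤ
  pair γ c = ∑ (λ i → lookup c i * pairSimpleCo γ i)

  s : Fin n → V n → V n
  s i x = tabulate (λ k → if ⌊ k ≟ i ⌋ then lookup x k - pairSimpleCo x i else lookup x k)

  -- simple reflection s_i on coroot coordinates: s_i(c) = c - ⟨α_i, c⟩ α_i^∨,
  -- with ⟨α_i, α_j^∨⟩ = A j i
  cs : Fin n → V n → V n
  cs i c = tabulate (λ k → if ⌊ k ≟ i ⌋ then lookup c k - ∑ (λ j → A j i * lookup c j) else lookup c k)

  -- Weyl group elements as words in simple reflections
  W : Set
  W = List (Fin n)

  act : W → V n → V n
  act []      x = x
  act (i ∷ w) x = s i (act w x)

  coact : W → V n → V n
  coact []      c = c
  coact (i ∷ w) c = cs i (coact w c)

  data IsRoot : V n → Set where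
    simple : ∀ i → IsRoot (e i)
    refl-s : ∀ i {x} → IsRoot x → IsRoot (s i x)

  Positive : V n → Set
  Positive x = IsRoot x × (∀ i → 0ℤ ≤ lookup x i)

  Negative : V n → Set
  Negative x = IsRoot x × (∀ i → lookup x i ≤ 0ℤ)

  IsHighest : V n → Set
  IsHighest θ = IsRoot θ × (∀ γ → IsRoot γ → ∀ i → lookup γ i ≤ lookup θ i)

  -- c = γ^∨ = 2γ/(γ,γ), in Π^∨ coordinates: c_i = 2 d_i γ_i / (γ,γ)
  IsCorootOf : V n → V n → Set
  IsCorootOf γ c = ∀ i → inner γ γ * lookup c i ≡ + (2 Data.Nat.* d i) * lookup γ i

  _≼_ : V n → V n → Set
  x ≼ y = ∃ λ (m : Fin n → ℕ) → ∀ i → lookup y i ≡ lookup x i + + m i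

  module WithTheta (θ θv : V n) where

    Long : V n → Set
    Long γ = IsRoot γ × inner γ γ ≡ inner θ θ

    LongSimple : Fin n → Set
    LongSimple i = inner (e i) (e i) ≡ inner θ θ

    InLCo : V n → Set
    InLCo c = ∃ λ γ → Long γ × IsCorootOf γ c

    LCo : Set
    LCo = Σ (V n) InLCo

    Pplus : V n → Set
    Pplus c = ∃ λ γ → Long γ × Positive γ × IsCorootOf γ c

    Pminus : V n → Set
    Pminus c = Pplus (neg c)

    _∼_ : V n → V n → Set
    c ∼ c' = c ≡ c' ⊎ (∃ λ i → LongSimple i ×
               ((c ≡ e i × c' ≡ neg (e i)) ⊎ (c ≡ neg (e i) × c' ≡ e i)))

    -- the order on (Δ_l)^∨/∼ (on representatives)
    _≤∼_ : V n → V n → Set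
    x ≤∼ y = ∃ λ x' → ∃ λ y' → x ∼ x' × y ∼ y' ×
              ((Pplus x' × Pplus y' × x' ≼ y')
             ⊎ (Pminus x' × Pminus y' × x' ≼ y')
             ⊎ (Pminus x' × Pplus y' × ∃ λ i → LongSimple i × x' ≼ neg (e i) × e i ≼ y'))

    Δ : ℤ → V n → Set
    Δ j γ = IsRoot γ × pair γ θv ≡ j

    Δ0+ : V n → Set
    Δ0+ γ = Δ 0ℤ γ × Positive γ

    InΠ0 : Fin n → Set
    InΠ0 i = pair (e i) θv ≡ 0ℤ

    _≼₀_ : V n → V n → Set
    μ ≼₀ γ = ∃ λ (m : Fin n → ℕ) → (∀ i → lookup γ i ≡ lookup μ i + + m i) ×
                                   (∀ i → ¬ InΠ0 i → m i ≡ 0)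

    InW0 : W → Set
    InW0 w = ∀ α → Δ0+ α → Positive (act w α)

    InN : W → V n → Set
    InN w γ = Positive γ × Negative (act w γ)

    InMinComplN : W → V n → Set
    InMinComplN w γ = (Δ 1ℤ γ × ¬ InN w γ) ×
                      (∀ μ → Δ 1ℤ μ → ¬ InN w μ → μ ≼₀ γ → μ ≡ γ)

    IsAntichain : (V n → Bool) → Set
    IsAntichain Γ = (∀ γ → Γ γ ≡ true → Δ 1ℤ γ) ×
                    (∀ γ μ → Γ γ ≡ true → Γ μ ≡ true → μ ≼₀ γ → μ ≡ γ)

    AN : Set
    AN = Σ (V n → Bool) IsAntichain

    _≈AN_ : AN → AN → Set
    (Γ , _) ≈AN (Γ' , _) = ∀ γ → Γ γ ≡ Γ' γ

    InI : AN → V n → Set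
    InI (Γ , _) γ = Δ 1ℤ γ × ∃ λ μ → Γ μ ≡ true × μ ≼₀ γ

    _≤up_ : AN → AN → Set
    G ≤up G' = ∀ γ → InI G γ → InI G' γ

    MinIs : W → AN → Set
    MinIs w (Γ , _) = ∀ γ → (Γ γ ≡ true → InMinComplN w γ) × (InMinComplN w γ → Γ γ ≡ true)

{-# OPTIONS --safe #-}
module Submission where

-- A vector γ of the root lattice is a root iff for some i it satisfies (γ , γ) = (αᵢ , αᵢ) and has an integral
-- coroot; this makes roots decidable and gives their signs. For w ∈ W⁰ put I(w) = Δ(1) ∖ N(w), an upper ideal.
-- Long roots ν correspond to elements w ∈ W⁰ through ν = wθ, because an element of W that preserves
-- Δ⁺ is trivial. If (αⱼ , (wθ)^∨) = 1, then sⱼw ∈ W⁰ and I(sⱼw) = I(w) ∖ {w⁻¹αⱼ}, while wθ^∨ drops by αⱼ^∨.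
-- Conversely, when wθ is not simple, wγ is simple for every minimal element γ of I(w), so the minimal elements
-- can be removed one by one; when wθ = αᵢ, the reflection sᵢ turns wθ into -αᵢ and does not change I(w).
-- Hence every upper ideal is some I(w), and inclusion of ideals matches the order on coroots. Finally, if
-- I(w) = I(w′) but wθ > 0 > w′θ, then wθ is simple and w′θ = -wθ, which is the identification in (Δ_l)^∨/∼.

-- The obstacle is decidability. Antichains are Boolean predicates on all integer vectors, while
-- `IsRoot` is an inductive closure that comes with no list of roots. The integrality criterion
-- decides membership, and the highest root confines the positive roots to a finite box, so minimal
-- elements can be found by search.
--
-- The effect of one reflection on I(w) rests on a single fact: sⱼ changes the sign of no positive
-- root other than αⱼ. So γ ∈ I(w) can be lost only if wγ = αⱼ, and then (αⱼ , (wθ)^∨) = (γ , θ^∨) =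
-- 1. If instead αⱼ = ±wθ, then w⁻¹αⱼ = ±θ has degree ±2, and no element of Δ(1) is affected; this
-- is why the two parts of (Δ_l)^∨ are glued along simple roots.
--
-- The two directions of the order statement use different inductions: inclusion of ideals is turned
-- into a chain of reflections by removing minimal elements, whereas a comparison of coroots is
-- interpolated by reflections of either end point.

open import Defs
open import Data.Bool using (Bool; true; false; if_then_else_)
import Data.Bool.Properties as Boolₚ
open import Data.Empty using (⊥; ⊥-elim)
open import Data.Fin as Fin using (Fin; zero; suc)
import Data.Fin.Properties as Finₚ
open import Data.Integer as ℤ using (ℤ; +_; -[1+_]; +[1+_]; _+_; _-_; _*_; -_; _≤_; _<_; 0ℤ; 1ℤ; +≤+; ∣_∣)
import Data.Integer.Divisibility.Signed as Div
import Data.Integer.Properties as ℤₚ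
open import Data.Integer.Tactic.RingSolver using (solve-∀)
open import Data.List using (List; []; _∷_; _++_; reverse; length; _∷ʳ_; initLast; _∷ʳ′_; upTo; cartesianProductWith)
open import Data.List.Membership.Propositional using (_∈_; lose)
open import Data.List.Membership.Propositional.Properties using (∈-cartesianProductWith⁺; ∈-upTo⁺)
import Data.List.Properties as Listₚ
import Data.List.Relation.Unary.Any as Any
open import Data.List.Relation.Unary.Any using (here)
open import Data.Nat as ℕ using (ℕ; zero; suc)
import Data.Nat.Properties as ℕₚ
open import Data.Product using (Σ; ∃; _×_; _,_; proj₁; proj₂)
open import Data.Sum using (_⊎_; inj₁; inj₂; [_,_]′)
open import Data.Vec as Vec using ([]; _∷_; lookup; tabulate; zipWith; replicate)
import Data.Vec.Properties as Vecₚ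
open import Function using (_∘_)
open import Function.Bundles using (_⇔_; mk⇔)
open import Relation.Binary.PropositionalEquality
open import Relation.Nullary using (¬_; yes; no; Dec; ⌊_⌋)
open import Relation.Nullary.Decidable using (map′; _×-dec_; _⊎-dec_; ¬?; decidable-stable)

-- Linear inequalities are brought to the form 0ℤ ≤ u, where they add up and the ring solver can compare them.

≤→0≤ : ∀ {a b} → a ≤ b → 0ℤ ≤ b - a
≤→0≤ = ℤₚ.i≤j⇒0≤j-i

0≤→≤ : ∀ {a b} → 0ℤ ≤ b - a → a ≤ b
0≤→≤ = ℤₚ.0≤i-j⇒j≤i

<→0≤ : ∀ {a b} → a < b → 0ℤ ≤ b - a - 1ℤ
<→0≤ {a} {b} h = subst (0ℤ ≤_) (e a b) (≤→0≤ (ℤₚ.i<j⇒suc[i]≤j h))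
  where e : ∀ a b → b - (1ℤ + a) ≡ b - a - 1ℤ
        e = solve-∀

0≤→< : ∀ {a b} → 0ℤ ≤ b - a - 1ℤ → a < b
0≤→< {a} {b} h = ℤₚ.suc[i]≤j⇒i<j (0≤→≤ (subst (0ℤ ≤_) (e a b) h))
  where e : ∀ a b → b - a - 1ℤ ≡ b - (1ℤ + a)
        e = solve-∀

≡→0≤ : ∀ {a b} → a ≡ b → 0ℤ ≤ a - b
≡→0≤ {a} refl = ℤₚ.≤-reflexive (sym (ℤₚ.+-inverseʳ a))

infixl 6 _⊞_
_⊞_ : ∀ {a b} → 0ℤ ≤ a → 0ℤ ≤ b → 0ℤ ≤ a + b
_⊞_ = ℤₚ.+-mono-≤

infixl 7 _⊠_
_⊠_ : ∀ {a b} → 0ℤ ≤ a → 0ℤ ≤ b → 0ℤ ≤ a * b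
_⊠_ {+ a} {+ b} p q = subst (0ℤ ≤_) (ℤₚ.pos-* a b) (+≤+ ℕ.z≤n)

0≤-resp : ∀ {a b} → 0ℤ ≤ a → a ≡ b → 0ℤ ≤ b
0≤-resp p refl = p

-- Closes the linear contradictions: the hypotheses are added up, and the ring solver evaluates the
-- sum to a negative constant.
0≤⇒neg-absurd : ∀ {a} → 0ℤ ≤ a → ∀ k → ¬ (a ≡ -[1+ k ])
0≤⇒neg-absurd () k refl

>0-* : ∀ a b → 0ℤ < a → 0ℤ < b → 0ℤ < a * b
>0-* +[1+ a ] +[1+ b ] p q = ℤ.+<+ (ℕ.s≤s ℕ.z≤n)
>0-* (+ 0) _ (ℤ.+<+ ()) q
>0-* +[1+ a ] (+ 0) p (ℤ.+<+ ())

>0-*-cancelˡ : ∀ {a b} → 0ℤ < a → 0ℤ < a * b → 0ℤ < b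
>0-*-cancelˡ {a} {+[1+ b ]} p q = ℤ.+<+ (ℕ.s≤s ℕ.z≤n)
>0-*-cancelˡ {a} {+ 0} p q = ⊥-elim (ℤₚ.<-irrefl (sym (ℤₚ.*-zeroʳ a)) q)
>0-*-cancelˡ {+[1+ a ]} { -[1+ b ] } p ()
>0-*-cancelˡ {+ 0} { -[1+ b ] } (ℤ.+<+ ()) q

≥0-*-cancelˡ : ∀ {a b} → 0ℤ < a → 0ℤ ≤ a * b → 0ℤ ≤ b
≥0-*-cancelˡ {a} {+ b} p q = +≤+ ℕ.z≤n
≥0-*-cancelˡ {+[1+ a ]} { -[1+ b ] } p ()
≥0-*-cancelˡ {+ 0} { -[1+ b ] } (ℤ.+<+ ()) q

*-cancel-pos : ∀ {a b c} → 0ℤ < a → a * b ≡ a * c → b ≡ c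
*-cancel-pos {+[1+ a ]} p q = ℤₚ.*-cancelˡ-≡ +[1+ a ] _ _ q
*-cancel-pos {+ 0} (ℤ.+<+ ()) q

-- Finite sums

∑-cong : ∀ {n} {f g : Fin n → ℤ} → (∀ i → f i ≡ g i) → ∑ f ≡ ∑ g
∑-cong {zero}  h = refl
∑-cong {suc n} h = cong₂ _+_ (h zero) (∑-cong (h ∘ suc))

∑-+ : ∀ {n} (f g : Fin n → ℤ) → ∑ (λ i → f i + g i) ≡ ∑ f + ∑ g
∑-+ {zero}  f g = refl
∑-+ {suc n} f g = trans (cong (λ z → f zero + g zero + z) (∑-+ (f ∘ suc) (g ∘ suc))) (e (f zero) (g zero) _ _)
  where e : ∀ a b c d → a + b + (c + d) ≡ a + c + (b + d)
        e = solve-∀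

∑-*ˡ : ∀ {n} k (f : Fin n → ℤ) → ∑ (λ i → k * f i) ≡ k * ∑ f
∑-*ˡ {zero}  k f = sym (ℤₚ.*-zeroʳ k)
∑-*ˡ {suc n} k f = trans (cong (λ z → k * f zero + z) (∑-*ˡ k (f ∘ suc))) (sym (ℤₚ.*-distribˡ-+ k (f zero) _))

∑-0 : ∀ {n} {f : Fin n → ℤ} → (∀ i → f i ≡ 0ℤ) → ∑ f ≡ 0ℤ
∑-0 {zero}  h = refl
∑-0 {suc n} h = cong₂ _+_ (h zero) (∑-0 (h ∘ suc))

∑-swap : ∀ {m n} (f : Fin m → Fin n → ℤ) → ∑ (λ i → ∑ (f i)) ≡ ∑ (λ j → ∑ (λ i → f i j))
∑-swap {zero} {n} f = sym (∑-0 {n} {λ _ → 0ℤ} (λ _ → refl))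
∑-swap {suc m} f = trans (cong (λ z → ∑ (f zero) + z) (∑-swap (f ∘ suc)))
                         (sym (∑-+ (f zero) (λ j → ∑ (λ i → f (suc i) j))))

∑-single : ∀ {n} {f : Fin n → ℤ} i → (∀ k → k ≢ i → f k ≡ 0ℤ) → ∑ f ≡ f i
∑-single {suc n} {f} zero    h = trans (cong (λ z → f zero + z) (∑-0 (λ k → h (suc k) λ ()))) (ℤₚ.+-identityʳ _)
∑-single {suc n} {f} (suc i) h = trans (cong₂ _+_ (h zero (λ ())) (∑-single i (λ k k≢i → h (suc k) (k≢i ∘ Finₚ.suc-injective))))
                                       (ℤₚ.+-identityˡ _)

∑-≥0 : ∀ {n} {f : Fin n → ℤ} → (∀ i → 0ℤ ≤ f i) → 0ℤ ≤ ∑ f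
∑-≥0 {zero}  h = ℤₚ.≤-refl
∑-≥0 {suc n} h = h zero ⊞ ∑-≥0 (h ∘ suc)

∑-≥0-≡0 : ∀ {n} {f : Fin n → ℤ} → (∀ i → 0ℤ ≤ f i) → ∑ f ≡ 0ℤ → ∀ i → f i ≡ 0ℤ
∑-≥0-≡0 {suc n} {f} h e zero = ℤₚ.≤-antisym
  (0≤→≤ (0≤-resp (≡→0≤ (sym e) ⊞ ∑-≥0 (h ∘ suc)) (l (f zero) (∑ (f ∘ suc))))) (h zero)
  where l : ∀ a b → 0ℤ - (a + b) + b ≡ 0ℤ - a
        l = solve-∀
∑-≥0-≡0 {suc n} {f} h e (suc i) = ∑-≥0-≡0 (h ∘ suc) (ℤₚ.≤-antisym
  (0≤→≤ (0≤-resp (≡→0≤ (sym e) ⊞ h zero) (l (f zero) (∑ (f ∘ suc))))) (∑-≥0 (h ∘ suc))) i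
  where l : ∀ a b → 0ℤ - (a + b) + a ≡ 0ℤ - b
        l = solve-∀

∑->0 : ∀ {n} (f : Fin n → ℤ) → 0ℤ < ∑ f → ∃ λ i → 0ℤ < f i
∑->0 {zero}  f (ℤ.+<+ ())
∑->0 {suc n} f p with 0ℤ ℤₚ.<? f zero
... | yes q = zero , q
... | no ¬q with ∑->0 (f ∘ suc) (0≤→< (0≤-resp (<→0≤ p ⊞ ≤→0≤ (ℤₚ.≮⇒≥ ¬q)) (l (f zero) (∑ (f ∘ suc)))))
  where l : ∀ a b → a + b - 0ℤ - 1ℤ + (0ℤ - a) ≡ b - 0ℤ - 1ℤ
        l = solve-∀
...   | i , q = suc i , q

-- Off-diagonal entries occur in equal pairs, so only the diagonal decides the parity.
∑∑-even : ∀ {n} (N : Fin n → Fin n → ℤ) → (∀ i j → N i j ≡ N j i) →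
          (∀ i → ∃ λ z → N i i ≡ + 2 * z) → ∃ λ z → ∑ (λ i → ∑ (N i)) ≡ + 2 * z
∑∑-even {zero}  N s d = 0ℤ , refl
∑∑-even {suc n} N s d with d zero | ∑∑-even (λ i j → N (suc i) (suc j)) (λ i j → s (suc i) (suc j)) (d ∘ suc)
... | z , p | z' , q = z + ∑ (λ j → N zero (suc j)) + z' , (begin
    N zero zero + r + ∑ (λ i → N (suc i) zero + ∑ (λ j → N (suc i) (suc j)))
      ≡⟨ cong₂ (λ a b → a + r + b) p (∑-+ (λ i → N (suc i) zero) _) ⟩
    + 2 * z + r + (∑ (λ i → N (suc i) zero) + ∑ (λ i → ∑ (λ j → N (suc i) (suc j))))
      ≡⟨ cong₂ (λ a b → + 2 * z + r + (a + b)) (∑-cong (λ i → s (suc i) zero)) q ⟩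
    + 2 * z + r + (r + + 2 * z')
      ≡⟨ l z r z' ⟩
    + 2 * (z + r + z') ∎)
  where
  open ≡-Reasoning
  r = ∑ (λ j → N zero (suc j))
  l : ∀ z r z' → + 2 * z + r + (r + + 2 * z') ≡ + 2 * (z + r + z')
  l = solve-∀

-- Integer vectors, positive and negative parts, finite boxes

infixl 6 _⊕_
_⊕_ : ∀ {n} → V n → V n → V n
_⊕_ = zipWith _+_

infixl 7 _·_
_·_ : ∀ {n} → ℤ → V n → V n
k · x = Vec.map (k *_) x

𝟘 : ∀ {n} → V n
𝟘 = replicate _ 0ℤ

lookup-⊕ : ∀ {n} (x y : V n) i → lookup (x ⊕ y) i ≡ lookup x i + lookup y i
lookup-⊕ x y i = Vecₚ.lookup-zipWith _+_ i x y

lookup-· : ∀ {n} k (x : V n) i → lookup (k · x) i ≡ k * lookup x i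
lookup-· k x i = Vecₚ.lookup-map i (k *_) x

lookup-𝟘 : ∀ {n} (i : Fin n) → lookup (𝟘 {n}) i ≡ 0ℤ
lookup-𝟘 i = Vecₚ.lookup-replicate i 0ℤ

lookup-ext : ∀ {n} {x y : V n} → (∀ i → lookup x i ≡ lookup y i) → x ≡ y
lookup-ext {x = x} {y} h = trans (sym (Vecₚ.tabulate∘lookup x)) (trans (Vecₚ.tabulate-cong h) (Vecₚ.tabulate∘lookup y))

posPart negPart : ℤ → ℤ
posPart (+ k)    = + k
posPart -[1+ k ] = 0ℤ
negPart (+ k)    = 0ℤ
negPart -[1+ k ] = +[1+ k ]

posPart≥0 : ∀ z → 0ℤ ≤ posPart z
posPart≥0 (+ k)    = +≤+ ℕ.z≤n
posPart≥0 -[1+ k ] = +≤+ ℕ.z≤n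

negPart≥0 : ∀ z → 0ℤ ≤ negPart z
negPart≥0 (+ k)    = +≤+ ℕ.z≤n
negPart≥0 -[1+ k ] = +≤+ ℕ.z≤n

pos+neg : ∀ z → z ≡ posPart z + - negPart z
pos+neg (+ k)    = sym (ℤₚ.+-identityʳ (+ k))
pos+neg -[1+ k ] = refl

pos*neg : ∀ z → posPart z * negPart z ≡ 0ℤ
pos*neg (+ k)    = ℤₚ.*-zeroʳ (+ k)
pos*neg -[1+ k ] = refl

-- Homogeneity under nonnegative factors is what passes the integrality of a coroot on to the two
-- parts of a vector.
posPart-* : ∀ k z → posPart (+ k * z) ≡ + k * posPart z
posPart-* k (+ m) rewrite sym (ℤₚ.pos-* k m) = refl
posPart-* zero    -[1+ m ] = refl
posPart-* (suc k) -[1+ m ] = sym (ℤₚ.*-zeroʳ (+ suc k))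

negPart-* : ∀ k z → negPart (+ k * z) ≡ + k * negPart z
negPart-* k (+ m) rewrite sym (ℤₚ.pos-* k m) = sym (ℤₚ.*-zeroʳ (+ k))
negPart-* zero    -[1+ m ] = refl
negPart-* (suc k) -[1+ m ] = refl

posPart≡0 : ∀ z → posPart z ≡ 0ℤ → z ≤ 0ℤ
posPart≡0 (+ k) p    = ℤₚ.≤-reflexive p
posPart≡0 -[1+ k ] p = ℤ.-≤+

negPart≡0 : ∀ z → negPart z ≡ 0ℤ → 0ℤ ≤ z
negPart≡0 (+ k) p = +≤+ ℕ.z≤n

-- A record rather than a function type, so that `x` can be recovered from the type of a proof.
record NN {n : ℕ} (x : V n) : Set where
  constructor nn
  field nonneg : ∀ i → 0ℤ ≤ lookup x i
open NN public

NN? : ∀ {n} (x : V n) → Dec (NN x)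
NN? x = map′ nn nonneg (Finₚ.all? (λ i → 0ℤ ℤₚ.≤? lookup x i))

height : ∀ {n} → V n → ℤ
height x = ∑ (lookup x)

2>0 : 0ℤ < + 2
2>0 = ℤ.+<+ (ℕ.s≤s ℕ.z≤n)

between±2 : ∀ z → - + 2 < z → z < + 2 → z ≡ - 1ℤ ⊎ z ≡ 0ℤ ⊎ z ≡ 1ℤ
between±2 (+ 0) _ _ = inj₂ (inj₁ refl)
between±2 (+ 1) _ _ = inj₂ (inj₂ refl)
between±2 (+ suc (suc k)) _ (ℤ.+<+ (ℕ.s≤s (ℕ.s≤s ())))
between±2 -[1+ 0 ] _ _ = inj₁ refl
between±2 -[1+ suc k ] (ℤ.-<- (ℕ.s≤s ())) _

box : ∀ {n} → V n → List (V n)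
box []       = [] ∷ []
box (b ∷ bs) = cartesianProductWith (λ k x → + k ∷ x) (upTo (suc ∣ b ∣)) (box bs)

∈-box : ∀ {n} (b x : V n) → (∀ i → 0ℤ ≤ lookup x i) → (∀ i → lookup x i ≤ lookup b i) → x ∈ box b
∈-box [] [] p q = here refl
∈-box (b ∷ bs) (x ∷ xs) p q = subst (λ z → z ∷ xs ∈ box (b ∷ bs)) (ℤₚ.0≤i⇒+∣i∣≡i (p zero))
  (∈-cartesianProductWith⁺ (λ k x → + k ∷ x) (∈-upTo⁺ (ℕ.s≤s abs≤)) (∈-box bs xs (p ∘ suc) (q ∘ suc)))
  where
  abs≤ : ∣ x ∣ ℕ.≤ ∣ b ∣
  abs≤ = ℤₚ.drop‿+≤+ (subst₂ _≤_ (sym (ℤₚ.0≤i⇒+∣i∣≡i (p zero))) (sym (ℤₚ.0≤i⇒+∣i∣≡i (ℤₚ.≤-trans (p zero) (q zero)))) (q zero))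

⌊⌋-true : ∀ {A : Set} (a? : Dec A) → A → ⌊ a? ⌋ ≡ true
⌊⌋-true (yes _) a = refl
⌊⌋-true (no ¬a) a = ⊥-elim (¬a a)

true-⌊⌋ : ∀ {A : Set} (a? : Dec A) → ⌊ a? ⌋ ≡ true → A
true-⌊⌋ (yes a) _ = a

true⇔⇒≡ : ∀ {a b : Bool} → (a ≡ true → b ≡ true) → (b ≡ true → a ≡ true) → a ≡ b
true⇔⇒≡ {true}  {b}     f g = sym (f refl)
true⇔⇒≡ {false} {true}  f g = g refl
true⇔⇒≡ {false} {false} f g = refl

-- Simple reflections and the invariant form

module RootSystem {n : ℕ} (C : CartanData n) where
  open CartanData C public
  open RS C public

  D : Fin n → ℤ
  D i = + d i

  D>0 : ∀ i → 0ℤ < D i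
  D>0 i = ℤ.+<+ (d-pos i)

  lookup-neg : ∀ x i → lookup (neg x) i ≡ - lookup x i
  lookup-neg x i = Vecₚ.lookup-map i (λ z → - z) x

  neg-is-· : ∀ x → neg x ≡ (- 1ℤ) · x
  neg-is-· x = lookup-ext λ i → trans (lookup-neg x i) (trans (sym (ℤₚ.-1*i≡-i _)) (sym (lookup-· (- 1ℤ) x i)))

  neg-involutive : ∀ x → neg (neg x) ≡ x
  neg-involutive x = lookup-ext λ i → trans (lookup-neg (neg x) i) (trans (cong -_ (lookup-neg x i)) (ℤₚ.neg-involutive _))

  lookup-e-same : ∀ i → lookup (e i) i ≡ 1ℤ
  lookup-e-same i rewrite Vecₚ.lookup∘tabulate (λ k → if ⌊ k Fin.≟ i ⌋ then 1ℤ else 0ℤ) i with i Fin.≟ i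
  ... | yes _ = refl
  ... | no i≢i = ⊥-elim (i≢i refl)

  lookup-e-diff : ∀ i k → k ≢ i → lookup (e i) k ≡ 0ℤ
  lookup-e-diff i k k≢i rewrite Vecₚ.lookup∘tabulate (λ k → if ⌊ k Fin.≟ i ⌋ then 1ℤ else 0ℤ) k with k Fin.≟ i
  ... | yes p = ⊥-elim (k≢i p)
  ... | no _ = refl

  lookup-e-≥0 : ∀ i k → 0ℤ ≤ lookup (e i) k
  lookup-e-≥0 i k with k Fin.≟ i
  ... | yes refl = subst (0ℤ ≤_) (sym (lookup-e-same i)) (+≤+ ℕ.z≤n)
  ... | no k≢i = subst (0ℤ ≤_) (sym (lookup-e-diff i k k≢i)) (+≤+ ℕ.z≤n)

  ∑-e : ∀ (f : Fin n → ℤ) i → ∑ (λ k → f k * lookup (e i) k) ≡ f i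
  ∑-e f i = trans (∑-single i (λ k k≢i → trans (cong (f k *_) (lookup-e-diff i k k≢i)) (ℤₚ.*-zeroʳ (f k))))
                  (trans (cong (f i *_) (lookup-e-same i)) (ℤₚ.*-identityʳ (f i)))

  -- Serves both `s` and `cs`: the coordinatewise definition becomes a linear expression.
  reflect-coord : (p : ℤ) (x : V n) (i : Fin n) →
    tabulate (λ k → if ⌊ k Fin.≟ i ⌋ then lookup x k - p else lookup x k) ≡ x ⊕ (- p) · e i
  reflect-coord p x i = lookup-ext λ k → trans (Vecₚ.lookup∘tabulate _ k)
    (sym (trans (lookup-⊕ x _ k) (trans (cong (λ z → lookup x k + z) (lookup-· (- p) (e i) k)) (at k))))
    where
    at : ∀ k → lookup x k + - p * lookup (e i) k ≡ (if ⌊ k Fin.≟ i ⌋ then lookup x k - p else lookup x k)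
    at k with k Fin.≟ i
    ... | yes refl rewrite lookup-e-same i = cong (λ z → lookup x k + z) (ℤₚ.*-identityʳ _)
    ... | no k≢i rewrite lookup-e-diff i k k≢i = trans (cong (λ z → lookup x k + z) (ℤₚ.*-zeroʳ (- p))) (ℤₚ.+-identityʳ _)

  -- Opaque copies of the form and of the pairing, so that unification sees them as rigid.
  abstract
    B : V n → V n → ℤ
    B = inner

    pSC : V n → Fin n → ℤ
    pSC = pairSimpleCo

    B≡inner : ∀ x y → B x y ≡ inner x y
    B≡inner x y = refl

    pSC≡pair : ∀ x i → pSC x i ≡ pairSimpleCo x i
    pSC≡pair x i = refl

    s-def : ∀ i x → s i x ≡ x ⊕ (- pSC x i) · e i
    s-def i x = reflect-coord (pSC x i) x i

  lookup-s : ∀ i x k → lookup (s i x) k ≡ lookup x k + (- pSC x i) * lookup (e i) k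
  lookup-s i x k = trans (cong (λ y → lookup y k) (s-def i x)) (trans (lookup-⊕ x _ k) (cong (λ z → lookup x k + z) (lookup-· (- pSC x i) (e i) k)))

  lookup-s-diff : ∀ i x k → k ≢ i → lookup (s i x) k ≡ lookup x k
  lookup-s-diff i x k k≢i = trans (lookup-s i x k) (trans (cong (λ u → lookup x k + (- pSC x i) * u) (lookup-e-diff i k k≢i))
    (trans (cong (λ z → lookup x k + z) (ℤₚ.*-zeroʳ (- pSC x i))) (ℤₚ.+-identityʳ _)))

  lookup-s-same : ∀ i x → lookup (s i x) i ≡ lookup x i - pSC x i
  lookup-s-same i x = trans (lookup-s i x i) (trans (cong (λ u → lookup x i + (- pSC x i) * u) (lookup-e-same i))
    (cong (λ z → lookup x i + z) (ℤₚ.*-identityʳ _)))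

  abstract
    pSC-⊕ : ∀ x y i → pSC (x ⊕ y) i ≡ pSC x i + pSC y i
    pSC-⊕ x y i = trans (∑-cong λ k → trans (cong (A i k *_) (lookup-⊕ x y k)) (ℤₚ.*-distribˡ-+ (A i k) _ _))
                        (∑-+ (λ k → A i k * lookup x k) _)

    pSC-· : ∀ c x i → pSC (c · x) i ≡ c * pSC x i
    pSC-· c x i = trans (∑-cong λ k → trans (cong (A i k *_) (lookup-· c x k)) (l (A i k) c (lookup x k)))
                        (∑-*ˡ c (λ k → A i k * lookup x k))
      where l : ∀ a c x → a * (c * x) ≡ c * (a * x)
            l = solve-∀

    pSC-e : ∀ i j → pSC (e j) i ≡ A i j
    pSC-e i j = ∑-e (A i) j

  abstract
    inner-def : ∀ x y → B x y ≡ ∑ (λ i → lookup x i * (D i * pSC y i))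
    inner-def x y = ∑-cong λ i → trans (∑-cong λ j → l (lookup x i) (D i) (A i j) (lookup y j))
                                       (trans (∑-*ˡ (lookup x i * D i) (λ j → A i j * lookup y j)) (ℤₚ.*-assoc (lookup x i) (D i) _))
      where l : ∀ x d a y → x * (d * a) * y ≡ x * d * (a * y)
            l = solve-∀

    inner-sym : ∀ x y → B x y ≡ B y x
    inner-sym x y = trans (∑-swap λ i j → lookup x i * (D i * A i j) * lookup y j)
      (∑-cong λ j → ∑-cong λ i → trans (cong (λ z → lookup x i * z * lookup y j) (symm i j)) (l (lookup x i) (D j * A j i) (lookup y j)))
      where l : ∀ x a y → x * a * y ≡ y * a * x
            l = solve-∀

    inner->0 : ∀ {x} → x ≢ 𝟘 → 0ℤ < B x x
    inner->0 {x} x≢𝟘 with Finₚ.¬∀⟶∃¬ n (λ i → lookup x i ≡ 0ℤ) (λ i → lookup x i ℤₚ.≟ 0ℤ) (λ h → x≢𝟘 (lookup-ext λ i → trans (h i) (sym (lookup-𝟘 i))))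
    ... | i , ne = posdef (lookup x) (i , ne)

  inner-⊕ʳ : ∀ x y z → B x (y ⊕ z) ≡ B x y + B x z
  inner-⊕ʳ x y z = begin
    B x (y ⊕ z)                                                       ≡⟨ inner-def x (y ⊕ z) ⟩
    ∑ (λ i → lookup x i * (D i * pSC (y ⊕ z) i))
      ≡⟨ (∑-cong λ i → trans (cong (λ u → lookup x i * (D i * u)) (pSC-⊕ y z i)) (l (lookup x i) (D i) (pSC y i) (pSC z i))) ⟩
    ∑ (λ i → lookup x i * (D i * pSC y i) + lookup x i * (D i * pSC z i))
      ≡⟨ ∑-+ (λ i → lookup x i * (D i * pSC y i)) _ ⟩
    _ ≡⟨ cong₂ _+_ (inner-def x y) (inner-def x z) ⟨
    B x y + B x z ∎
    where open ≡-Reasoning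
          l : ∀ x d a b → x * (d * (a + b)) ≡ x * (d * a) + x * (d * b)
          l = solve-∀

  inner-·ʳ : ∀ x c y → B x (c · y) ≡ c * B x y
  inner-·ʳ x c y = begin
    B x (c · y)                                                       ≡⟨ inner-def x (c · y) ⟩
    ∑ (λ i → lookup x i * (D i * pSC (c · y) i))
      ≡⟨ (∑-cong λ i → trans (cong (λ u → lookup x i * (D i * u)) (pSC-· c y i)) (l (lookup x i) (D i) c (pSC y i))) ⟩
    ∑ (λ i → c * (lookup x i * (D i * pSC y i)))                 ≡⟨ ∑-*ˡ c (λ i → lookup x i * (D i * pSC y i)) ⟩
    _ ≡⟨ cong (c *_) (inner-def x y) ⟨
    c * B x y ∎
    where open ≡-Reasoning
          l : ∀ x d c a → x * (d * (c * a)) ≡ c * (x * (d * a))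
          l = solve-∀

  inner-⊕ˡ : ∀ x y z → B (x ⊕ y) z ≡ B x z + B y z
  inner-⊕ˡ x y z = trans (inner-sym (x ⊕ y) z) (trans (inner-⊕ʳ z x y) (cong₂ _+_ (inner-sym z x) (inner-sym z y)))

  inner-·ˡ : ∀ c x y → B (c · x) y ≡ c * B x y
  inner-·ˡ c x y = trans (inner-sym (c · x) y) (trans (inner-·ʳ y c x) (cong (c *_) (inner-sym y x)))

  inner-negˡ : ∀ x y → B (neg x) y ≡ - B x y
  inner-negˡ x y = trans (cong (λ z → B z y) (neg-is-· x)) (trans (inner-·ˡ (- 1ℤ) x y) (ℤₚ.-1*i≡-i _))

  inner-negʳ : ∀ x y → B x (neg y) ≡ - B x y
  inner-negʳ x y = trans (inner-sym x (neg y)) (trans (inner-negˡ y x) (cong -_ (inner-sym y x)))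

  inner-neg-neg : ∀ x → B (neg x) (neg x) ≡ B x x
  inner-neg-neg x = trans (inner-negˡ x (neg x)) (trans (cong -_ (inner-negʳ x x)) (ℤₚ.neg-involutive _))

  inner-e : ∀ i y → B (e i) y ≡ D i * pSC y i
  inner-e i y = trans (inner-def (e i) y) (trans (∑-cong λ k → ℤₚ.*-comm (lookup (e i) k) _) (∑-e (λ k → D k * pSC y k) i))

  inner-expand : ∀ x y → B x y ≡ ∑ (λ i → lookup x i * B (e i) y)
  inner-expand x y = trans (inner-def x y) (∑-cong λ i → cong (lookup x i *_) (sym (inner-e i y)))

  inner-e-e : ∀ i → B (e i) (e i) ≡ + 2 * D i
  inner-e-e i = trans (inner-e i (e i)) (trans (cong (D i *_) (trans (pSC-e i i) (diag i))) (ℤₚ.*-comm (D i) (+ 2)))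

  inner-ejx : ∀ i j → B (e i) (e j) ≡ D i * A i j
  inner-ejx i j = trans (inner-e i (e j)) (cong (D i *_) (pSC-e i j))

  inner-⊕·-⊕· : ∀ x y z a b → B (x ⊕ a · z) (y ⊕ b · z) ≡ B x y + b * B z x + (a * B z y + a * (b * B z z))
  inner-⊕·-⊕· x y z a b = begin
    B (x ⊕ a · z) (y ⊕ b · z)                              ≡⟨ inner-⊕ˡ x (a · z) (y ⊕ b · z) ⟩
    B x (y ⊕ b · z) + B (a · z) (y ⊕ b · z)
      ≡⟨ cong₂ _+_ (inner-⊕ʳ x y (b · z)) (trans (inner-·ˡ a z (y ⊕ b · z)) (cong (a *_) (inner-⊕ʳ z y (b · z)))) ⟩
    B x y + B x (b · z) + a * (B z y + B z (b · z))
      ≡⟨ cong₂ (λ u v → B x y + u + a * (B z y + v)) (trans (inner-·ʳ x b z) (cong (b *_) (inner-sym x z))) (inner-·ʳ z b z) ⟩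
    B x y + b * B z x + a * (B z y + b * B z z)
      ≡⟨ cong (λ v → B x y + b * B z x + v) (ℤₚ.*-distribˡ-+ a (B z y) _) ⟩
    B x y + b * B z x + (a * B z y + a * (b * B z z)) ∎
    where open ≡-Reasoning

  inner-s : ∀ i x y → B (s i x) (s i y) ≡ B x y
  inner-s i x y = begin
    B (s i x) (s i y)                       ≡⟨ cong₂ B (s-def i x) (s-def i y) ⟩
    B (x ⊕ (- p) · e i) (y ⊕ (- q) · e i)   ≡⟨ inner-⊕·-⊕· x y (e i) (- p) (- q) ⟩
    B x y + - q * B (e i) x + (- p * B (e i) y + - p * (- q * B (e i) (e i)))
      ≡⟨ cong₂ (λ u v → B x y + - q * u + (- p * v + - p * (- q * B (e i) (e i)))) (inner-e i x) (inner-e i y) ⟩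
    B x y + - q * (D i * p) + (- p * (D i * q) + - p * (- q * B (e i) (e i)))
      ≡⟨ cong (λ u → B x y + - q * (D i * p) + (- p * (D i * q) + - p * (- q * u))) (inner-e-e i) ⟩
    B x y + - q * (D i * p) + (- p * (D i * q) + - p * (- q * (+ 2 * D i)))
      ≡⟨ l (B x y) (D i) p q ⟩
    B x y ∎
    where open ≡-Reasoning
          p = pSC x i
          q = pSC y i
          l : ∀ b d p q → b + - q * (d * p) + (- p * (d * q) + - p * (- q * (+ 2 * d))) ≡ b
          l = solve-∀

  pSC-s : ∀ i x → pSC (s i x) i ≡ - pSC x i
  pSC-s i x = trans (cong (λ y → pSC y i) (s-def i x)) (trans (pSC-⊕ x ((- pSC x i) · e i) i)
    (trans (cong (λ u → pSC x i + u) (trans (pSC-· (- pSC x i) (e i) i) (cong (- pSC x i *_) (trans (pSC-e i i) (diag i)))))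
           (l (pSC x i))))
    where l : ∀ p → p + - p * + 2 ≡ - p
          l = solve-∀

  s-involutive : ∀ i x → s i (s i x) ≡ x
  s-involutive i x = lookup-ext λ k → trans (lookup-s i (s i x) k)
    (trans (cong₂ (λ u v → u + - v * lookup (e i) k) (lookup-s i x k) (pSC-s i x)) (l (lookup x k) (pSC x i) (lookup (e i) k)))
    where
    l : ∀ a p u → a + - p * u + - - p * u ≡ a
    l = solve-∀

  s-⊕ : ∀ i x y → s i (x ⊕ y) ≡ s i x ⊕ s i y
  s-⊕ i x y = lookup-ext λ k → trans (lookup-s i (x ⊕ y) k)
    (trans (cong₂ (λ u v → u + - v * lookup (e i) k) (lookup-⊕ x y k) (pSC-⊕ x y i))
    (trans (l (lookup x k) (lookup y k) (pSC x i) (pSC y i) (lookup (e i) k))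
           (sym (trans (lookup-⊕ (s i x) (s i y) k) (cong₂ _+_ (lookup-s i x k) (lookup-s i y k))))))
    where
    l : ∀ a b p q u → a + b + - (p + q) * u ≡ a + - p * u + (b + - q * u)
    l = solve-∀

  s-· : ∀ i c x → s i (c · x) ≡ c · s i x
  s-· i c x = lookup-ext λ k → trans (lookup-s i (c · x) k)
    (trans (cong₂ (λ u v → u + - v * lookup (e i) k) (lookup-· c x k) (pSC-· c x i))
    (trans (l c (lookup x k) (pSC x i) (lookup (e i) k))
           (sym (trans (lookup-· c (s i x) k) (cong (c *_) (lookup-s i x k))))))
    where
    l : ∀ c a p u → c * a + - (c * p) * u ≡ c * (a + - p * u)
    l = solve-∀

  s-neg : ∀ i x → s i (neg x) ≡ neg (s i x)
  s-neg i x = trans (cong (s i) (neg-is-· x)) (trans (s-· i (- 1ℤ) x) (sym (neg-is-· (s i x))))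

  s-e : ∀ i → s i (e i) ≡ neg (e i)
  s-e i = lookup-ext λ k → trans (lookup-s i (e i) k)
    (trans (cong (λ v → lookup (e i) k + - v * lookup (e i) k) (trans (pSC-e i i) (diag i)))
    (trans (l (lookup (e i) k)) (sym (lookup-neg (e i) k))))
    where
    l : ∀ u → u + - + 2 * u ≡ - u
    l = solve-∀

  _≟V_ : (x y : V n) → Dec (x ≡ y)
  _≟V_ = Vecₚ.≡-dec ℤₚ._≟_

  -- Writing (x , x) = Σᵢ xᵢ (αᵢ , x), some summand is positive.
  abstract
    acute : ∀ {x} → (∀ i → 0ℤ ≤ lookup x i) → x ≢ 𝟘 → ∃ λ j → 0ℤ < lookup x j × 0ℤ < B (e j) x
    acute {x} x≥0 x≢𝟘 with ∑->0 (λ i → lookup x i * B (e i) x) (subst (0ℤ <_) (inner-expand x x) (inner->0 x≢𝟘))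
    ... | j , p with lookup x j ℤₚ.≟ 0ℤ
    ...   | yes z = ⊥-elim (ℤₚ.<-irrefl refl (subst (λ u → 0ℤ < u * B (e j) x) z p))
    ...   | no nz = j , xj>0 , >0-*-cancelˡ {lookup x j} {B (e j) x} xj>0 p
      where xj>0 : 0ℤ < lookup x j
            xj>0 = ℤₚ.≤∧≢⇒< (x≥0 j) (λ q → nz (sym q))

  act-⊕ : ∀ w x y → act w (x ⊕ y) ≡ act w x ⊕ act w y
  act-⊕ [] x y = refl
  act-⊕ (i ∷ w) x y = trans (cong (s i) (act-⊕ w x y)) (s-⊕ i (act w x) (act w y))

  act-· : ∀ w c x → act w (c · x) ≡ c · act w x
  act-· [] c x = refl
  act-· (i ∷ w) c x = trans (cong (s i) (act-· w c x)) (s-· i c (act w x))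

  act-neg : ∀ w x → act w (neg x) ≡ neg (act w x)
  act-neg [] x = refl
  act-neg (i ∷ w) x = trans (cong (s i) (act-neg w x)) (s-neg i (act w x))

  inner-act : ∀ w x y → B (act w x) (act w y) ≡ B x y
  inner-act [] x y = refl
  inner-act (i ∷ w) x y = trans (inner-s i (act w x) (act w y)) (inner-act w x y)

  act-++ : ∀ u w x → act (u ++ w) x ≡ act u (act w x)
  act-++ [] w x = refl
  act-++ (i ∷ u) w x = cong (s i) (act-++ u w x)

  inv : W → W
  inv = reverse

  act-inv : ∀ w x → act (inv w) (act w x) ≡ x
  act-inv [] x = refl
  act-inv (i ∷ w) x = begin
    act (inv (i ∷ w)) (s i (act w x))  ≡⟨ cong (λ u → act u (s i (act w x))) (Listₚ.unfold-reverse i w) ⟩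
    _                                            ≡⟨ act-++ (inv w) (i ∷ []) (s i (act w x)) ⟩
    act (inv w) (s i (s i (act w x)))            ≡⟨ cong (act (inv w)) (s-involutive i (act w x)) ⟩
    act (inv w) (act w x)                        ≡⟨ act-inv w x ⟩
    x ∎
    where open ≡-Reasoning

  act-inv′ : ∀ w x → act w (act (inv w) x) ≡ x
  act-inv′ w x = trans (cong (λ u → act u (act (inv w) x)) (sym (Listₚ.reverse-involutive w))) (act-inv (inv w) x)

  root-act : ∀ w {x} → IsRoot x → IsRoot (act w x)
  root-act [] r = r
  root-act (i ∷ w) r = refl-s i (root-act w r)

  root-neg : ∀ {x} → IsRoot x → IsRoot (neg x)
  root-neg (simple i) = subst IsRoot (s-e i) (refl-s i (simple i))
  root-neg (refl-s i {x} r) = subst IsRoot (s-neg i x) (refl-s i (root-neg r))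

  -- Root-like vectors: signs and decidability of roots

  lookup-sub : ∀ x y k → lookup (x ⊕ neg y) k ≡ lookup x k - lookup y k
  lookup-sub x y k = trans (lookup-⊕ x (neg y) k) (cong (λ z → lookup x k + z) (lookup-neg y k))

  inner-sub : ∀ x y → B (x ⊕ neg y) (x ⊕ neg y) ≡ B x x - + 2 * B x y + B y y
  inner-sub x y = trans (cong (λ z → B (x ⊕ z) (x ⊕ z)) (neg-is-· y)) (trans (inner-⊕·-⊕· x x y (- 1ℤ) (- 1ℤ))
    (trans (cong (λ z → B x x + - 1ℤ * z + (- 1ℤ * z + - 1ℤ * (- 1ℤ * B y y))) (inner-sym y x)) (l (B x x) (B x y) (B y y))))
    where l : ∀ a b c → a + - 1ℤ * b + (- 1ℤ * b + - 1ℤ * (- 1ℤ * c)) ≡ a - + 2 * b + c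
          l = solve-∀

  -- The numbers co are the Π^∨-coordinates of the coroot; the point is that they are integers.
  record RootLike (γ : V n) : Set where
    constructor rootLike
    field
      idx    : Fin n
      co     : Fin n → ℤ
      norm   : B γ γ ≡ + 2 * D idx
      coroot : ∀ j → D j * lookup γ j ≡ D idx * co j

  open RootLike

  -- The pairing ⟨αⱼ , c⟩ for a coroot with coordinates `c`. Together with `pSC` it gives the two
  -- Cartan integers of a root and a simple root; `coPair-B` and `inner-e` express both through the
  -- form.
  coPair : (Fin n → ℤ) → Fin n → ℤ
  coPair c j = ∑ (λ m → c m * A m j)

  coPair-B : ∀ m x (c : Fin n → ℤ) → (∀ j → D j * lookup x j ≡ m * c j) → ∀ i → m * coPair c i ≡ B (e i) x
  coPair-B m x c h i = begin
    m * coPair c i                                   ≡⟨ ∑-*ˡ m (λ k → c k * A k i) ⟨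
    ∑ (λ k → m * (c k * A k i))                   ≡⟨ (∑-cong λ k → trans (sym (ℤₚ.*-assoc m (c k) (A k i))) (trans (cong (_* A k i) (sym (h k))) (l (D k) (lookup x k) (A k i)))) ⟩
    ∑ (λ k → lookup x k * (D k * A k i))          ≡⟨ (∑-cong λ k → cong (lookup x k *_) (inner-ejx k i)) ⟨
    ∑ (λ k → lookup x k * B (e k) (e i))      ≡⟨ inner-expand x (e i) ⟨
    B x (e i)                                 ≡⟨ inner-sym x (e i) ⟩
    B (e i) x ∎
    where open ≡-Reasoning
          l : ∀ d x a → d * x * a ≡ x * (d * a)
          l = solve-∀

  D-e : ∀ i j → D j * lookup (e i) j ≡ D i * lookup (e i) j
  D-e i j with j Fin.≟ i
  ... | yes refl = refl
  ... | no j≢i = trans (cong (D j *_) (lookup-e-diff i j j≢i)) (trans (ℤₚ.*-zeroʳ (D j))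
                   (sym (trans (cong (D i *_) (lookup-e-diff i j j≢i)) (ℤₚ.*-zeroʳ (D i)))))

  -- The coroot undergoes the dual reflection c - ⟨αᵢ , c⟩ αᵢ^∨, whose coefficients are integers
  -- again.
  co-s : ∀ m x (c : Fin n → ℤ) → (∀ j → D j * lookup x j ≡ m * c j) →
         ∀ i j → D j * lookup (s i x) j ≡ m * (c j - coPair c i * lookup (e i) j)
  co-s m x c h i j = begin
    D j * lookup (s i x) j                            ≡⟨ cong (D j *_) (lookup-s i x j) ⟩
    D j * (lookup x j + - p * lookup (e i) j)         ≡⟨ l₁ (D j) (lookup x j) p (lookup (e i) j) ⟩
    D j * lookup x j - p * (D j * lookup (e i) j)     ≡⟨ cong₂ (λ u v → u - p * v) (h j) (D-e i j) ⟩
    m * c j - p * (D i * lookup (e i) j)              ≡⟨ l₂ (m * c j) p (D i) (lookup (e i) j) ⟩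
    m * c j - D i * p * lookup (e i) j                ≡⟨ cong (λ u → m * c j - u * lookup (e i) j) (trans (sym (inner-e i x)) (sym (coPair-B m x c h i))) ⟩
    m * c j - m * coPair c i * lookup (e i) j            ≡⟨ l₃ m (c j) (coPair c i) (lookup (e i) j) ⟩
    m * (c j - coPair c i * lookup (e i) j) ∎
    where
    open ≡-Reasoning
    p : ℤ
    p = pSC x i
    l₁ : ∀ d x p u → d * (x + - p * u) ≡ d * x - p * (d * u)
    l₁ = solve-∀
    l₂ : ∀ a p d u → a - p * (d * u) ≡ a - d * p * u
    l₂ = solve-∀
    l₃ : ∀ m c q u → m * c - m * q * u ≡ m * (c - q * u)
    l₃ = solve-∀

  abstract
    rootLike-s : ∀ i {x} → RootLike x → RootLike (s i x)
    rootLike-s i {x} (rootLike m c N h) = rootLike m (λ j → c j - coPair c i * lookup (e i) j) (trans (inner-s i x x) N) (co-s (D m) x c h i)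

  abstract
    root⇒rootLike : ∀ {γ} → IsRoot γ → RootLike γ
    root⇒rootLike (simple i) = rootLike i (lookup (e i)) (inner-e-e i) (D-e i)
    root⇒rootLike (refl-s i r) = rootLike-s i (root⇒rootLike r)

  rootLike-neg : ∀ {γ} → RootLike γ → RootLike (neg γ)
  rootLike-neg {γ} (rootLike m c N h) = rootLike m (λ j → - c j) (trans (inner-neg-neg γ) N) λ j →
    trans (cong (D j *_) (lookup-neg γ j)) (trans (sym (ℤₚ.neg-distribʳ-* (D j) (lookup γ j))) (trans (cong -_ (h j)) (ℤₚ.neg-distribʳ-* (D m) (c j))))

  rootLike->0 : ∀ {γ} → RootLike γ → 0ℤ < B γ γ
  rootLike->0 a = subst (0ℤ <_) (sym (norm a)) (>0-* (+ 2) (D (idx a)) (ℤ.+<+ (ℕ.s≤s ℕ.z≤n)) (D>0 (idx a)))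

  inner-𝟘 : B 𝟘 𝟘 ≡ 0ℤ
  inner-𝟘 = trans (inner-def 𝟘 𝟘) (∑-0 λ i → cong (_* (D i * pSC 𝟘 i)) (lookup-𝟘 i))

  rootLike≢𝟘 : ∀ {γ} → RootLike γ → γ ≢ 𝟘
  rootLike≢𝟘 a refl = ℤₚ.<-irrefl (sym inner-𝟘) (rootLike->0 a)

  abstract
    -- (x , x) / m is the sum of the matrix cᵢ Aᵢⱼ xⱼ. It is symmetric, although A need not be,
    -- because m times it is the summand of the form; its diagonal entries 2 cᵢ xᵢ are even. In
    -- particular, a nonzero such x has norm at least 2m.
    norm-even : ∀ x m (c : Fin n → ℤ) → 0ℤ < m → (∀ j → D j * lookup x j ≡ m * c j) → ∃ λ z → B x x ≡ m * (+ 2 * z)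
    norm-even x m c m>0 h = proj₁ ev , trans mN (cong (m *_) (proj₂ ev))
      where
      N : Fin n → Fin n → ℤ
      N i j = c i * A i j * lookup x j
      l₁ : ∀ x d a y → x * (d * a) * y ≡ d * x * a * y
      l₁ = solve-∀
      l₂ : ∀ m c a y → m * c * a * y ≡ m * (c * a * y)
      l₂ = solve-∀
      l₃ : ∀ c x → c * + 2 * x ≡ + 2 * (c * x)
      l₃ = solve-∀
      l₄ : ∀ x a y → x * a * y ≡ y * a * x
      l₄ = solve-∀
      term : ∀ i j → lookup x i * (D i * A i j) * lookup x j ≡ m * N i j
      term i j = trans (l₁ (lookup x i) (D i) (A i j) (lookup x j)) (trans (cong (λ u → u * A i j * lookup x j) (h i)) (l₂ m (c i) (A i j) (lookup x j)))
      mN : B x x ≡ m * ∑ (λ i → ∑ (N i))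
      mN = trans (B≡inner x x) (trans (∑-cong λ i → trans (∑-cong (term i)) (∑-*ˡ m (N i))) (∑-*ˡ m (λ i → ∑ (N i))))
      N-sym : ∀ i j → N i j ≡ N j i
      N-sym i j = *-cancel-pos {m} {N i j} {N j i} m>0 (trans (sym (term i j)) (trans (trans (cong (λ u → lookup x i * u * lookup x j) (symm i j)) (l₄ (lookup x i) (D j * A j i) (lookup x j))) (term j i)))
      ev : ∃ λ z → ∑ (λ i → ∑ (N i)) ≡ + 2 * z
      ev = ∑∑-even N N-sym λ i → c i * lookup x i , trans (cong (λ u → c i * u * lookup x i) (diag i)) (l₃ (c i) (lookup x i))

  -- Disjoint supports kill the diagonal terms, and the off-diagonal Cartan entries are nonpositive.
  obtuse : ∀ {a b} → NN a → NN b → (∀ i → lookup a i * lookup b i ≡ 0ℤ) → 0ℤ ≤ - B a b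
  obtuse {a} {b} a≥0 b≥0 ab≡0 = 0≤-resp (∑-≥0 λ i → 0≤-resp (∑-≥0 (at i)) (∑-*ˡ (- 1ℤ) (T i)))
    (trans (∑-*ˡ (- 1ℤ) (λ i → ∑ (λ j → T i j))) (trans (ℤₚ.-1*i≡-i (inner a b)) (cong -_ (sym (B≡inner a b)))))
    where
    T : Fin n → Fin n → ℤ
    T i j = lookup a i * (D i * A i j) * lookup b j
    l₁ : ∀ a d x b → a * (d * (0ℤ - x)) * b ≡ - 1ℤ * (a * (d * x) * b)
    l₁ = solve-∀
    l₂ : ∀ a d x b → a * b * (- d * x) ≡ - 1ℤ * (a * (d * x) * b)
    l₂ = solve-∀
    at : ∀ i j → 0ℤ ≤ - 1ℤ * T i j
    at i j with i Fin.≟ j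
    ... | yes refl = ℤₚ.≤-reflexive (trans (sym (cong (_* (- D i * A i i)) (ab≡0 i))) (l₂ (lookup a i) (D i) (A i i) (lookup b i)))
    ... | no i≢j = 0≤-resp (nonneg a≥0 i ⊠ (ℤₚ.<⇒≤ (D>0 i) ⊠ ≤→0≤ {A i j} {0ℤ} (offdiag i j i≢j)) ⊠ nonneg b≥0 j) (l₁ (lookup a i) (D i) (A i j) (lookup b j))

  module Parts (γ : V n) (m : Fin n) (c : Fin n → ℤ) (N : B γ γ ≡ + 2 * D m) (h : ∀ j → D j * lookup γ j ≡ D m * c j) where
    a b : V n
    a = tabulate (posPart ∘ lookup γ)
    b = tabulate (negPart ∘ lookup γ)
    la : ∀ i → lookup a i ≡ posPart (lookup γ i)
    la = Vecₚ.lookup∘tabulate _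
    lb : ∀ i → lookup b i ≡ negPart (lookup γ i)
    lb = Vecₚ.lookup∘tabulate _
    γ≡ : γ ≡ a ⊕ neg b
    γ≡ = lookup-ext λ i → trans (pos+neg (lookup γ i)) (sym (trans (lookup-sub a b i) (cong₂ _-_ (la i) (lb i))))
    ha : ∀ j → D j * lookup a j ≡ D m * posPart (c j)
    ha j = trans (cong (D j *_) (la j)) (trans (sym (posPart-* (d j) (lookup γ j))) (trans (cong posPart (h j)) (posPart-* (d m) (c j))))
    hb : ∀ j → D j * lookup b j ≡ D m * negPart (c j)
    hb j = trans (cong (D j *_) (lb j)) (trans (sym (negPart-* (d j) (lookup γ j))) (trans (cong negPart (h j)) (negPart-* (d m) (c j))))
    ea = norm-even a (D m) (λ j → posPart (c j)) (D>0 m) ha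
    eb = norm-even b (D m) (λ j → negPart (c j)) (D>0 m) hb
    ob : 0ℤ ≤ - B a b
    ob = obtuse {a} {b} (nn λ i → subst (0ℤ ≤_) (sym (la i)) (posPart≥0 (lookup γ i))) (nn λ i → subst (0ℤ ≤_) (sym (lb i)) (negPart≥0 (lookup γ i)))
                (λ i → trans (cong₂ _*_ (la i) (lb i)) (pos*neg (lookup γ i)))
    tot : + 2 * D m ≡ D m * (+ 2 * proj₁ ea) - + 2 * B a b + D m * (+ 2 * proj₁ eb)
    tot = trans (sym N) (trans (cong (λ z → B z z) γ≡) (trans (inner-sub a b) (cong₂ (λ u v → u - + 2 * B a b + v) (proj₂ ea) (proj₂ eb))))
    z>0 : ∀ x z → x ≢ 𝟘 → B x x ≡ D m * (+ 2 * z) → 0ℤ < z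
    z>0 x z ne q = >0-*-cancelˡ {+ 2} {z} (ℤ.+<+ (ℕ.s≤s ℕ.z≤n)) (>0-*-cancelˡ {D m} {+ 2 * z} (D>0 m) (subst (0ℤ <_) q (inner->0 {x} ne)))
    -- Certificate that 2m = 2mu - 2w + 2mv is impossible for m, u, v ≥ 1 and w ≤ 0: the right-hand
    -- side is at least 4m. After cancellation the nonnegative summands add up to -2.
    l : ∀ m u v w → m * (u - 0ℤ - 1ℤ) + m * (v - 0ℤ - 1ℤ) + - w + - w + m * (u - 0ℤ - 1ℤ) + m * (v - 0ℤ - 1ℤ) + (m - 0ℤ - 1ℤ) + (m - 0ℤ - 1ℤ)
                    + (+ 2 * m - (m * (+ 2 * u) - + 2 * w + m * (+ 2 * v))) ≡ -[1+ 1 ]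
    l = solve-∀
    contra : a ≢ 𝟘 → b ≢ 𝟘 → ⊥
    contra na nb = 0≤⇒neg-absurd
        (ma ⊞ mb ⊞ ob ⊞ ob ⊞ ma ⊞ mb ⊞ <→0≤ (D>0 m) ⊞ <→0≤ (D>0 m) ⊞ ≡→0≤ tot)
        1 (l (D m) (proj₁ ea) (proj₁ eb) (B a b))
        where ma = ℤₚ.<⇒≤ (D>0 m) ⊠ <→0≤ (z>0 a (proj₁ ea) na (proj₂ ea))
              mb = ℤₚ.<⇒≤ (D>0 m) ⊠ <→0≤ (z>0 b (proj₁ eb) nb (proj₂ eb))

  -- If both the positive part a and the negative part b of γ were nonzero, each of (a , a) and (b , b)
  -- would be a positive multiple of (γ , γ), whereas (a , b) ≤ 0.
  abstract
    rootLike-sign : ∀ {γ} → RootLike γ → NN γ ⊎ NN (neg γ)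
    rootLike-sign {γ} (rootLike m c N h) with Parts.a γ m c N h ≟V 𝟘 | Parts.b γ m c N h ≟V 𝟘
    ... | yes a≡𝟘 | _ = inj₂ (nn λ i → subst (0ℤ ≤_) (sym (lookup-neg γ i)) (ℤₚ.neg-mono-≤ (posPart≡0 (lookup γ i)
                          (trans (sym (Parts.la γ m c N h i)) (trans (cong (λ z → lookup z i) a≡𝟘) (lookup-𝟘 i))))))
    ... | no _ | yes b≡𝟘 = inj₁ (nn λ i → negPart≡0 (lookup γ i)
                          (trans (sym (Parts.lb γ m c N h i)) (trans (cong (λ z → lookup z i) b≡𝟘) (lookup-𝟘 i))))
    ... | no na | no nb = ⊥-elim (Parts.contra γ m c N h na nb)

  0≤-⇒≤0 : ∀ z → 0ℤ ≤ - z → z ≤ 0ℤ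
  0≤-⇒≤0 (+ zero) h = ℤₚ.≤-refl
  0≤-⇒≤0 -[1+ k ] h = ℤ.-≤+

  ≤0⇒0≤- : ∀ z → z ≤ 0ℤ → 0ℤ ≤ - z
  ≤0⇒0≤- (+ zero) h = ℤₚ.≤-refl
  ≤0⇒0≤- +[1+ k ] (+≤+ ())
  ≤0⇒0≤- -[1+ k ] h = +≤+ ℕ.z≤n

  NN-neg⇒≤0 : ∀ x → NN (neg x) → ∀ i → lookup x i ≤ 0ℤ
  NN-neg⇒≤0 x h i = 0≤-⇒≤0 (lookup x i) (subst (0ℤ ≤_) (lookup-neg x i) (nonneg h i))

  NN-antisym : ∀ {x} → NN x → NN (neg x) → x ≡ 𝟘
  NN-antisym {x} p q = lookup-ext λ i → trans (ℤₚ.≤-antisym (NN-neg⇒≤0 x q i) (nonneg p i)) (sym (lookup-𝟘 i))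

  NN-e : ∀ i → NN (e i)
  NN-e i = nn (lookup-e-≥0 i)

  *≡1⇒≡1 : ∀ {a b} → 0ℤ ≤ a → a * b ≡ 1ℤ → a ≡ 1ℤ
  *≡1⇒≡1 {a} {b} a≥0 h = trans (sym (ℤₚ.0≤i⇒+∣i∣≡i a≥0))
    (cong +_ (ℕₚ.m*n≡1⇒m≡1 ∣ a ∣ ∣ b ∣ (trans (sym (ℤₚ.abs-* a b)) (cong ∣_∣ h))))

  -- If γ = kαⱼ, its norm is 2k(Dⱼk) = 2k(D_m cⱼ) and also 2D_m. Hence k cⱼ = 1 in the integers, and
  -- k ≥ 0 leaves only k = 1.
  rootLike-single : ∀ {γ} j → RootLike γ → NN γ → (∀ k → k ≢ j → lookup γ k ≡ 0ℤ) → γ ≡ e j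
  rootLike-single {γ} j (rootLike m c N h) γ≥0 z = trans γ≡ (trans (cong (_· e j) k≡1) (lookup-ext λ i → trans (lookup-· 1ℤ (e j) i) (ℤₚ.*-identityˡ (lookup (e j) i))))
    where
    k = lookup γ j
    at : ∀ i → lookup γ i ≡ lookup (k · e j) i
    at i with i Fin.≟ j
    ... | yes refl = sym (trans (lookup-· k (e j) i) (trans (cong (k *_) (lookup-e-same j)) (ℤₚ.*-identityʳ k)))
    ... | no i≢j = trans (z i i≢j) (sym (trans (lookup-· k (e j) i) (trans (cong (k *_) (lookup-e-diff j i i≢j)) (ℤₚ.*-zeroʳ k))))
    γ≡ : γ ≡ k · e j
    γ≡ = lookup-ext at
    l₁ : ∀ k d → k * (k * (+ 2 * d)) ≡ + 2 * (k * (d * k))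
    l₁ = solve-∀
    l₂ : ∀ k m c → + 2 * (k * (m * c)) ≡ + 2 * (m * (k * c))
    l₂ = solve-∀
    eq : + 2 * (D m * 1ℤ) ≡ + 2 * (D m * (k * c j))
    eq = trans (cong (+ 2 *_) (ℤₚ.*-identityʳ (D m))) (trans (sym N) (trans (cong (λ x → B x x) γ≡) (trans (inner-·ˡ k (e j) (k · e j)) (trans (cong (k *_) (trans (inner-·ʳ (e j) k (e j)) (cong (k *_) (inner-e-e j))))
         (trans (l₁ k (D j)) (trans (cong (λ u → + 2 * (k * u)) (h j)) (l₂ k (D m) (c j))))))))
    k≡1 : k ≡ 1ℤ
    k≡1 = *≡1⇒≡1 (nonneg γ≥0 j) (sym (*-cancel-pos {D m} {1ℤ} {k * c j} (D>0 m) (*-cancel-pos {+ 2} {D m * 1ℤ} {D m * (k * c j)} (ℤ.+<+ (ℕ.s≤s ℕ.z≤n)) eq)))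

  -- sᵢ changes only the i-th coordinate. If the sign flipped, all other coordinates would vanish,
  -- and γ would be αᵢ.
  rootLike-s-NN : ∀ {γ} i → RootLike γ → NN γ → γ ≢ e i → NN (s i γ)
  rootLike-s-NN {γ} i a γ≥0 ne = fromSign (rootLike-sign (rootLike-s i a))
    where
    support : NN (neg (s i γ)) → ∀ k → k ≢ i → lookup γ k ≡ 0ℤ
    support q k k≢i = ℤₚ.≤-antisym (subst (_≤ 0ℤ) (lookup-s-diff i γ k k≢i) (NN-neg⇒≤0 (s i γ) q k)) (nonneg γ≥0 k)
    fromSign : NN (s i γ) ⊎ NN (neg (s i γ)) → NN (s i γ)
    fromSign (inj₁ p) = p
    fromSign (inj₂ q) = ⊥-elim (ne (rootLike-single {γ} i a γ≥0 (support q)))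

  height-s : ∀ i x → height (s i x) ≡ height x - pSC x i
  height-s i x = trans (∑-cong (lookup-s i x)) (trans (∑-+ (lookup x) (λ k → (- pSC x i) * lookup (e i) k)) (cong (λ z → height x + z) (∑-e (λ _ → - pSC x i) i)))

  pSC>0 : ∀ {x i} → 0ℤ < B (e i) x → 0ℤ < pSC x i
  pSC>0 {x} {i} p = >0-*-cancelˡ {D i} {pSC x i} (D>0 i) (subst (0ℤ <_) (inner-e i x) p)

  -- Reflecting in an acute simple root lowers the height and keeps a non-simple vector root-like
  -- and nonnegative. The descent ends at a simple root, and running it backwards builds the
  -- derivation of `IsRoot`.
  rootLike-NN⇒root : ∀ N {γ} → height γ ≤ + N → RootLike γ → NN γ → IsRoot γ
  rootLike-NN⇒root N {γ} hN a γ≥0 with acute {γ} (nonneg γ≥0) (rootLike≢𝟘 a)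
  ... | j , γj>0 , p with γ ≟V e j
  ...   | yes refl = simple j
  rootLike-NN⇒root zero {γ} hN a γ≥0 | j , γj>0 , p | no ne =
    ⊥-elim (ℤₚ.<-irrefl (sym (∑-≥0-≡0 (nonneg γ≥0) (ℤₚ.≤-antisym hN (∑-≥0 (nonneg γ≥0))) j)) γj>0)
  rootLike-NN⇒root (suc N) {γ} hN a γ≥0 | j , γj>0 , p | no ne =
    subst IsRoot (s-involutive j γ) (refl-s j (rootLike-NN⇒root N le (rootLike-s j a) (rootLike-s-NN j a γ≥0 ne)))
    where
    l : ∀ h p N → 1ℤ + N - h + (p - 0ℤ - 1ℤ) ≡ N - (h - p)
    l = solve-∀
    le : height (s j γ) ≤ + N
    le = 0≤→≤ (0≤-resp (≤→0≤ hN ⊞ <→0≤ (pSC>0 {γ} p))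
                       (trans (l (height γ) (pSC γ j) (+ N)) (cong (λ u → + N - u) (sym (height-s j γ)))))

  abstract
    rootLike⇒root : ∀ {γ} → RootLike γ → IsRoot γ
    rootLike⇒root {γ} a with rootLike-sign a
    ... | inj₁ p = rootLike-NN⇒root ∣ height γ ∣ (ℤₚ.≤-reflexive (sym (ℤₚ.0≤i⇒+∣i∣≡i (∑-≥0 (nonneg p))))) a p
    ... | inj₂ p = subst IsRoot (neg-involutive γ) (root-neg (rootLike-NN⇒root ∣ height (neg γ) ∣ (ℤₚ.≤-reflexive (sym (ℤₚ.0≤i⇒+∣i∣≡i (∑-≥0 (nonneg p))))) (rootLike-neg a) p))

  abstract
    -- No search for the coroot is required: its coordinates are the quotients produced by the
    -- divisibility tests.
    isRoot? : ∀ γ → Dec (IsRoot γ)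
    isRoot? γ = map′ to from (Finₚ.any? λ i → (B γ γ ℤₚ.≟ + 2 * D i) ×-dec Finₚ.all? (λ j → D i Div.∣? D j * lookup γ j))
      where
      Criterion : Set
      Criterion = ∃ λ i → B γ γ ≡ + 2 * D i × (∀ j → D i Div.∣ D j * lookup γ j)
      to : Criterion → IsRoot γ
      to (i , N , h) = rootLike⇒root (rootLike i (λ j → Div._∣_.quotient (h j)) N
        λ j → trans (Div._∣_.equality (h j)) (ℤₚ.*-comm (Div._∣_.quotient (h j)) (D i)))
      from : IsRoot γ → Criterion
      from r = fromAdm (root⇒rootLike r)
        where fromAdm : RootLike γ → Criterion
              fromAdm (rootLike i c N h) = i , N , λ j → Div.divides (c j) (trans (h j) (ℤₚ.*-comm (D i) (c j)))

  root-sign : ∀ {γ} → IsRoot γ → NN γ ⊎ NN (neg γ)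
  root-sign r = rootLike-sign (root⇒rootLike r)

  root≢𝟘 : ∀ {γ} → IsRoot γ → γ ≢ 𝟘
  root≢𝟘 r = rootLike≢𝟘 (root⇒rootLike r)

  root-s-NN : ∀ {γ} i → IsRoot γ → NN γ → γ ≢ e i → NN (s i γ)
  root-s-NN i r = rootLike-s-NN i (root⇒rootLike r)

  -- Adding and subtracting a simple root

  sub≡𝟘 : ∀ {x y : V n} → x ⊕ neg y ≡ 𝟘 → x ≡ y
  sub≡𝟘 {x} {y} p = lookup-ext λ i → ℤₚ.i-j≡0⇒i≡j (lookup x i) (lookup y i) (trans (sym (lookup-sub x y i)) (trans (cong (λ z → lookup z i) p) (lookup-𝟘 i)))

  -- One of the Cartan integers k = (γ , αⱼ^∨) and l = (αⱼ , γ^∨) equals 1: if both were at least 2,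
  -- then γ - αⱼ would have norm ≤ 0. For k = 1 the difference is sⱼγ. For l = 1 it is minus the
  -- reflection of αⱼ in γ, with coroot kγ^∨ - αⱼ^∨.
  rootLike-sub : ∀ {γ} j → RootLike γ → 0ℤ < B (e j) γ → γ ≢ e j → RootLike (γ ⊕ neg (e j))
  rootLike-sub {γ} j a@(rootLike i c N h) p ne with pSC γ j ℤₚ.≟ 1ℤ
  ... | yes k≡1 = subst RootLike (trans (s-def j γ) (cong (γ ⊕_) (trans (cong (λ u → (- u) · e j) k≡1) (sym (neg-is-· (e j)))))) (rootLike-s j a)
  ... | no k≢1 with coPair c j ℤₚ.≟ 1ℤ
  ...   | yes l≡1 = (rootLike j (λ m → c m * k - lookup (e j) m) Nx hx)
    where
    k = pSC γ j
    Di≡ : D i ≡ D j * k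
    Di≡ = trans (sym (ℤₚ.*-identityʳ (D i))) (trans (cong (D i *_) (sym l≡1)) (trans (coPair-B (D i) γ c h j) (inner-e j γ)))
    l : ∀ d k → + 2 * (d * k) - + 2 * (d * k) + + 2 * d ≡ + 2 * d
    l = solve-∀
    Nx : B (γ ⊕ neg (e j)) (γ ⊕ neg (e j)) ≡ + 2 * D j
    Nx = trans (inner-sub γ (e j)) (trans (cong₂ (λ u v → u - + 2 * v + B (e j) (e j)) (trans N (cong (+ 2 *_) Di≡)) (trans (inner-sym γ (e j)) (inner-e j γ)))
         (trans (cong (λ u → + 2 * (D j * k) - + 2 * (D j * k) + u) (inner-e-e j)) (l (D j) k)))
    l₂ : ∀ d k c u → d * k * c - d * u ≡ d * (c * k - u)
    l₂ = solve-∀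
    l₃ : ∀ a b c → a * (b - c) ≡ a * b - a * c
    l₃ = solve-∀
    hx : ∀ m → D m * lookup (γ ⊕ neg (e j)) m ≡ D j * (c m * k - lookup (e j) m)
    hx m = trans (cong (D m *_) (lookup-sub γ (e j) m)) (trans (l₃ (D m) (lookup γ m) (lookup (e j) m))
           (trans (cong₂ _-_ (trans (h m) (cong (_* c m) Di≡)) (D-e j m)) (l₂ (D j) k (c m) (lookup (e j) m))))
  ...   | no l≢1 = ⊥-elim (0≤⇒neg-absurd (<→0≤ pos
                     ⊞ ℤₚ.<⇒≤ (D>0 i) ⊠ l≥2 ⊞ ℤₚ.<⇒≤ (D>0 j) ⊠ k≥2 ⊞ ≡→0≤ (trans (sym (inner-e j γ)) (sym (coPair-B (D i) γ c h j))))
                     0 (fin (D i) (D j) k (coPair c j)))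
    where
    k = pSC γ j
    k>0 : 0ℤ < k
    k>0 = pSC>0 {γ} p
    ≥2 : ∀ {z} → 0ℤ < z → z ≢ 1ℤ → 0ℤ ≤ z - + 2
    ≥2 {z} z>0 z≢1 = 0≤-resp (<→0≤ (ℤₚ.≤∧≢⇒< (ℤₚ.i<j⇒suc[i]≤j z>0) (z≢1 ∘ sym))) (t z)
      where t : ∀ z → z - 1ℤ - 1ℤ ≡ z - + 2
            t = solve-∀
    k≥2 = ≥2 {k} k>0 k≢1
    l≥2 = ≥2 {coPair c j} (>0-*-cancelˡ {D i} {coPair c j} (D>0 i) (subst (0ℤ <_) (sym (coPair-B (D i) γ c h j)) p)) l≢1
    pos : 0ℤ < + 2 * D i - + 2 * (D j * k) + + 2 * D j
    pos = subst (0ℤ <_) (trans (inner-sub γ (e j)) (trans (cong₂ (λ u v → u - + 2 * v + B (e j) (e j)) N (trans (inner-sym γ (e j)) (inner-e j γ)))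
          (cong (λ u → + 2 * D i - + 2 * (D j * k) + u) (inner-e-e j)))) (inner->0 (ne ∘ sub≡𝟘))
    fin : ∀ m d k l → + 2 * m - + 2 * (d * k) + + 2 * d - 0ℤ - 1ℤ + m * (l - + 2) + d * (k - + 2) + (d * k - m * l) ≡ -[1+ 0 ]
    fin = solve-∀

  root-sub : ∀ {γ} j → IsRoot γ → 0ℤ < B (e j) γ → γ ≢ e j → IsRoot (γ ⊕ neg (e j))
  root-sub j r p ne = rootLike⇒root (rootLike-sub j (root⇒rootLike r) p ne)

  neg-sub : ∀ x y → neg (neg x ⊕ neg y) ≡ x ⊕ y
  neg-sub x y = lookup-ext λ i → trans (lookup-neg (neg x ⊕ neg y) i) (trans (cong -_ (trans (lookup-⊕ (neg x) (neg y) i) (cong₂ _+_ (lookup-neg x i) (lookup-neg y i))))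
    (trans (l (lookup x i) (lookup y i)) (sym (lookup-⊕ x y i))))
    where l : ∀ a b → - (- a + - b) ≡ a + b
          l = solve-∀

  root-add : ∀ {γ} j → IsRoot γ → B (e j) γ < 0ℤ → γ ≢ neg (e j) → IsRoot (γ ⊕ e j)
  root-add {γ} j r p ne = subst IsRoot (neg-sub γ (e j)) (root-neg (root-sub j (root-neg r)
    (subst (0ℤ <_) (sym (inner-negʳ (e j) γ)) (ℤₚ.neg-mono-< p)) (λ q → ne (trans (sym (neg-involutive γ)) (cong neg q)))))

  -- Exchange condition; elements preserving positivity act trivially

  conj : ∀ u i j → act u (e i) ≡ e j → ∀ x → act u (s i x) ≡ s j (act u x)
  conj u i j h x = trans (cong (act u) (s-def i x)) (trans (act-⊕ u x ((- pSC x i) · e i)) (trans (cong (act u x ⊕_) (trans (act-· u (- pSC x i) (e i)) (cong₂ (λ a b → (- a) · b) pp h)))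
    (sym (s-def j (act u x)))))
    where
    DD : + 2 * D i ≡ + 2 * D j
    DD = trans (sym (inner-e-e i)) (trans (sym (inner-act u (e i) (e i))) (trans (cong (λ z → B z z) h) (inner-e-e j)))
    pp : pSC x i ≡ pSC (act u x) j
    pp = *-cancel-pos {D i} {pSC x i} {pSC (act u x) j} (D>0 i) (trans (sym (inner-e i x)) (trans (sym (inner-act u (e i) x)) (trans (cong (λ z → B z (act u x)) h)
         (trans (inner-e j (act u x)) (cong (_* pSC (act u x) j) (sym (*-cancel-pos {+ 2} {D i} {D j} (ℤ.+<+ (ℕ.s≤s ℕ.z≤n)) DD)))))))

  abstract
    -- Reading the word from the right, some letter j first makes the image of αᵢ negative. Just
    -- before it the image is αⱼ, so by `conj` the reflection sᵢ moves through as sⱼ and cancels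
    -- that letter.
    exchange : ∀ u i → ¬ NN (act u (e i)) → ∃ λ v → length v ℕ.< length u × (∀ x → act u (s i x) ≡ act v x)
    exchange [] i h = ⊥-elim (h (NN-e i))
    exchange (j ∷ u) i h with NN? (act u (e i))
    ... | no h′ = let (v , lt , q) = exchange u i h′ in j ∷ v , ℕ.s≤s lt , λ x → cong (s j) (q x)
    ... | yes h′ with act u (e i) ≟V e j
    ...   | yes q = u , ℕₚ.≤-refl , λ x → trans (cong (s j) (conj u i j q x)) (s-involutive j (act u x))
    ...   | no q = ⊥-elim (h (root-s-NN j (root-act u (simple i)) h′ q))

  -- If u = u′sᵢ, then uαᵢ = -u′αᵢ ≥ 0 makes u′αᵢ negative, and `exchange` yields a shorter word
  -- with the same action.
  NN⇒trivial : ∀ N u → length u ℕ.≤ N → (∀ i → NN (act u (e i))) → ∀ x → act u x ≡ x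
  NN⇒trivial N u le h x with initLast u
  ... | [] = refl
  ... | u′ ∷ʳ′ i with exchange u′ i (λ p → root≢𝟘 (root-act u′ (simple i)) (NN-antisym p (subst NN neg≡ (h i))))
    where neg≡ : act (u′ ∷ʳ i) (e i) ≡ neg (act u′ (e i))
          neg≡ = trans (act-++ u′ (i ∷ []) (e i)) (trans (cong (act u′) (s-e i)) (act-neg u′ (e i)))
  NN⇒trivial zero _ le h x | u′ ∷ʳ′ i | v , lt , q = ⊥-elim (ℕₚ.n≮0 (ℕₚ.<-≤-trans (ℕₚ.≤-<-trans ℕ.z≤n (ℕₚ.n<1+n _)) (subst (ℕ._≤ 0) (Listₚ.length-++-sucʳ u′ i []) le)))
  NN⇒trivial (suc N) _ le h x | u′ ∷ʳ′ i | v , lt , q = trans (uv x) (NN⇒trivial N v le′ (λ k → subst NN (uv (e k)) (h k)) x)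
    where
    uv : ∀ x → act (u′ ∷ʳ i) x ≡ act v x
    uv x = trans (act-++ u′ (i ∷ []) x) (q x)
    le′ : length v ℕ.≤ N
    le′ = ℕₚ.≤-trans (ℕₚ.<⇒≤ lt) (ℕₚ.≤-pred (subst (ℕ._≤ suc N) (trans (Listₚ.length-++-sucʳ u′ i []) (cong (suc ∘ length) (Listₚ.++-identityʳ u′))) le))

-- The highest root and the grading by θ^∨

module HighestRoot {n : ℕ} (C : CartanData n) (θ θv : V n) (H : RS.IsHighest C θ) (Hv : RS.IsCorootOf C θ θv) where
  open RootSystem C public
  open WithTheta θ θv public
  open RootLike using (idx; norm)

  θ-root : IsRoot θ
  θ-root = proj₁ H

  θ-rootLike : RootLike θ
  θ-rootLike = root⇒rootLike θ-root

  -- Half the norm of θ; multiplication by it turns the pairing with θ^∨ into the form with θ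
  -- (`M*p`).
  M : ℤ
  M = D (idx θ-rootLike)

  M>0 : 0ℤ < M
  M>0 = D>0 (idx θ-rootLike)

  θ-norm : B θ θ ≡ + 2 * M
  θ-norm = norm θ-rootLike

  θ-co : ∀ j → M * lookup θv j ≡ D j * lookup θ j
  θ-co j = *-cancel-pos {+ 2} {M * lookup θv j} {D j * lookup θ j} 2>0
    (trans (sym (ℤₚ.*-assoc (+ 2) M (lookup θv j))) (trans (cong (_* lookup θv j) (trans (sym θ-norm) (B≡inner θ θ)))
    (trans (Hv j) (trans (cong (_* lookup θ j) (ℤₚ.pos-* 2 (d j))) (ℤₚ.*-assoc (+ 2) (D j) (lookup θ j))))))

  abstract
    p : V n → ℤ
    p γ = pair γ θv

    p≡pair : ∀ γ → p γ ≡ pair γ θv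
    p≡pair γ = refl

    M*p : ∀ γ → M * p γ ≡ B γ θ
    M*p γ = trans (sym (∑-*ˡ M (λ i → lookup θv i * pairSimpleCo γ i))) (trans (∑-cong at) (trans (sym (inner-def θ γ)) (inner-sym θ γ)))
      where
      at : ∀ i → M * (lookup θv i * pairSimpleCo γ i) ≡ lookup θ i * (D i * pSC γ i)
      at i = trans (sym (ℤₚ.*-assoc M (lookup θv i) (pairSimpleCo γ i))) (trans (cong₂ _*_ (θ-co i) (sym (pSC≡pair γ i))) (l (D i) (lookup θ i) (pSC γ i)))
        where l : ∀ d x q → d * x * q ≡ x * (d * q)
              l = solve-∀

  p-via-B : ∀ x z → B x θ ≡ M * z → p x ≡ z
  p-via-B x z h = *-cancel-pos {M} {p x} {z} M>0 (trans (M*p x) h)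

  p-⊕ : ∀ x y → p (x ⊕ y) ≡ p x + p y
  p-⊕ x y = p-via-B (x ⊕ y) (p x + p y) (trans (inner-⊕ˡ x y θ) (trans (cong₂ _+_ (sym (M*p x)) (sym (M*p y))) (sym (ℤₚ.*-distribˡ-+ M (p x) (p y)))))

  p-neg : ∀ x → p (neg x) ≡ - p x
  p-neg x = p-via-B (neg x) (- p x) (trans (inner-negˡ x θ) (trans (cong -_ (sym (M*p x))) (ℤₚ.neg-distribʳ-* M (p x))))

  p-θ : p θ ≡ + 2
  p-θ = p-via-B θ (+ 2) (trans θ-norm (ℤₚ.*-comm (+ 2) M))

  below-θ : ∀ {γ} → IsRoot γ → NN (θ ⊕ neg γ)
  below-θ {γ} r = nn λ i → subst (0ℤ ≤_) (sym (lookup-sub θ γ i)) (≤→0≤ (proj₂ H γ r i))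

  θ-dominant : ∀ i → 0ℤ ≤ B (e i) θ
  θ-dominant i = subst (0ℤ ≤_) (sym (inner-e i θ)) (ℤₚ.<⇒≤ (D>0 i) ⊠ 0≤-resp (≤→0≤ (proj₂ H (s i θ) (refl-s i θ-root) i))
    (trans (cong (λ z → lookup θ i - z) (lookup-s-same i θ)) (l (lookup θ i) (pSC θ i))))
    where l : ∀ a b → a - (a - b) ≡ b
          l = solve-∀

  θ-NN : NN θ
  θ-NN = [ (λ h → h) , (λ h → ⊥-elim (contra h)) ]′ (root-sign θ-root)
    where contra : ¬ NN (neg θ)
          contra h with ℤₚ.≤-trans (subst (_≤ lookup θ (idx θ-rootLike)) (lookup-e-same (idx θ-rootLike)) (proj₂ H _ (simple (idx θ-rootLike)) (idx θ-rootLike)))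
                                   (NN-neg⇒≤0 θ h (idx θ-rootLike))
          ... | +≤+ ()

  B-NN : ∀ {x y} → NN x → (∀ i → 0ℤ ≤ B (e i) y) → 0ℤ ≤ B x y
  B-NN {x} {y} hx hy = subst (0ℤ ≤_) (sym (inner-expand x y)) (∑-≥0 λ i → nonneg hx i ⊠ hy i)

  p-NN : ∀ {x} → NN x → 0ℤ ≤ p x
  p-NN {x} h = ≥0-*-cancelˡ {M} {p x} M>0 (subst (0ℤ ≤_) (sym (M*p x)) (B-NN h θ-dominant))

  dominant? : ∀ x → (∃ λ i → B (e i) x < 0ℤ) ⊎ (∀ i → 0ℤ ≤ B (e i) x)
  dominant? x with Finₚ.any? (λ i → B (e i) x ℤₚ.<? 0ℤ)
  ... | yes h = inj₁ h
  ... | no h = inj₂ λ i → ℤₚ.≮⇒≥ (λ q → h (i , q))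

  height-⊕ : ∀ (x y : V n) → height (x ⊕ y) ≡ height x + height y
  height-⊕ x y = trans (∑-cong (lookup-⊕ x y)) (∑-+ (lookup x) (lookup y))

  height-neg : ∀ (x : V n) → height (neg x) ≡ - height x
  height-neg x = trans (∑-cong λ i → trans (lookup-neg x i) (sym (ℤₚ.-1*i≡-i (lookup x i)))) (trans (∑-*ˡ (- 1ℤ) (lookup x)) (ℤₚ.-1*i≡-i (height x)))

  height-NN : ∀ {x : V n} → NN x → 0ℤ ≤ height x
  height-NN h = ∑-≥0 (nonneg h)

  height-below-θ : ∀ {γ} → IsRoot γ → 0ℤ ≤ height θ - height γ
  height-below-θ {γ} r = 0≤-resp (height-NN (below-θ r)) (trans (height-⊕ θ (neg γ)) (cong (λ z → height θ + z) (height-neg γ)))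

  -- Reflecting in a simple root that pairs negatively with γ raises γ, so θ is reached after finitely many steps.
  climb : (P : V n → Set) → (∀ γ → IsRoot γ → (∀ i → 0ℤ ≤ B (e i) γ) → P γ) →
          (∀ i γ → IsRoot γ → B (e i) γ < 0ℤ → P (s i γ) → P γ) → ∀ γ → IsRoot γ → P γ
  climb P base step γ r = go ∣ height θ - height γ ∣ γ r (ℤₚ.≤-reflexive (sym (ℤₚ.0≤i⇒+∣i∣≡i (height-below-θ r))))
    where
    l : ∀ N t h q → 1ℤ + N - (t - h) + (0ℤ - q - 1ℤ) ≡ N - (t - (h - q))
    l = solve-∀
    l₀ : ∀ t h q → 0ℤ - (t - h) + (0ℤ - q - 1ℤ) + (t - (h - q)) ≡ -[1+ 0 ]
    l₀ = solve-∀
    pSC<0 : ∀ i x → B (e i) x < 0ℤ → pSC x i < 0ℤ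
    pSC<0 i x h = ℤₚ.≰⇒> λ q → ℤₚ.<⇒≱ h (subst (0ℤ ≤_) (sym (inner-e i x)) (ℤₚ.<⇒≤ (D>0 i) ⊠ q))
    go : ∀ N γ → IsRoot γ → height θ - height γ ≤ + N → P γ
    branch : ∀ N γ → IsRoot γ → height θ - height γ ≤ + N → (∃ λ i → B (e i) γ < 0ℤ) ⊎ (∀ i → 0ℤ ≤ B (e i) γ) → P γ
    go N γ r hN = branch N γ r hN (dominant? γ)
    branch N γ r hN (inj₂ dom) = base γ r dom
    branch zero γ r hN (inj₁ (i , h)) = ⊥-elim (0≤⇒neg-absurd
      (≤→0≤ hN ⊞ <→0≤ (pSC<0 i γ h) ⊞ 0≤-resp (height-below-θ (refl-s i r)) (cong (λ z → height θ - z) (height-s i γ)))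
      0 (l₀ (height θ) (height γ) (pSC γ i)))
    branch (suc N) γ r hN (inj₁ (i , h)) = step i γ r h (go N (s i γ) (refl-s i r)
      (0≤→≤ (0≤-resp (≤→0≤ hN ⊞ <→0≤ (pSC<0 i γ h)) (trans (l (+ N) (height θ) (height γ) (pSC γ i)) (cong (λ z → + N - (height θ - z)) (sym (height-s i γ)))))))

  dominant-norm : ∀ γ → IsRoot γ → (∀ i → 0ℤ ≤ B (e i) γ) → B γ γ ≤ B θ γ
  dominant-norm γ r dom = 0≤→≤ (0≤-resp (B-NN (below-θ r) dom) (trans (inner-⊕ˡ θ (neg γ) γ) (cong (λ z → B θ γ + z) (inner-negˡ γ γ))))

  -- For dominant γ the nonnegative vector θ - γ pairs nonnegatively with γ and with θ, so (γ , γ) ≤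
  -- (θ , γ) ≤ (θ , θ). Reflections do not change the norm.
  longest : ∀ γ → IsRoot γ → B γ γ ≤ B θ θ
  longest = climb (λ γ → B γ γ ≤ B θ θ)
    (λ γ r dom → ℤₚ.≤-trans (dominant-norm γ r dom) (0≤→≤ (0≤-resp (B-NN (below-θ r) θ-dominant)
      (trans (inner-⊕ˡ θ (neg γ) θ) (cong (λ z → B θ θ + z) (trans (inner-negˡ γ θ) (cong -_ (inner-sym γ θ))))))))
    (λ i γ r _ h → subst (_≤ B θ θ) (inner-s i γ γ) h)

  -- Positive definiteness at γ - θ, whose norm is at most M · 2(2 - `p γ`).
  p<2 : ∀ {γ} → B γ γ ≤ B θ θ → γ ≢ θ → p γ < + 2
  p<2 {γ} le ne = 0≤→< (0≤-resp (<→0≤ (>0-*-cancelˡ {+ 2} {+ 2 - p γ} 2>0 (>0-*-cancelˡ {M} {+ 2 * (+ 2 - p γ)} M>0 (ℤₚ.<-≤-trans pos bound)))) (l₀ (p γ)))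
    where
    pos : 0ℤ < B γ γ - + 2 * B γ θ + B θ θ
    pos = subst (0ℤ <_) (inner-sub γ θ) (inner->0 {γ ⊕ neg θ} (ne ∘ sub≡𝟘))
    l₀ : ∀ z → + 2 - z - 0ℤ - 1ℤ ≡ + 2 - z - 1ℤ
    l₀ = solve-∀
    l : ∀ m q → + 2 * m - + 2 * (m * q) + + 2 * m ≡ m * (+ 2 * (+ 2 - q))
    l = solve-∀
    bound : B γ γ - + 2 * B γ θ + B θ θ ≤ M * (+ 2 * (+ 2 - p γ))
    bound = ℤₚ.≤-trans (ℤₚ.+-monoˡ-≤ (B θ θ) (ℤₚ.+-monoˡ-≤ (- (+ 2 * B γ θ)) le))
      (ℤₚ.≤-reflexive (trans (cong₂ (λ u v → u - + 2 * v + u) θ-norm (sym (M*p γ))) (l M (p γ))))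

  -- The grading of Δ by θ^∨: degrees 2 and -2 contain only θ and -θ.
  data PView (γ : V n) : Set where
    is-θ  : γ ≡ θ → PView γ
    is-1  : p γ ≡ 1ℤ → PView γ
    is-0  : p γ ≡ 0ℤ → PView γ
    is--1 : p γ ≡ - 1ℤ → PView γ
    is--θ : neg γ ≡ θ → PView γ

  pView : ∀ {γ} → IsRoot γ → PView γ
  pView {γ} r with γ ≟V θ | neg γ ≟V θ
  ... | yes q | _ = is-θ q
  ... | no _ | yes q = is--θ q
  ... | no a | no b = [ is--1 , [ is-0 , is-1 ]′ ]′ (between±2 (p γ) lower (p<2 (longest γ r) a))
    where lower : - + 2 < p γ
          lower = subst (- + 2 <_) (ℤₚ.neg-involutive (p γ)) (ℤₚ.neg-mono-< (subst (_< + 2) (p-neg γ) (p<2 (longest _ (root-neg r)) b)))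

  p-1⇒NN : ∀ {γ} → IsRoot γ → p γ ≡ 1ℤ → NN γ
  p-1⇒NN {γ} r h = [ (λ q → q) , (λ q → ⊥-elim (0≤⇒neg-absurd (p-NN q) 0 (trans (p-neg γ) (cong -_ h)))) ]′ (root-sign r)

  -- Elements of W⁰ and the ideals I(w) under one reflection

  W0 : W → Set
  W0 w = ∀ α → IsRoot α → p α ≡ 0ℤ → NN α → NN (act w α)

  -- γ ∈ Δ(1) ∖ N(w)
  I : W → V n → Set
  I w γ = IsRoot γ × p γ ≡ 1ℤ × NN (act w γ)

  B-act : ∀ w γ → B (act w γ) (act w θ) ≡ M * p γ
  B-act w γ = trans (inner-act w γ θ) (sym (M*p γ))

  p-inv : ∀ w x → M * p (act (inv w) x) ≡ B x (act w θ)
  p-inv w x = trans (sym (B-act w (act (inv w) x))) (cong (λ z → B z (act w θ)) (act-inv′ w x))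

  -- The only positive root made negative by sⱼ is αⱼ. It is not in wΔ(0), since it is not
  -- orthogonal to wθ.
  W0-step : ∀ w j → W0 w → B (e j) (act w θ) ≢ 0ℤ → W0 (j ∷ w)
  W0-step w j h ne α r pα α≥0 = root-s-NN j (root-act w r) (h α r pα α≥0)
    λ q → ne (trans (cong (λ z → B z (act w θ)) (sym q)) (trans (B-act w α) (trans (cong (M *_) pα) (ℤₚ.*-zeroʳ M))))

  I-keep : ∀ w j γ → I w γ → act w γ ≢ e j → I (j ∷ w) γ
  I-keep w j γ (r , h , q) ne = r , h , root-s-NN j (root-act w r) q ne

  -- γ could be lost only if wγ = αⱼ, but then (αⱼ , wθ) = (γ , θ) = M > 0.
  I-up : ∀ w j → B (e j) (act w θ) < 0ℤ → ∀ γ → I w γ → I (j ∷ w) γ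
  I-up w j lt γ i@(r , h , q) = I-keep w j γ i λ eq → ℤₚ.<⇒≱ lt (subst (0ℤ ≤_)
    (trans (sym (trans (B-act w γ) (trans (cong (M *_) h) (ℤₚ.*-identityʳ M)))) (cong (λ z → B z (act w θ)) eq)) (ℤₚ.<⇒≤ M>0))

  B-s-e : ∀ j x → B (e j) (s j x) ≡ - B (e j) x
  B-s-e j x = trans (inner-e j (s j x)) (trans (cong (D j *_) (pSC-s j x)) (trans (sym (ℤₚ.neg-distribʳ-* (D j) (pSC x j))) (cong -_ (sym (inner-e j x)))))

  I-cancel : ∀ w j γ → I (j ∷ j ∷ w) γ → I w γ
  I-cancel w j γ (r , h , q) = r , h , subst NN (s-involutive j (act w γ)) q

  I-down : ∀ w j → 0ℤ < B (e j) (act w θ) → ∀ γ → I (j ∷ w) γ → I w γ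
  I-down w j gt γ i = I-cancel w j γ (I-up (j ∷ w) j (subst (_< 0ℤ) (sym (B-s-e j (act w θ))) (ℤₚ.neg-mono-< gt)) γ i)

  act-cancel : ∀ w {x y} → act w x ≡ act w y → x ≡ y
  act-cancel w {x} {y} h = trans (sym (act-inv w x)) (trans (cong (act (inv w)) h) (act-inv w y))

  -- Here wγ = αⱼ would force γ = ±θ, which has degree ±2 instead of 1.
  I-flip : ∀ w j → act w θ ≡ e j ⊎ act w θ ≡ neg (e j) → ∀ γ → I w γ → I (j ∷ w) γ
  I-flip w j t γ i@(r , h , q) = I-keep w j γ i (ne t)
    where
    ne : act w θ ≡ e j ⊎ act w θ ≡ neg (e j) → act w γ ≢ e j
    ne (inj₁ a) b with trans (sym h) (trans (cong p (act-cancel w {γ} {θ} (trans b (sym a)))) p-θ)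
    ... | ()
    ne (inj₂ a) b with trans (sym h) (trans (cong p (act-cancel w {γ} {neg θ} (trans b (sym (trans (act-neg w θ) (trans (cong neg a) (neg-involutive (e j)))))))) (trans (p-neg θ) (cong -_ p-θ)))
    ... | ()

  flip-θ : ∀ w j → act w θ ≡ e j ⊎ act w θ ≡ neg (e j) → act (j ∷ w) θ ≡ neg (act w θ)
  flip-θ w j (inj₁ a) = trans (cong (s j) a) (trans (s-e j) (cong neg (sym a)))
  flip-θ w j (inj₂ a) = trans (cong (s j) a) (trans (s-neg j (e j)) (cong neg (trans (s-e j) (sym a))))

  I-unflip : ∀ w j → act w θ ≡ e j ⊎ act w θ ≡ neg (e j) → ∀ γ → I (j ∷ w) γ → I w γ
  I-unflip w j t γ i = I-cancel w j γ (I-flip (j ∷ w) j (t′ t) γ i)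
    where t′ : act w θ ≡ e j ⊎ act w θ ≡ neg (e j) → act (j ∷ w) θ ≡ e j ⊎ act (j ∷ w) θ ≡ neg (e j)
          t′ (inj₁ a) = inj₂ (trans (flip-θ w j (inj₁ a)) (cong neg a))
          t′ (inj₂ a) = inj₁ (trans (flip-θ w j (inj₂ a)) (trans (cong neg a) (neg-involutive (e j))))

  B-e-e≢0 : ∀ j → B (e j) (e j) ≢ 0ℤ
  B-e-e≢0 j h = ℤₚ.<-irrefl (sym h) (rootLike->0 (root⇒rootLike (simple j)))

  W0-flip : ∀ w j → act w θ ≡ e j ⊎ act w θ ≡ neg (e j) → W0 w → W0 (j ∷ w)
  W0-flip w j t h = W0-step w j h (ne t)
    where
    ne : act w θ ≡ e j ⊎ act w θ ≡ neg (e j) → B (e j) (act w θ) ≢ 0ℤ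
    ne (inj₁ a) q = B-e-e≢0 j (trans (cong (B (e j)) (sym a)) q)
    ne (inj₂ a) q = B-e-e≢0 j (trans (sym (ℤₚ.neg-involutive (B (e j) (e j)))) (cong -_ (trans (sym (inner-negʳ (e j) (e j))) (trans (cong (B (e j)) (sym a)) q))))

  -- What wθ and I(w) determine

  W0-NN : ∀ w {η} → W0 w → IsRoot η → p η ≡ 0ℤ → NN (act w η) → NN η
  W0-NN w {η} h r pη q = [ (λ z → z) , (λ z → ⊥-elim (contra z)) ]′ (root-sign r)
    where contra : ¬ NN (neg η)
          contra z = root≢𝟘 (root-act w r) (NN-antisym q (subst NN (act-neg w η) (h (neg η) (root-neg r) (trans (p-neg η) (cong -_ pη)) z)))

  -- u = w⁻¹w′ fixes θ and so preserves degrees. Simple roots of degree 1 stay in Δ(1), which is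
  -- positive; those of degree 0 stay positive because w and w′ both respect Δ(0)⁺; a simple θ is
  -- fixed. Hence u acts trivially.
  W0-unique : ∀ w w′ → W0 w → W0 w′ → act w θ ≡ act w′ θ → ∀ x → act w x ≡ act w′ x
  W0-unique w w′ h h′ eq x = trans (cong (act w) (sym (trans (sym (act-++ (inv w) w′ x)) (NN⇒trivial (length u) u ℕₚ.≤-refl preserve x)))) (act-inv′ w (act w′ x))
    where
    u : W
    u = inv w ++ w′
    uθ : act u θ ≡ θ
    uθ = trans (act-++ (inv w) w′ θ) (trans (cong (act (inv w)) (sym eq)) (act-inv w θ))
    p-u : ∀ x → p (act u x) ≡ p x
    p-u x = p-via-B (act u x) (p x) (trans (cong (B (act u x)) (sym uθ)) (B-act u x))
    by : ∀ i → PView (e i) → NN (act u (e i))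
    by i (is-θ q) = subst NN (trans (sym uθ) (cong (act u) (sym q))) θ-NN
    by i (is-1 q) = p-1⇒NN (root-act u (simple i)) (trans (p-u (e i)) q)
    by i (is-0 q) = W0-NN w h (root-act u (simple i)) (trans (p-u (e i)) q)
      (subst NN (sym (trans (cong (act w) (act-++ (inv w) w′ (e i))) (act-inv′ w (act w′ (e i))))) (h′ (e i) (simple i) q (NN-e i)))
    by i (is--1 q) = ⊥-elim (0≤⇒neg-absurd (p-NN (NN-e i)) 0 q)
    by i (is--θ q) = ⊥-elim (0≤⇒neg-absurd (p-NN (NN-e i)) 1 (trans (sym (ℤₚ.neg-involutive (p (e i)))) (cong -_ (trans (sym (p-neg (e i))) (trans (cong p q) p-θ)))))
    preserve : ∀ i → NN (act u (e i))
    preserve i = by i (pView (simple i))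

  root-neg-NN : ∀ {x} → IsRoot x → ¬ NN x → NN (neg x)
  root-neg-NN r h = [ (λ q → ⊥-elim (h q)) , (λ q → q) ]′ (root-sign r)

  ¬NN-neg : ∀ {x} → IsRoot x → NN x → ¬ NN (neg x)
  ¬NN-neg r a b = root≢𝟘 r (NN-antisym a b)

  -- The sign of w′η is compared with that of wη degree by degree: degrees ±1 are governed by the
  -- ideals, degree 0 by W⁰, and ±θ by the last two hypotheses. For η = w⁻¹αᵢ this shows that w′w⁻¹
  -- keeps simple roots positive.
  I-determines : ∀ w w′ → W0 w → W0 w′ → (∀ γ → I w γ → I w′ γ) → (∀ γ → I w′ γ → I w γ) →
                 (NN (act w θ) → NN (act w′ θ)) → (NN (act w′ θ) → NN (act w θ)) → act w θ ≡ act w′ θ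
  I-determines w w′ h h′ ⊆ ⊇ to from = trans (sym (NN⇒trivial (length u) u ℕₚ.≤-refl (λ i → subst NN (sym (act-++ w′ (inv w) (e i))) (preserve i)) (act w θ)))
    (trans (act-++ w′ (inv w) (act w θ)) (cong (act w′) (act-inv w θ)))
    where
    u : W
    u = w′ ++ inv w
    module _ (i : Fin n) where
      η : V n
      η = act (inv w) (e i)
      η-root : IsRoot η
      η-root = root-act (inv w) (simple i)
      wη : act w η ≡ e i
      wη = act-inv′ w (e i)
      wη-NN : NN (act w η)
      wη-NN = subst NN (sym wη) (NN-e i)
      not-neg : ¬ NN (neg (act w′ η)) → NN (act w′ η)
      not-neg q = [ (λ z → z) , (λ z → ⊥-elim (q z)) ]′ (root-sign (root-act w′ η-root))
      ¬neg : ¬ NN (act w (neg η))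
      ¬neg q = ¬NN-neg (root-act w η-root) wη-NN (subst NN (act-neg w η) q)
      by : PView η → NN (act w′ η)
      by (is-θ q) = subst (λ z → NN (act w′ z)) (sym q) (to (subst (λ z → NN (act w z)) q wη-NN))
      by (is-1 q) = proj₂ (proj₂ (⊆ η (η-root , q , wη-NN)))
      by (is-0 q) = h′ η η-root q (W0-NN w h η-root q wη-NN)
      by (is--1 q) = not-neg λ z → ¬neg (proj₂ (proj₂ (⊇ (neg η) (root-neg η-root , trans (p-neg η) (cong -_ q) , subst NN (sym (act-neg w′ η)) z))))
      by (is--θ q) = not-neg λ z → ¬neg (subst (λ t → NN (act w t)) (sym q) (from (subst (λ t → NN (act w′ t)) q (subst NN (sym (act-neg w′ η)) z))))
      preserve : NN (act w′ η)
      preserve = by (pView η-root)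

  NN-sub-e : ∀ {x} j → NN x → 0ℤ < lookup x j → NN (x ⊕ neg (e j))
  NN-sub-e {x} j h gt = nn λ k → subst (0ℤ ≤_) (sym (lookup-sub x (e j) k)) (at k)
    where
    at : ∀ k → 0ℤ ≤ lookup x k - lookup (e j) k
    at k with k Fin.≟ j
    ... | yes refl = ≤→0≤ (subst (_≤ lookup x k) (sym (lookup-e-same k)) (ℤₚ.i<j⇒suc[i]≤j gt))
    ... | no ne = ≤→0≤ (subst (_≤ lookup x k) (sym (lookup-e-diff j k ne)) (nonneg h k))

  sub-add : ∀ (x y : V n) → y ⊕ (x ⊕ neg y) ≡ x
  sub-add x y = lookup-ext λ i → trans (lookup-⊕ y (x ⊕ neg y) i) (trans (cong (λ z → lookup y i + z) (lookup-sub x y i)) (l (lookup y i) (lookup x i)))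
    where l : ∀ a b → a + (b - a) ≡ b
          l = solve-∀

  NN-⊕ : ∀ {x y : V n} → NN x → NN y → NN (x ⊕ y)
  NN-⊕ {x} {y} a b = nn λ i → subst (0ℤ ≤_) (sym (lookup-⊕ x y i)) (nonneg a i ⊞ nonneg b i)

  p-inv-acute : ∀ w j → 0ℤ < B (e j) (act w θ) → act w θ ≢ e j → p (act (inv w) (e j)) ≡ 1ℤ
  p-inv-acute w j gt ne = by (pView (root-act (inv w) (simple j)))
    where
    pos : 0ℤ < p (act (inv w) (e j))
    pos = >0-*-cancelˡ {M} {p (act (inv w) (e j))} M>0 (subst (0ℤ <_) (sym (p-inv w (e j))) gt)
    by : PView (act (inv w) (e j)) → p (act (inv w) (e j)) ≡ 1ℤ
    by (is-θ q) = ⊥-elim (ne (trans (cong (act w) (sym q)) (act-inv′ w (e j))))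
    by (is-1 q) = q
    by (is-0 q) = ⊥-elim (ℤₚ.<-irrefl (sym q) pos)
    by (is--1 q) = ⊥-elim (0≤⇒neg-absurd (ℤₚ.<⇒≤ pos) 0 q)
    by (is--θ q) = ⊥-elim (0≤⇒neg-absurd (ℤₚ.<⇒≤ pos) 1 (trans (sym (ℤₚ.neg-involutive _)) (cong -_ (trans (sym (p-neg _)) (trans (cong p q) p-θ)))))

  -- If I(w) = I(w′) while wθ > 0 > w′θ, then wθ is simple: otherwise wθ = αᵢ + (wθ - αᵢ) pulls back
  -- to a decomposition of θ into two elements of I(w).
  opposite⇒simple : ∀ w w′ → (∀ γ → I w γ → I w′ γ) → NN (act w θ) → NN (neg (act w′ θ)) → ∃ λ i → act w θ ≡ e i
  opposite⇒simple w w′ ⊆ pos ngt = by (acute {act w θ} (nonneg pos) (root≢𝟘 (root-act w θ-root)))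
    where
    by : (∃ λ j → 0ℤ < lookup (act w θ) j × 0ℤ < B (e j) (act w θ)) → ∃ λ i → act w θ ≡ e i
    by (i , ν>0 , gt) with act w θ ≟V e i
    ... | yes q = i , q
    ... | no ne = ⊥-elim (¬NN-neg (root-act w′ θ-root) (subst NN (trans (sym (act-⊕ w′ γ₁ γ₂)) (cong (act w′) γ₁+γ₂)) (NN-⊕ (proj₂ (proj₂ (⊆ γ₁ I₁))) (proj₂ (proj₂ (⊆ γ₂ I₂))))) ngt)
      where
      γ₁ γ₂ : V n
      γ₁ = act (inv w) (e i)
      γ₂ = act (inv w) (act w θ ⊕ neg (e i))
      γ₁+γ₂ : γ₁ ⊕ γ₂ ≡ θ
      γ₁+γ₂ = trans (sym (act-⊕ (inv w) (e i) (act w θ ⊕ neg (e i)))) (trans (cong (act (inv w)) (sub-add (act w θ) (e i))) (act-inv w θ))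
      p₁ : p γ₁ ≡ 1ℤ
      p₁ = p-inv-acute w i gt ne
      l : ∀ z → 1ℤ + z ≡ + 2 → z ≡ 1ℤ
      l z q = trans (t z) (cong (_- 1ℤ) q)
        where t : ∀ z → z ≡ 1ℤ + z - 1ℤ
              t = solve-∀
      p₂ : p γ₂ ≡ 1ℤ
      p₂ = l (p γ₂) (trans (cong (_+ p γ₂) (sym p₁)) (trans (sym (p-⊕ γ₁ γ₂)) (trans (cong p γ₁+γ₂) p-θ)))
      I₁ : I w γ₁
      I₁ = root-act (inv w) (simple i) , p₁ , subst NN (sym (act-inv′ w (e i))) (NN-e i)
      I₂ : I w γ₂
      I₂ = root-act (inv w) (root-sub i (root-act w θ-root) gt ne) , p₂ , subst NN (sym (act-inv′ w _)) (NN-sub-e i pos ν>0)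

  infix 4 _≈_
  -- The relation `∼` read on the roots wθ; `longSimple` supplies the length condition on the way
  -- back to coroots.
  _≈_ : V n → V n → Set
  x ≈ y = x ≡ y ⊎ (∃ λ i → (x ≡ e i × y ≡ neg (e i)) ⊎ (x ≡ neg (e i) × y ≡ e i))

  -- For mixed signs, wθ = αᵢ by `opposite⇒simple`. Then sᵢw has the same ideal as w and the same
  -- sign as w′, which reduces the case to `I-determines`.
  I-determines-≈ : ∀ w w′ → W0 w → W0 w′ → (∀ γ → I w γ → I w′ γ) → (∀ γ → I w′ γ → I w γ) → act w θ ≈ act w′ θ
  I-determines-≈ w w′ h h′ ⊆ ⊇ = by (NN? (act w θ)) (NN? (act w′ θ))
    where
    mixed : ∀ w w′ → W0 w → W0 w′ → (∀ γ → I w γ → I w′ γ) → (∀ γ → I w′ γ → I w γ) → NN (act w θ) → ¬ NN (act w′ θ) →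
            ∃ λ i → act w θ ≡ e i × act w′ θ ≡ neg (e i)
    mixed w w′ h h′ ⊆ ⊇ a b = fromSimple (opposite⇒simple w w′ ⊆ a (root-neg-NN (root-act w′ θ-root) b))
      where
      fromSimple : (∃ λ i → act w θ ≡ e i) → ∃ λ i → act w θ ≡ e i × act w′ θ ≡ neg (e i)
      fromSimple (i , q) = i , q , sym (trans (sym iwθ) (I-determines (i ∷ w) w′ (W0-flip w i (inj₁ q) h) h′
          (λ γ → ⊆ γ ∘ I-unflip w i (inj₁ q) γ) (λ γ → I-flip w i (inj₁ q) γ ∘ ⊇ γ)
          (λ z → ⊥-elim (¬NN-neg (simple i) (NN-e i) (subst NN iwθ z))) (λ z → ⊥-elim (b z))))
        where iwθ : act (i ∷ w) θ ≡ neg (e i)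
              iwθ = trans (flip-θ w i (inj₁ q)) (cong neg q)
    by : Dec (NN (act w θ)) → Dec (NN (act w′ θ)) → act w θ ≈ act w′ θ
    by (yes a) (yes b) = inj₁ (I-determines w w′ h h′ ⊆ ⊇ (λ _ → b) (λ _ → a))
    by (no a) (no b) = inj₁ (I-determines w w′ h h′ ⊆ ⊇ (λ z → ⊥-elim (a z)) (λ z → ⊥-elim (b z)))
    by (yes a) (no b) = let (i , q , q′) = mixed w w′ h h′ ⊆ ⊇ a b in inj₂ (i , inj₁ (q , q′))
    by (no a) (yes b) = let (i , q , q′) = mixed w′ w h′ h ⊇ ⊆ b a in inj₂ (i , inj₂ (q′ , q))

  θ-determines-I : ∀ w w′ → W0 w → W0 w′ → act w θ ≡ act w′ θ → ∀ γ → I w γ → I w′ γ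
  θ-determines-I w w′ h h′ eq γ (r , q , z) = r , q , subst NN (W0-unique w w′ h h′ eq γ) z

  -- Positive roots lie coordinatewise between 0 and θ, so it is enough to test the box below θ.
  search : (Q : V n → Set) → (∀ γ → Dec (Q γ)) → (∀ γ → Q γ → IsRoot γ × NN γ) → Dec (∃ Q)
  search Q Q? Q⇒ = map′ Any.satisfied (λ (γ , q) → lose (∈-box θ γ (nonneg (proj₂ (Q⇒ γ q))) (proj₂ H γ (proj₁ (Q⇒ γ q)))) q) (Any.any? Q? (box θ))

  -- The order on Δ(1) and minimal elements

  p-e≡0⇒Π0 : ∀ i → p (e i) ≡ 0ℤ → InΠ0 i
  p-e≡0⇒Π0 i h = trans (sym (p≡pair (e i))) h

  Π0⇒p-e≡0 : ∀ i → InΠ0 i → p (e i) ≡ 0ℤ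
  Π0⇒p-e≡0 i h = trans (p≡pair (e i)) h

  -- (β , θ) = Σ βᵢ (αᵢ , θ) is zero with nonnegative summands, so every summand vanishes.
  support-Π0 : ∀ β → NN β → p β ≡ 0ℤ → ∀ i → lookup β i ≢ 0ℤ → p (e i) ≡ 0ℤ
  support-Π0 β h q i ne = [ (λ z → ⊥-elim (ne z)) , (λ z → p-via-B (e i) 0ℤ (trans z (sym (ℤₚ.*-zeroʳ M)))) ]′
    (ℤₚ.i*j≡0⇒i≡0∨j≡0 (lookup β i) {B (e i) θ} (∑-≥0-≡0 (λ i → nonneg h i ⊠ θ-dominant i)
      (trans (sym (inner-expand β θ)) (trans (sym (M*p β)) (trans (cong (M *_) q) (ℤₚ.*-zeroʳ M)))) i))

  ≼₀-intro : ∀ μ γ → (∀ i → lookup μ i ≤ lookup γ i) → (∀ i → lookup μ i ≢ lookup γ i → p (e i) ≡ 0ℤ) → μ ≼₀ γ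
  ≼₀-intro μ γ le sup = (λ i → ∣ lookup γ i - lookup μ i ∣)
    , (λ i → trans (l (lookup γ i) (lookup μ i)) (cong (λ z → lookup μ i + z) (sym (ℤₚ.0≤i⇒+∣i∣≡i (≤→0≤ (le i))))))
    , λ i ni → zero-diff i ni (lookup μ i ℤₚ.≟ lookup γ i)
    where
    l : ∀ a b → a ≡ b + (a - b)
    l = solve-∀
    zero-diff : ∀ i → ¬ InΠ0 i → Dec (lookup μ i ≡ lookup γ i) → ∣ lookup γ i - lookup μ i ∣ ≡ 0
    zero-diff i ni (yes q) = cong ∣_∣ (ℤₚ.i≡j⇒i-j≡0 (sym q))
    zero-diff i ni (no q) = ⊥-elim (ni (p-e≡0⇒Π0 i (sup i q)))

  ≼₀-NN : ∀ {μ γ} → μ ≼₀ γ → NN (γ ⊕ neg μ)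
  ≼₀-NN {μ} {γ} (m , h , _) = nn λ i → subst (0ℤ ≤_) (sym (trans (lookup-sub γ μ i) (trans (cong (_- lookup μ i) (h i)) (l (lookup μ i) (+ m i))))) (+≤+ ℕ.z≤n)
    where l : ∀ a b → a + b - a ≡ b
          l = solve-∀

  ≼₀-support : ∀ {μ γ} → μ ≼₀ γ → ∀ i → lookup (γ ⊕ neg μ) i ≢ 0ℤ → p (e i) ≡ 0ℤ
  ≼₀-support {μ} {γ} (m , h , z) i ne = decidable-stable (p (e i) ℤₚ.≟ 0ℤ) λ q → ne (trans (lookup-sub γ μ i) (trans (cong (_- lookup μ i)
    (trans (h i) (trans (cong (λ k → lookup μ i + + k) (z i (q ∘ Π0⇒p-e≡0 i))) (ℤₚ.+-identityʳ (lookup μ i))))) (ℤₚ.+-inverseʳ (lookup μ i))))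

  sub-NN⇒≤ : ∀ {μ γ : V n} → NN (γ ⊕ neg μ) → ∀ i → lookup μ i ≤ lookup γ i
  sub-NN⇒≤ {μ} {γ} h i = 0≤→≤ (subst (0ℤ ≤_) (lookup-sub γ μ i) (nonneg h i))

  ≼₀? : ∀ μ γ → Dec (μ ≼₀ γ)
  ≼₀? μ γ = map′ to from (Finₚ.all? λ i → (lookup μ i ℤₚ.≤? lookup γ i) ×-dec ((p (e i) ℤₚ.≟ 0ℤ) ⊎-dec (lookup μ i ℤₚ.≟ lookup γ i)))
    where
    Criterion : Set
    Criterion = ∀ i → lookup μ i ≤ lookup γ i × (p (e i) ≡ 0ℤ ⊎ lookup μ i ≡ lookup γ i)
    to : Criterion → μ ≼₀ γ
    to h = ≼₀-intro μ γ (proj₁ ∘ h) λ i ne → [ (λ z → z) , (λ z → ⊥-elim (ne z)) ]′ (proj₂ (h i))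
    from : μ ≼₀ γ → Criterion
    from h i = sub-NN⇒≤ (≼₀-NN {μ} {γ} h) i , cases (lookup μ i ℤₚ.≟ lookup γ i)
      where cases : Dec (lookup μ i ≡ lookup γ i) → p (e i) ≡ 0ℤ ⊎ lookup μ i ≡ lookup γ i
            cases (yes q) = inj₂ q
            cases (no q) = inj₁ (≼₀-support {μ} {γ} h i λ z → q (sym (ℤₚ.i-j≡0⇒i≡j (lookup γ i) (lookup μ i) (trans (sym (lookup-sub γ μ i)) z))))

  ≼₀-refl : ∀ γ → γ ≼₀ γ
  ≼₀-refl γ = ≼₀-intro γ γ (λ i → ℤₚ.≤-refl) (λ i ne → ⊥-elim (ne refl))

  ≼₀-trans : ∀ {x y z} → x ≼₀ y → y ≼₀ z → x ≼₀ z
  ≼₀-trans {x} {y} {z} (m , h , u) (m′ , h′ , u′) = (λ i → m i ℕ.+ m′ i)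
    , (λ i → trans (h′ i) (trans (cong (_+ + m′ i) (h i)) (trans (ℤₚ.+-assoc (lookup x i) (+ m i) (+ m′ i)) (cong (λ t → lookup x i + t) (sym (ℤₚ.pos-+ (m i) (m′ i)))))))
    , λ i ni → cong₂ ℕ._+_ (u i ni) (u′ i ni)

  height-pos : ∀ {x : V n} → NN x → x ≢ 𝟘 → 0ℤ < height x
  height-pos {x} h ne = ℤₚ.≤∧≢⇒< (height-NN h) λ q → ne (lookup-ext λ i → trans (∑-≥0-≡0 (nonneg h) (sym q) i) (sym (lookup-𝟘 i)))

  height-sub : ∀ (x y : V n) → height (x ⊕ neg y) ≡ height x - height y
  height-sub x y = trans (height-⊕ x (neg y)) (cong (λ z → height x + z) (height-neg y))

  ≼₀-antisym : ∀ {x y} → x ≼₀ y → y ≼₀ x → x ≡ y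
  ≼₀-antisym {x} {y} a b = lookup-ext λ i → ℤₚ.≤-antisym (sub-NN⇒≤ (≼₀-NN {x} {y} a) i) (sub-NN⇒≤ (≼₀-NN {y} {x} b) i)

  minimal : (R : V n → Set) → (∀ γ → Dec (R γ)) → (∀ γ → R γ → IsRoot γ × NN γ) → ∀ γ → R γ →
            ∃ λ γ₀ → R γ₀ × γ₀ ≼₀ γ × (∀ μ → R μ → μ ≼₀ γ₀ → μ ≡ γ₀)
  minimal R R? R⇒ γ r = go ∣ height γ ∣ γ r (ℤₚ.≤-reflexive (sym (ℤₚ.0≤i⇒+∣i∣≡i (height-NN (proj₂ (R⇒ γ r))))))
    where
    Result : V n → Set
    Result γ = ∃ λ γ₀ → R γ₀ × γ₀ ≼₀ γ × (∀ μ → R μ → μ ≼₀ γ₀ → μ ≡ γ₀)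
    Smaller : V n → V n → Set
    Smaller γ μ = R μ × μ ≼₀ γ × μ ≢ γ
    smaller? : ∀ γ → Dec (∃ (Smaller γ))
    smaller? γ = search (Smaller γ) (λ μ → R? μ ×-dec ≼₀? μ γ ×-dec ¬? (μ ≟V γ)) (λ μ s → R⇒ μ (proj₁ s))
    drop : ∀ {μ γ} → μ ≼₀ γ → μ ≢ γ → 0ℤ < height γ - height μ
    drop {μ} {γ} le ne = subst (0ℤ <_) (height-sub γ μ) (height-pos {γ ⊕ neg μ} (≼₀-NN {μ} {γ} le) λ z → ne (sym (sub≡𝟘 z)))
    go : ∀ N γ → R γ → height γ ≤ + N → Result γ
    branch : ∀ N γ → R γ → height γ ≤ + N → Dec (∃ (Smaller γ)) → Result γ
    go N γ r le = branch N γ r le (smaller? γ)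
    branch N γ r le (no none) = γ , r , ≼₀-refl γ , λ μ rμ lμ → decidable-stable (μ ≟V γ) λ ne → none (μ , rμ , lμ , ne)
    branch zero γ r le (yes (μ , rμ , lμ , ne)) = ⊥-elim (0≤⇒neg-absurd (≤→0≤ le ⊞ <→0≤ (drop {μ} {γ} lμ ne) ⊞ height-NN (proj₂ (R⇒ μ rμ))) 0 (l (height γ) (height μ)))
      where l : ∀ g m → 0ℤ - g + (g - m - 0ℤ - 1ℤ) + m ≡ -[1+ 0 ]
            l = solve-∀
    branch (suc N) γ r le (yes (μ , rμ , lμ , ne)) =
      let (γ₀ , r₀ , l₀ , m₀) = go N μ rμ (0≤→≤ (0≤-resp (≤→0≤ le ⊞ <→0≤ (drop {μ} {γ} lμ ne)) (l (+ N) (height γ) (height μ))))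
      in γ₀ , r₀ , ≼₀-trans {γ₀} {μ} {γ} l₀ lμ , m₀
      where l : ∀ N g m → 1ℤ + N - g + (g - m - 0ℤ - 1ℤ) ≡ N - m
            l = solve-∀

  -- A difference of two elements of Δ(1) need not be a root, so the W⁰ condition is applied to one
  -- simple root of Π(0) at a time.
  NN-act-Π0 : ∀ w → W0 w → ∀ β → NN β → (∀ i → lookup β i ≢ 0ℤ → p (e i) ≡ 0ℤ) → NN (act w β)
  NN-act-Π0 w h β β≥0 = go ∣ height β ∣ β β≥0 (ℤₚ.≤-reflexive (sym (ℤₚ.0≤i⇒+∣i∣≡i (height-NN β≥0))))
    where
    Sup : V n → Set
    Sup β = ∀ i → lookup β i ≢ 0ℤ → p (e i) ≡ 0ℤ
    act-𝟘 : NN (act w 𝟘)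
    act-𝟘 = nn λ i → ℤₚ.≤-reflexive (sym (trans (cong (λ z → lookup z i) (trans (cong (act w) z≡) (act-· w 0ℤ 𝟘))) (lookup-· 0ℤ (act w 𝟘) i)))
      where z≡ : 𝟘 ≡ 0ℤ · 𝟘
            z≡ = lookup-ext λ i → trans (lookup-𝟘 i) (sym (lookup-· 0ℤ (𝟘 {n}) i))
    go : ∀ N β → NN β → height β ≤ + N → Sup β → NN (act w β)
    branch : ∀ N β → NN β → height β ≤ + N → Sup β → Dec (β ≡ 𝟘) → NN (act w β)
    peel : ∀ N β → NN β → height β ≤ + suc N → Sup β → (∃ λ i → 0ℤ < lookup β i) → NN (act w β)
    go N β β≥0 le sup = branch N β β≥0 le sup (β ≟V 𝟘)
    branch N β β≥0 le sup (yes q) = subst (λ z → NN (act w z)) (sym q) act-𝟘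
    branch zero β β≥0 le sup (no q) = ⊥-elim (ℤₚ.<⇒≱ (height-pos β≥0 q) le)
    branch (suc N) β β≥0 le sup (no q) = peel N β β≥0 le sup (∑->0 (lookup β) (height-pos β≥0 q))
    peel N β β≥0 le sup (i , gt) = subst NN (trans (sym (act-⊕ w (e i) (β ⊕ neg (e i)))) (cong (act w) (sub-add β (e i))))
      (NN-⊕ (h (e i) (simple i) (sup i (λ z → ℤₚ.<-irrefl (sym z) gt)) (NN-e i))
            (go N (β ⊕ neg (e i)) (NN-sub-e i β≥0 gt) le′ sup′))
      where
      height-e : height (e i) ≡ 1ℤ
      height-e = trans (∑-cong λ k → sym (ℤₚ.*-identityˡ (lookup (e i) k))) (∑-e (λ _ → 1ℤ) i)
      l : ∀ N b → 1ℤ + N - b ≡ N - (b - 1ℤ)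
      l = solve-∀
      le′ : height (β ⊕ neg (e i)) ≤ + N
      le′ = 0≤→≤ (0≤-resp (≤→0≤ le) (trans (l (+ N) (height β)) (cong (λ z → + N - z) (sym (trans (height-sub β (e i)) (cong (λ z → height β - z) height-e))))))
      sup′ : Sup (β ⊕ neg (e i))
      sup′ k ne with k Fin.≟ i
      ... | yes refl = sup k (λ z → ℤₚ.<-irrefl (sym z) gt)
      ... | no k≢i = sup k λ z → ne (trans (lookup-sub β (e i) k) (cong₂ _-_ z (lookup-e-diff i k k≢i)))

  I-upper : ∀ w → W0 w → ∀ γ γ′ → I w γ → γ ≼₀ γ′ → IsRoot γ′ → p γ′ ≡ 1ℤ → I w γ′
  I-upper w h γ γ′ (_ , _ , q) le r′ p′ = r′ , p′ , subst NN (trans (sym (act-⊕ w γ (γ′ ⊕ neg γ))) (cong (act w) (sub-add γ′ γ)))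
    (NN-⊕ q (NN-act-Π0 w h (γ′ ⊕ neg γ) (≼₀-NN {γ} {γ′} le) (≼₀-support {γ} {γ′} le)))

  -- Minimal elements of I(w) and their removal

  I? : ∀ w γ → Dec (I w γ)
  I? w γ = isRoot? γ ×-dec (p γ ℤₚ.≟ 1ℤ) ×-dec NN? (act w γ)

  I⇒pos : ∀ w γ → I w γ → IsRoot γ × NN γ
  I⇒pos w γ (r , q , _) = r , p-1⇒NN r q

  Minimal : W → V n → Set
  Minimal w γ₀ = I w γ₀ × (∀ μ → I w μ → μ ≼₀ γ₀ → μ ≡ γ₀)

  -- wγ₀ = β + η with w⁻¹β ∈ Δ(0)⁺ would make w⁻¹η an element of I(w) strictly below γ₀.
  no-split : ∀ w → W0 w → ∀ γ₀ → Minimal w γ₀ → ∀ β η → IsRoot β → IsRoot η → NN β → NN η →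
             p (act (inv w) β) ≡ 0ℤ → β ⊕ η ≡ act w γ₀ → ⊥
  no-split w h γ₀ ((r₀ , p₀ , _) , min) β η rβ rη β≥0 η≥0 pβ sum = root≢𝟘 rβ′ β′≡𝟘
    where
    β′ η′ : V n
    β′ = act (inv w) β
    η′ = act (inv w) η
    rβ′ : IsRoot β′
    rβ′ = root-act (inv w) rβ
    sum′ : β′ ⊕ η′ ≡ γ₀
    sum′ = trans (sym (act-⊕ (inv w) β η)) (trans (cong (act (inv w)) sum) (act-inv w γ₀))
    β′≥0 : NN β′
    β′≥0 = W0-NN w h rβ′ pβ (subst NN (sym (act-inv′ w β)) β≥0)
    pη′ : p η′ ≡ 1ℤ
    pη′ = trans (sym (ℤₚ.+-identityˡ (p η′))) (trans (cong (_+ p η′) (sym pβ)) (trans (sym (p-⊕ β′ η′)) (trans (cong p sum′) p₀)))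
    at : ∀ i → lookup γ₀ i ≡ lookup β′ i + lookup η′ i
    at i = trans (cong (λ z → lookup z i) (sym sum′)) (lookup-⊕ β′ η′ i)
    l : ∀ a b → a ≡ a + b - b
    l = solve-∀
    η′≼γ₀ : η′ ≼₀ γ₀
    η′≼γ₀ = ≼₀-intro η′ γ₀
      (λ i → 0≤→≤ (subst (0ℤ ≤_) (trans (l (lookup β′ i) (lookup η′ i)) (cong (_- lookup η′ i) (sym (at i)))) (nonneg β′≥0 i)))
      (λ i ne → support-Π0 β′ β′≥0 pβ i λ z → ne (sym (trans (at i) (trans (cong (_+ lookup η′ i) z) (ℤₚ.+-identityˡ (lookup η′ i))))))
    η′≡γ₀ : η′ ≡ γ₀
    η′≡γ₀ = min η′ (root-act (inv w) rη , pη′ , subst NN (sym (act-inv′ w η)) η≥0) η′≼γ₀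
    β′≡𝟘 : β′ ≡ 𝟘
    β′≡𝟘 = lookup-ext λ i → trans (l (lookup β′ i) (lookup η′ i)) (trans (cong₂ _-_ (trans (sym (at i)) (cong (λ z → lookup z i) (sym η′≡γ₀))) refl)
      (trans (ℤₚ.+-inverseʳ (lookup η′ i)) (sym (lookup-𝟘 i))))

  ⊕-comm : ∀ (x y : V n) → x ⊕ y ≡ y ⊕ x
  ⊕-comm x y = lookup-ext λ i → trans (lookup-⊕ x y i) (trans (ℤₚ.+-comm (lookup x i) (lookup y i)) (sym (lookup-⊕ y x i)))

  -- If δ = wγ₀ is not simple, subtract a simple root αⱼ acute to it and consider the degree of
  -- w⁻¹αⱼ. In degrees 0 and 1 one of αⱼ and δ - αⱼ pulls back into Δ(0), against `no-split`. Degree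
  -- 2 would make wθ simple, and degree -2 contradicts acuteness. In degree -1 the difference δ - αⱼ
  -- has degree 2, so δ = αⱼ + wθ, and a second simple root, acute to wθ, is brought in by `third`.
  minimal⇒simple : ∀ w → W0 w → (∀ i → act w θ ≢ e i) → ∀ γ₀ → Minimal w γ₀ → ∃ λ j → act w γ₀ ≡ e j
  minimal⇒simple w h notSimple γ₀ Mγ₀@((r₀ , p₀ , δ≥0) , _) = first (acute {δ} (nonneg δ≥0) (root≢𝟘 δ-root))
    where
    δ ν : V n
    δ = act w γ₀
    ν = act w θ
    Goal : Set
    Goal = ∃ λ j → δ ≡ e j
    δ-root : IsRoot δ
    δ-root = root-act w r₀
    ν-root : IsRoot ν
    ν-root = root-act w θ-root
    q : V n → ℤ
    q x = p (act (inv w) x)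
    qδ : q δ ≡ 1ℤ
    qδ = trans (cong p (act-inv w γ₀)) p₀
    q-⊕ : ∀ x y → q (x ⊕ y) ≡ q x + q y
    q-⊕ x y = trans (cong p (act-⊕ (inv w) x y)) (p-⊕ (act (inv w) x) (act (inv w) y))
    q-δ-e : ∀ j z → q (e j) ≡ z → q (δ ⊕ neg (e j)) ≡ 1ℤ - z
    q-δ-e j z h = trans (q-⊕ δ (neg (e j))) (cong₂ _+_ qδ (trans (cong p (act-neg (inv w) (e j))) (trans (p-neg (act (inv w) (e j))) (cong -_ h))))
    q≡2 : ∀ x → IsRoot x → q x ≡ + 2 → x ≡ ν
    q≡2 x r h = by (pView (root-act (inv w) r))
      where
      absurd : ∀ {z} → q x ≡ z → z ≢ + 2 → x ≡ ν
      absurd a ne = ⊥-elim (ne (trans (sym a) h))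
      by : PView (act (inv w) x) → x ≡ ν
      by (is-θ a) = trans (sym (act-inv′ w x)) (cong (act w) a)
      by (is-1 a) = absurd a λ ()
      by (is-0 a) = absurd a λ ()
      by (is--1 a) = absurd a λ ()
      by (is--θ a) = absurd { - + 2} (trans (sym (ℤₚ.neg-involutive (q x))) (cong -_ (trans (sym (p-neg (act (inv w) x))) (trans (cong p a) p-θ)))) λ ()
    peel : ∀ j → 0ℤ < lookup δ j → 0ℤ < B (e j) δ → δ ≢ e j → q (e j) ≡ 1ℤ → ⊥
    peel j δ>0 gt ne qe = no-split w h γ₀ Mγ₀ (δ ⊕ neg (e j)) (e j) (root-sub j δ-root gt ne) (simple j) (NN-sub-e j δ≥0 δ>0) (NN-e j)
      (q-δ-e j 1ℤ qe) (trans (⊕-comm (δ ⊕ neg (e j)) (e j)) (sub-add δ (e j)))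
    third : ∀ j → q (e j) ≡ - 1ℤ → ν ≡ δ ⊕ neg (e j) → NN ν → (∃ λ i → 0ℤ < lookup ν i × 0ℤ < B (e i) ν) → Goal
    third j qj ν≡ ν≥0 (i , ν>0 , gt) = by (δ ≟V e i) (0ℤ ℤₚ.<? B (e i) δ)
      where
      qi : q (e i) ≡ 1ℤ
      qi = p-inv-acute w i gt (notSimple i)
      δ≡ : δ ≡ e j ⊕ ν
      δ≡ = trans (sym (sub-add δ (e j))) (cong (e j ⊕_) (sym ν≡))
      δi>0 : 0ℤ < lookup δ i
      δi>0 = subst (0ℤ <_) (sym (trans (cong (λ z → lookup z i) δ≡) (lookup-⊕ (e j) ν i))) (ℤₚ.+-mono-≤-< (lookup-e-≥0 j i) ν>0)
      by : Dec (δ ≡ e i) → Dec (0ℤ < B (e i) δ) → Goal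
      by (yes a) _ = i , a
      by (no a) (yes b) = ⊥-elim (peel i δi>0 b a qi)
      -- From (αᵢ , δ) ≤ 0 < (αᵢ , ν) follows (αᵢ , αⱼ) < 0, so αⱼ + αᵢ is a root, of degree -1 + 1
      -- = 0. Regrouping δ as (αⱼ + αᵢ) + (ν - αᵢ) contradicts `no-split`.
      by (no a) (no b) = ⊥-elim (no-split w h γ₀ Mγ₀ (e j ⊕ e i) (ν ⊕ neg (e i))
          (root-add i (simple j) lt λ z → ¬NN-neg (simple i) (NN-e i) (subst NN z (NN-e j))) (root-sub i ν-root gt (notSimple i))
          (NN-⊕ (NN-e j) (NN-e i)) (NN-sub-e i ν≥0 ν>0)
          (trans (q-⊕ (e j) (e i)) (cong₂ _+_ qj qi))
          (trans (lookup-ext λ k → at k) (sym δ≡)))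
        where
        l₁ : ∀ x y → 0ℤ - (y + x) + (x - 0ℤ - 1ℤ) ≡ 0ℤ - y - 1ℤ
        l₁ = solve-∀
        lt : B (e i) (e j) < 0ℤ
        lt = 0≤→< (0≤-resp (0≤-resp (≤→0≤ (ℤₚ.≮⇒≥ b)) (cong (λ z → 0ℤ - z) (trans (cong (B (e i)) δ≡) (inner-⊕ʳ (e i) (e j) ν))) ⊞ <→0≤ gt) (l₁ (B (e i) ν) (B (e i) (e j))))
        l₂ : ∀ a b c → a + b + (c - b) ≡ a + c
        l₂ = solve-∀
        at : ∀ k → lookup (e j ⊕ e i ⊕ (ν ⊕ neg (e i))) k ≡ lookup (e j ⊕ ν) k
        at k = trans (lookup-⊕ (e j ⊕ e i) (ν ⊕ neg (e i)) k) (trans (cong₂ _+_ (lookup-⊕ (e j) (e i) k) (lookup-sub ν (e i) k))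
          (trans (l₂ (lookup (e j) k) (lookup (e i) k) (lookup ν k)) (sym (lookup-⊕ (e j) ν k))))
    second : ∀ j → 0ℤ < lookup δ j → 0ℤ < B (e j) δ → δ ≢ e j → PView (act (inv w) (e j)) → Goal
    second j δ>0 gt ne (is-θ a) = ⊥-elim (notSimple j (trans (cong (act w) (sym a)) (act-inv′ w (e j))))
    second j δ>0 gt ne (is-1 a) = ⊥-elim (peel j δ>0 gt ne a)
    second j δ>0 gt ne (is-0 a) = ⊥-elim (no-split w h γ₀ Mγ₀ (e j) (δ ⊕ neg (e j)) (simple j) (root-sub j δ-root gt ne) (NN-e j) (NN-sub-e j δ≥0 δ>0) a (sub-add δ (e j)))
    second j δ>0 gt ne (is--1 a) = third j a (sym δ-e≡ν) ν≥0 (acute {ν} (nonneg ν≥0) (root≢𝟘 ν-root))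
      where δ-e≡ν : δ ⊕ neg (e j) ≡ ν
            δ-e≡ν = q≡2 (δ ⊕ neg (e j)) (root-sub j δ-root gt ne) (q-δ-e j (- 1ℤ) a)
            ν≥0 : NN ν
            ν≥0 = subst NN δ-e≡ν (NN-sub-e j δ≥0 δ>0)
    second j δ>0 gt ne (is--θ a) = ⊥-elim (ℤₚ.<-asym gt (subst (_< 0ℤ) eq (ℤₚ.neg-mono-< M>0)))
      where
      ej≡ : neg ν ≡ e j
      ej≡ = trans (cong neg (trans (cong (act w) (sym a)) (trans (act-neg w (act (inv w) (e j))) (cong neg (act-inv′ w (e j)))))) (neg-involutive (e j))
      eq : - M ≡ B (e j) δ
      eq = trans (cong -_ (trans (sym (ℤₚ.*-identityʳ M)) (trans (cong (M *_) (sym p₀)) (trans (sym (B-act w γ₀)) (inner-sym δ ν))))) (trans (sym (inner-negˡ ν δ)) (cong (λ z → B z δ) ej≡))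
    first : (∃ λ j → 0ℤ < lookup δ j × 0ℤ < B (e j) δ) → Goal
    first (j , δ>0 , gt) = by (δ ≟V e j)
      where by : Dec (δ ≡ e j) → Goal
            by (yes a) = j , a
            by (no a) = second j δ>0 gt a (pView (root-act (inv w) (simple j)))

  -- w ↓ w′: the element w is reached from w′ by reflections that lower wθ by one simple coroot,
  -- or that exchange a simple root with its negative.
  data _↓_ (w : W) : W → Set where
    stop  : w ↓ w
    lower : ∀ {w′} j → 0ℤ < B (e j) (act w′ θ) → act w′ θ ≢ e j → w ↓ (j ∷ w′) → w ↓ w′
    flip  : ∀ {w′} j → act w′ θ ≡ e j → w ↓ (j ∷ w′) → w ↓ w′

  -- As P is an upper ideal, a minimal element of I(w′) ∖ P is already minimal in I(w′), so
  -- `minimal⇒simple` provides the reflection that removes exactly it. If wθ is simple, it is first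
  -- flipped to its negative.
  descend : (P : V n → Set) → (∀ γ → Dec (P γ)) → (∀ γ γ′ → P γ → γ ≼₀ γ′ → IsRoot γ′ → p γ′ ≡ 1ℤ → P γ′) →
            ∀ w′ → W0 w′ → (∀ γ → P γ → I w′ γ) →
            ∃ λ w → W0 w × w ↓ w′ × (∀ γ → P γ → I w γ) × (∀ γ → I w γ → P γ)
  -- Adding the height of θ makes the measure nonnegative, since -θ is the lowest root.
  descend P P? up w₀ h₀ sub₀ = go ∣ height (act w₀ θ) + height θ ∣ w₀ h₀ sub₀ (ℤₚ.≤-reflexive (sym (ℤₚ.0≤i⇒+∣i∣≡i (bound w₀))))
    where
    Result : W → Set
    Result w′ = ∃ λ w → W0 w × w ↓ w′ × (∀ γ → P γ → I w γ) × (∀ γ → I w γ → P γ)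
    bound : ∀ w → 0ℤ ≤ height (act w θ) + height θ
    bound w = 0≤-resp (height-below-θ (root-neg (root-act w θ-root))) (trans (cong (λ z → height θ - z) (height-neg (act w θ))) (l (height θ) (height (act w θ))))
      where l : ∀ a b → a - (- b) ≡ b + a
            l = solve-∀
    Excess : W → V n → Set
    Excess w′ γ = I w′ γ × ¬ P γ
    excess? : ∀ w′ γ → Dec (Excess w′ γ)
    excess? w′ γ = I? w′ γ ×-dec ¬? (P? γ)
    excess⇒ : ∀ w′ γ → Excess w′ γ → IsRoot γ × NN γ
    excess⇒ w′ γ (i , _) = I⇒pos w′ γ i
    go : ∀ N w′ → W0 w′ → (∀ γ → P γ → I w′ γ) → height (act w′ θ) + height θ ≤ + N → Result w′
    branch : ∀ N w′ → W0 w′ → (∀ γ → P γ → I w′ γ) → height (act w′ θ) + height θ ≤ + N → Dec (∃ (Excess w′)) → Result w′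
    remove : ∀ N w′ → W0 w′ → (∀ γ → P γ → I w′ γ) → height (act w′ θ) + height θ ≤ + N → ∀ γ₀ → Minimal w′ γ₀ → ¬ P γ₀ →
             Dec (∃ λ i → act w′ θ ≡ e i) → Result w′
    next : ∀ N w′ j → W0 (j ∷ w′) → (∀ γ → P γ → I (j ∷ w′) γ) → height (act w′ θ) + height θ ≤ + N → 0ℤ < B (e j) (act w′ θ) → Result (j ∷ w′)
    go N w′ h sub le = branch N w′ h sub le (search (Excess w′) (excess? w′) (excess⇒ w′))
    branch N w′ h sub le (no none) = w′ , h , stop , sub , λ γ i → decidable-stable (P? γ) λ np → none (γ , i , np)
    branch N w′ h sub le (yes (γ , x)) =
      let (γ₀ , (i₀ , np₀) , _ , min₀) = minimal (Excess w′) (excess? w′) (excess⇒ w′) γ x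
      in remove N w′ h sub le γ₀ (i₀ , λ μ iμ lμ → min₀ μ (iμ , λ pμ → np₀ (up μ γ₀ pμ lμ (proj₁ i₀) (proj₁ (proj₂ i₀)))) lμ) np₀
           (Finₚ.any? λ i → act w′ θ ≟V e i)
    remove N w′ h sub le γ₀ min₀ np₀ (yes (i , q)) =
      let (w , hw , ch , a , b) = next N w′ i (W0-flip w′ i (inj₁ q) h) (λ γ pγ → I-flip w′ i (inj₁ q) γ (sub γ pγ)) le
                                    (subst (λ z → 0ℤ < B (e i) z) (sym q) (rootLike->0 (root⇒rootLike (simple i))))
      in w , hw , flip i q ch , a , b
    remove N w′ h sub le γ₀ min₀@((r₀ , p₀ , _) , _) np₀ (no ns) = withSimple (minimal⇒simple w′ h (λ i q → ns (i , q)) γ₀ min₀)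
      where
      withSimple : (∃ λ j → act w′ γ₀ ≡ e j) → Result w′
      withSimple (j , q) =
        let (w , hw , ch , a , b) = next N w′ j (W0-step w′ j h (λ z → ℤₚ.<-irrefl (sym z) gt))
              (λ γ pγ → I-keep w′ j γ (sub γ pγ) λ z → np₀ (subst P (act-cancel w′ {γ} {γ₀} (trans z (sym q))) pγ)) le gt
        in w , hw , lower j gt (λ z → ns (j , z)) ch , a , b
        where gt : 0ℤ < B (e j) (act w′ θ)
              gt = subst (0ℤ <_) (trans (sym (trans (B-act w′ γ₀) (trans (cong (M *_) p₀) (ℤₚ.*-identityʳ M)))) (cong (λ z → B z (act w′ θ)) q)) M>0
    next zero w′ j h sub le gt = ⊥-elim (0≤⇒neg-absurd (≤→0≤ le ⊞ <→0≤ (pSC>0 {act w′ θ} gt)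
        ⊞ 0≤-resp (bound (j ∷ w′)) (cong (_+ height θ) (height-s j (act w′ θ)))) 0 (l (height (act w′ θ)) (height θ) (pSC (act w′ θ) j)))
      where l : ∀ a t k → 0ℤ - (a + t) + (k - 0ℤ - 1ℤ) + (a - k + t) ≡ -[1+ 0 ]
            l = solve-∀
    next (suc N) w′ j h sub le gt = go N (j ∷ w′) h sub (0≤→≤ (0≤-resp (≤→0≤ le ⊞ <→0≤ (pSC>0 {act w′ θ} gt))
        (trans (l (+ N) (height (act w′ θ)) (height θ) (pSC (act w′ θ) j)) (cong (λ z → + N - (z + height θ)) (sym (height-s j (act w′ θ)))))))
      where l : ∀ N a t k → 1ℤ + N - (a + t) + (k - 0ℤ - 1ℤ) ≡ N - (a - k + t)
            l = solve-∀

  -- A dominant γ as long as θ satisfies 2M = (γ , γ) ≤ (θ , γ) = M · `p γ`, so `p<2` forces γ = θ.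
  -- The reflections of `climb` stay in W⁰ because their simple roots are not orthogonal to the
  -- current root.
  reach : ∀ γ → IsRoot γ → B γ γ ≡ B θ θ → ∃ λ w → W0 w × act w θ ≡ γ
  reach = climb (λ γ → B γ γ ≡ B θ θ → ∃ λ w → W0 w × act w θ ≡ γ) base step
    where
    base : ∀ γ → IsRoot γ → (∀ i → 0ℤ ≤ B (e i) γ) → B γ γ ≡ B θ θ → ∃ λ w → W0 w × act w θ ≡ γ
    base γ r dom N = [] , (λ α _ _ q → q) , sym (decidable-stable (γ ≟V θ) λ ne → ℤₚ.<⇒≱ (p<2 {γ} (ℤₚ.≤-reflexive N) ne)
      (ℤₚ.*-cancelˡ-≤-pos (+ 2) (p γ) M {{ℤ.positive M>0}} (subst₂ _≤_ (trans N (trans θ-norm (ℤₚ.*-comm (+ 2) M))) (trans (inner-sym θ γ) (sym (M*p γ))) (dominant-norm γ r dom))))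
    step : ∀ i γ → IsRoot γ → B (e i) γ < 0ℤ → (B (s i γ) (s i γ) ≡ B θ θ → ∃ λ w → W0 w × act w θ ≡ s i γ) → B γ γ ≡ B θ θ → ∃ λ w → W0 w × act w θ ≡ γ
    step i γ r lt ih N = extend (ih (trans (inner-s i γ γ) N))
      where
      extend : (∃ λ w → W0 w × act w θ ≡ s i γ) → ∃ λ w → W0 w × act w θ ≡ γ
      extend (w , h , q) = i ∷ w , W0-step w i h (λ z → ℤₚ.<-irrefl (trans (sym (ℤₚ.neg-involutive (B (e i) γ))) (cong -_ (trans (sym (B-s-e i γ)) (trans (cong (B (e i)) (sym q)) z)))) lt)
        , trans (cong (s i) q) (s-involutive i γ)

  -- c is the coroot of the root x, provided x is as long as θ.
  LongCo : V n → V n → Set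
  LongCo x c = ∀ j → D j * lookup x j ≡ M * lookup c j

  -- Coroots of long roots and their classes

  longCo : ∀ {γ c} → B γ γ ≡ B θ θ → IsCorootOf γ c → LongCo γ c
  longCo {γ} {c} N h j = sym (*-cancel-pos {+ 2} {M * lookup c j} {D j * lookup γ j} 2>0
    (trans (sym (ℤₚ.*-assoc (+ 2) M (lookup c j))) (trans (cong (_* lookup c j) (trans (sym θ-norm) (trans (sym N) (B≡inner γ γ))))
    (trans (h j) (trans (cong (_* lookup γ j) (ℤₚ.pos-* 2 (d j))) (ℤₚ.*-assoc (+ 2) (D j) (lookup γ j)))))))

  isCoroot : ∀ {γ c} → B γ γ ≡ B θ θ → LongCo γ c → IsCorootOf γ c
  isCoroot {γ} {c} N h j = trans (cong (_* lookup c j) (trans (sym (B≡inner γ γ)) (trans N θ-norm))) (trans (ℤₚ.*-assoc (+ 2) M (lookup c j))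
    (trans (cong (+ 2 *_) (sym (h j))) (trans (sym (ℤₚ.*-assoc (+ 2) (D j) (lookup γ j))) (cong (_* lookup γ j) (sym (ℤₚ.pos-* 2 (d j)))))))

  co-unique : ∀ {x c c′} → LongCo x c → LongCo x c′ → c ≡ c′
  co-unique {x} {c} {c′} h h′ = lookup-ext λ j → *-cancel-pos {M} {lookup c j} {lookup c′ j} M>0 (trans (sym (h j)) (h′ j))

  root-unique : ∀ {x x′ c} → LongCo x c → LongCo x′ c → x ≡ x′
  root-unique {x} {x′} h h′ = lookup-ext λ j → *-cancel-pos {D j} {lookup x j} {lookup x′ j} (D>0 j) (trans (h j) (sym (h′ j)))

  co-neg : ∀ {x c} → LongCo x c → LongCo (neg x) (neg c)
  co-neg {x} {c} h j = trans (cong (D j *_) (lookup-neg x j)) (trans (sym (ℤₚ.neg-distribʳ-* (D j) (lookup x j))) (trans (cong -_ (h j))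
    (trans (ℤₚ.neg-distribʳ-* M (lookup c j)) (cong (M *_) (sym (lookup-neg c j))))))

  co-act : ∀ w → LongCo (act w θ) (coact w θv)
  co-act [] j = sym (θ-co j)
  co-act (i ∷ w) j = trans (co-s M (act w θ) (lookup c) (co-act w) i j) (cong (M *_) (sym cs-lookup))
    where
    c : V n
    c = coact w θv
    q : ℤ
    q = ∑ (λ k → A k i * lookup c k)
    cs-lookup : lookup (cs i c) j ≡ lookup c j - coPair (lookup c) i * lookup (e i) j
    cs-lookup = trans (cong (λ z → lookup z j) (reflect-coord q c i)) (trans (lookup-⊕ c ((- q) · e i) j) (cong (λ z → lookup c j + z)
      (trans (lookup-· (- q) (e i) j) (trans (sym (ℤₚ.neg-distribˡ-* q (lookup (e i) j))) (cong (λ z → - (z * lookup (e i) j)) (∑-cong λ k → ℤₚ.*-comm (A k i) (lookup c k)))))))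

  act-norm : ∀ w → B (act w θ) (act w θ) ≡ B θ θ
  act-norm w = inner-act w θ θ

  longSimple : ∀ w i → act w θ ≡ e i → LongSimple i
  longSimple w i q = trans (sym (B≡inner (e i) (e i))) (trans (trans (sym (cong (λ z → B z z) q)) (act-norm w)) (B≡inner θ θ))

  longSimple-norm : ∀ i → LongSimple i → B (e i) (e i) ≡ B θ θ
  longSimple-norm i h = trans (B≡inner (e i) (e i)) (trans h (sym (B≡inner θ θ)))

  co-e : ∀ i → LongSimple i → LongCo (e i) (e i)
  co-e i h j = trans (D-e i j) (cong (_* lookup (e i) j) (*-cancel-pos {+ 2} {D i} {M} 2>0 (trans (sym (inner-e-e i)) (trans (longSimple-norm i h) θ-norm))))

  coact≡⇒act≡ : ∀ w {x c} → LongCo x c → coact w θv ≡ c → act w θ ≡ x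
  coact≡⇒act≡ w {x} {c} h q = root-unique {act w θ} {x} {c} (subst (LongCo (act w θ)) q (co-act w)) h

  act≡⇒coact≡ : ∀ w {x c} → LongCo x c → act w θ ≡ x → coact w θv ≡ c
  act≡⇒coact≡ w {x} {c} h q = co-unique {x} {coact w θv} {c} (subst (λ z → LongCo z (coact w θv)) q (co-act w)) h

  ≈⇒∼ : ∀ w w′ → act w θ ≈ act w′ θ → coact w θv ∼ coact w′ θv
  ≈⇒∼ w w′ (inj₁ q) = inj₁ (act≡⇒coact≡ w {act w′ θ} (co-act w′) q)
  ≈⇒∼ w w′ (inj₂ (i , inj₁ (q , q′))) = inj₂ (i , l , inj₁ (act≡⇒coact≡ w {e i} (co-e i l) q , act≡⇒coact≡ w′ {neg (e i)} (co-neg {e i} {e i} (co-e i l)) q′))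
    where l = longSimple w i q
  ≈⇒∼ w w′ (inj₂ (i , inj₂ (q , q′))) = inj₂ (i , l , inj₂ (act≡⇒coact≡ w {neg (e i)} (co-neg {e i} {e i} (co-e i l)) q , act≡⇒coact≡ w′ {e i} (co-e i l) q′))
    where l = longSimple w′ i q′

  ∼-sym : ∀ {x y} → x ∼ y → y ∼ x
  ∼-sym (inj₁ q) = inj₁ (sym q)
  ∼-sym (inj₂ (i , l , inj₁ (a , b))) = inj₂ (i , l , inj₂ (b , a))
  ∼-sym (inj₂ (i , l , inj₂ (a , b))) = inj₂ (i , l , inj₁ (b , a))

  -- Presents a nontrivial identification as negation, so that two of them in a row cancel.
  e-or-neg : ∀ {x y} → x ∼ y → x ≡ y ⊎ (∃ λ i → LongSimple i × (x ≡ e i ⊎ x ≡ neg (e i)) × y ≡ neg x)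
  e-or-neg (inj₁ q) = inj₁ q
  e-or-neg (inj₂ (i , l , inj₁ (a , b))) = inj₂ (i , l , inj₁ a , trans b (cong neg (sym a)))
  e-or-neg (inj₂ (i , l , inj₂ (a , b))) = inj₂ (i , l , inj₂ a , trans b (trans (sym (neg-involutive (e i))) (cong neg (sym a))))

  ∼-trans : ∀ {x y z} → x ∼ y → y ∼ z → x ∼ z
  ∼-trans {x} {y} {z} xy yz = by (e-or-neg xy) (e-or-neg yz)
    where
    by : _ ⊎ _ → _ ⊎ _ → x ∼ z
    by (inj₁ refl) _ = yz
    by (inj₂ _) (inj₁ q) = subst (x ∼_) q xy
    by (inj₂ (_ , _ , _ , q)) (inj₂ (_ , _ , _ , q′)) = inj₁ (sym (trans q′ (trans (cong neg q) (neg-involutive x))))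

  -- Passing to the other representative costs one reflection sᵢ, which leaves the ideal unchanged.
  representative : ∀ w → W0 w → ∀ {x} → coact w θv ∼ x →
                   ∃ λ w₁ → W0 w₁ × coact w₁ θv ≡ x × (∀ γ → I w γ → I w₁ γ) × (∀ γ → I w₁ γ → I w γ)
  representative w h (inj₁ q) = w , h , q , (λ _ i → i) , (λ _ i → i)
  representative w h {x} (inj₂ (i , l , t)) = i ∷ w , W0-flip w i t′ h , flipped t , I-flip w i t′ , I-unflip w i t′
    where
    t′ : act w θ ≡ e i ⊎ act w θ ≡ neg (e i)
    t′ = [ (λ a → inj₁ (coact≡⇒act≡ w {e i} (co-e i l) (proj₁ a))) , (λ a → inj₂ (coact≡⇒act≡ w {neg (e i)} (co-neg {e i} {e i} (co-e i l)) (proj₁ a))) ]′ t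
    flipped : (coact w θv ≡ e i × x ≡ neg (e i)) ⊎ (coact w θv ≡ neg (e i) × x ≡ e i) → coact (i ∷ w) θv ≡ x
    flipped (inj₁ (a , b)) = trans (act≡⇒coact≡ (i ∷ w) {neg (e i)} (co-neg {e i} {e i} (co-e i l)) (trans (cong (s i) (coact≡⇒act≡ w {e i} (co-e i l) a)) (s-e i))) (sym b)
    flipped (inj₂ (a , b)) = trans (act≡⇒coact≡ (i ∷ w) {e i} (co-e i l) (trans (cong (s i) (coact≡⇒act≡ w {neg (e i)} (co-neg {e i} {e i} (co-e i l)) a))
      (trans (s-neg i (e i)) (trans (cong neg (s-e i)) (neg-involutive (e i)))))) (sym b)

  coact≡⇒I : ∀ w w′ → W0 w → W0 w′ → coact w θv ≡ coact w′ θv → ∀ γ → I w γ → I w′ γ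
  coact≡⇒I w w′ h h′ q = θ-determines-I w w′ h h′ (coact≡⇒act≡ w {act w′ θ} (co-act w′) q)

  ∼⇒I : ∀ w w′ → W0 w → W0 w′ → coact w θv ∼ coact w′ θv → ∀ γ → I w γ → I w′ γ
  ∼⇒I w w′ h h′ q γ i = let (w₁ , h₁ , q₁ , to , _) = representative w h q in coact≡⇒I w₁ w′ h₁ h′ q₁ γ (to γ i)

  Pplus⇒NN : ∀ w {c} → coact w θv ≡ c → Pplus c → NN (act w θ)
  Pplus⇒NN w {c} q (γ , (_ , N) , (_ , pos) , co) = subst NN (sym (coact≡⇒act≡ w {γ} {c} (longCo {γ} {c} (trans (B≡inner γ γ) (trans N (sym (B≡inner θ θ)))) co) q)) (nn pos)

  Pminus⇒NN : ∀ w {c} → coact w θv ≡ c → Pminus c → NN (neg (act w θ))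
  Pminus⇒NN w {c} q (γ , (_ , N) , (_ , pos) , co) = subst NN γ≡ (nn pos)
    where
    γ≡ : γ ≡ neg (act w θ)
    γ≡ = root-unique {γ} {neg (act w θ)} {neg c} (longCo {γ} {neg c} (trans (B≡inner γ γ) (trans N (sym (B≡inner θ θ)))) co)
           (co-neg {act w θ} {c} (subst (LongCo (act w θ)) q (co-act w)))

  long-act : ∀ w → Long (act w θ)
  long-act w = root-act w θ-root , trans (sym (B≡inner (act w θ) (act w θ))) (trans (act-norm w) (B≡inner θ θ))

  NN⇒Pplus : ∀ w → NN (act w θ) → Pplus (coact w θv)
  NN⇒Pplus w h = act w θ , long-act w , (root-act w θ-root , nonneg h) , isCoroot {act w θ} {coact w θv} (act-norm w) (co-act w)

  NN⇒Pminus : ∀ w → NN (neg (act w θ)) → Pminus (coact w θv)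
  NN⇒Pminus w h = neg (act w θ) , (root-neg (root-act w θ-root) , trans (sym (B≡inner _ _)) (trans N′ (B≡inner θ θ))) , (root-neg (root-act w θ-root) , nonneg h)
      , isCoroot {neg (act w θ)} {neg (coact w θv)} N′ (co-neg {act w θ} {coact w θv} (co-act w))
    where N′ : B (neg (act w θ)) (neg (act w θ)) ≡ B θ θ
          N′ = trans (inner-neg-neg (act w θ)) (act-norm w)

  -- From the order on classes to inclusion of ideals

  ≼-refl : ∀ {x : V n} → x ≼ x
  ≼-refl {x} = (λ _ → 0) , λ i → sym (ℤₚ.+-identityʳ (lookup x i))

  ≼-trans : ∀ {x y z : V n} → x ≼ y → y ≼ z → x ≼ z
  ≼-trans {x} {y} {z} (m , h) (m′ , h′) = (λ i → m i ℕ.+ m′ i)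
    , λ i → trans (h′ i) (trans (cong (_+ + m′ i) (h i)) (trans (ℤₚ.+-assoc (lookup x i) (+ m i) (+ m′ i)) (cong (λ t → lookup x i + t) (sym (ℤₚ.pos-+ (m i) (m′ i))))))

  -- For roots of the length of θ, differences of coroots and of roots are proportional in each
  -- coordinate with positive factors, so the order on coroots can be tested on roots.
  M-diff : ∀ x y c c′ → LongCo x c → LongCo y c′ → ∀ i → M * (lookup c′ i - lookup c i) ≡ D i * lookup (y ⊕ neg x) i
  M-diff x y c c′ h h′ i = trans (l M (lookup c′ i) (lookup c i)) (trans (cong₂ _-_ (sym (h′ i)) (sym (h i))) (trans (sym (l (D i) (lookup y i) (lookup x i))) (cong (D i *_) (sym (lookup-sub y x i)))))
    where l : ∀ m a b → m * (a - b) ≡ m * a - m * b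
          l = solve-∀

  NN⇒≼ : ∀ x y c c′ → LongCo x c → LongCo y c′ → NN (y ⊕ neg x) → c ≼ c′
  NN⇒≼ x y c c′ h h′ q = (λ i → ∣ lookup c′ i - lookup c i ∣) , λ i → trans (l (lookup c′ i) (lookup c i)) (cong (λ z → lookup c i + z) (sym (ℤₚ.0≤i⇒+∣i∣≡i (pos i))))
    where
    l : ∀ a b → a ≡ b + (a - b)
    l = solve-∀
    pos : ∀ i → 0ℤ ≤ lookup c′ i - lookup c i
    pos i = ≥0-*-cancelˡ {M} {lookup c′ i - lookup c i} M>0 (subst (0ℤ ≤_) (sym (M-diff x y c c′ h h′ i)) (ℤₚ.<⇒≤ (D>0 i) ⊠ nonneg q i))

  ≼⇒NN : ∀ x y c c′ → LongCo x c → LongCo y c′ → c ≼ c′ → NN (y ⊕ neg x)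
  ≼⇒NN x y c c′ h h′ (m , q) = nn λ i → ≥0-*-cancelˡ {D i} {lookup (y ⊕ neg x) i} (D>0 i)
    (subst (0ℤ ≤_) (M-diff x y c c′ h h′ i) (ℤₚ.<⇒≤ M>0 ⊠ subst (0ℤ ≤_) (sym (trans (cong (_- lookup c i) (q i)) (l (lookup c i) (+ m i)))) (+≤+ ℕ.z≤n)))
    where l : ∀ a b → a + b - a ≡ b
          l = solve-∀

  -- There is no integral vector strictly between 0 and αⱼ; this keeps simple roots and their
  -- negatives from being the reflected end point in `monotone`.
  squeeze : ∀ {x} j → NN x → NN (e j ⊕ neg x) → 0ℤ < lookup (e j ⊕ neg x) j → x ≡ 𝟘
  squeeze {x} j h h′ gt = lookup-ext λ k → trans (at k) (sym (lookup-𝟘 k))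
    where
    at : ∀ k → lookup x k ≡ 0ℤ
    at k with k Fin.≟ j
    ... | yes refl = ℤₚ.≤-antisym (0≤→≤ (0≤-resp (<→0≤ gt) (trans (cong (λ z → z - 0ℤ - 1ℤ) (trans (lookup-sub (e k) x k) (cong (_- lookup x k) (lookup-e-same k)))) (l (lookup x k))))) (nonneg h k)
      where l : ∀ z → 1ℤ - z - 0ℤ - 1ℤ ≡ 0ℤ - z
            l = solve-∀
    ... | no ne = ℤₚ.≤-antisym (0≤→≤ (subst (0ℤ ≤_) (trans (lookup-sub (e j) x k) (cong (_- lookup x k) (lookup-e-diff j k ne))) (nonneg h′ k))) (nonneg h k)

  NN-swap : ∀ {x y : V n} → NN x → NN (y ⊕ neg x) → NN y
  NN-swap {x} {y} a b = subst NN (sub-add y x) (NN-⊕ a b)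

  p-inv-obtuse : ∀ w j → B (e j) (act w θ) < 0ℤ → act w θ ≢ neg (e j) → p (act (inv w) (e j)) ≡ - 1ℤ
  p-inv-obtuse w j lt ne = by (pView (root-act (inv w) (simple j)))
    where
    neg<0 : 0ℤ < - p (act (inv w) (e j))
    neg<0 = >0-*-cancelˡ {M} { - p (act (inv w) (e j)) } M>0 (subst (0ℤ <_)
      (trans (cong -_ (sym (p-inv w (e j)))) (ℤₚ.neg-distribʳ-* M (p (act (inv w) (e j))))) (ℤₚ.neg-mono-< lt))
    by : PView (act (inv w) (e j)) → p (act (inv w) (e j)) ≡ - 1ℤ
    by (is-θ q) = ⊥-elim (0≤⇒neg-absurd (ℤₚ.<⇒≤ neg<0) 1 (cong -_ (trans (cong p q) p-θ)))
    by (is-1 q) = ⊥-elim (0≤⇒neg-absurd (ℤₚ.<⇒≤ neg<0) 0 (cong -_ q))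
    by (is-0 q) = ⊥-elim (ℤₚ.<-irrefl (sym (cong -_ q)) neg<0)
    by (is--1 q) = q
    by (is--θ q) = ⊥-elim (ne (trans (sym (cong (act w) q)) (trans (act-neg w (act (inv w) (e j))) (cong neg (act-inv′ w (e j))))))

  -- If ν < ν′ are roots of the same length and sign, then (ν′ - ν , αⱼ) > 0 for some αⱼ in the support of ν′ - ν,
  -- so either sⱼν′ or sⱼν lies between ν and ν′.
  monotone : ∀ w w′ → W0 w → W0 w′ → NN (act w θ) ⊎ NN (neg (act w′ θ)) → NN (act w′ θ ⊕ neg (act w θ)) → ∀ γ → I w γ → I w′ γ
  monotone w w′ h h′ S le = go ∣ height (act w′ θ ⊕ neg (act w θ)) ∣ w w′ h h′ S le (ℤₚ.≤-reflexive (sym (ℤₚ.0≤i⇒+∣i∣≡i (height-NN le))))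
    where
    _⊖_ : W → W → V n
    w′ ⊖ w = act w′ θ ⊕ neg (act w θ)
    Goal : W → W → Set
    Goal w w′ = ∀ γ → I w γ → I w′ γ
    -- As wθ ≤ w′θ, positivity of the lower root or negativity of the upper one fixes both signs.
    Sign : W → W → Set
    Sign w w′ = NN (act w θ) ⊎ NN (neg (act w′ θ))
    go : ∀ N w w′ → W0 w → W0 w′ → Sign w w′ → NN (w′ ⊖ w) → height (w′ ⊖ w) ≤ + N → Goal w w′

    -- The integer coordinate of the coroot difference at j is positive, so it may be lowered by one.
    module Step (N : ℕ) (w w′ : W) (h : W0 w) (h′ : W0 w′) (S : Sign w w′) (le : NN (w′ ⊖ w)) (hN : height (w′ ⊖ w) ≤ + suc N)
                (j : Fin n) (gt : 0ℤ < lookup (w′ ⊖ w) j) where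
      -- `D j * k ≡ M` says that kαⱼ in root coordinates is one αⱼ^∨ in coroot coordinates; k
      -- exceeds 1 when αⱼ is short.
      room : ∀ k → D j * k ≡ M → 0ℤ ≤ lookup (w′ ⊖ w) j - k
      room k q = ≥0-*-cancelˡ {D j} {lookup (w′ ⊖ w) j - k} (D>0 j) (0≤-resp
        (ℤₚ.<⇒≤ M>0 ⊠ <→0≤ (>0-*-cancelˡ {M} {δ} M>0 (subst (0ℤ <_) (sym diff) (>0-* (D j) (lookup (w′ ⊖ w) j) (D>0 j) gt))))
        (trans (l M δ) (trans (cong₂ _-_ diff (sym q)) (l′ (D j) (lookup (w′ ⊖ w) j) k))))
        where
        δ : ℤ
        δ = lookup (coact w′ θv) j - lookup (coact w θv) j
        diff : M * δ ≡ D j * lookup (w′ ⊖ w) j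
        diff = M-diff (act w θ) (act w′ θ) (coact w θv) (coact w′ θv) (co-act w) (co-act w′) j
        l : ∀ m z → m * (z - 0ℤ - 1ℤ) ≡ m * z - m
        l = solve-∀
        l′ : ∀ d z k → d * z - d * k ≡ d * (z - k)
        l′ = solve-∀

      lowered : ∀ k → D j * k ≡ M → ∀ {y} → (∀ i → lookup y i ≡ lookup (w′ ⊖ w) i - k * lookup (e j) i) → NN y
      lowered k q {y} hy = nn λ i → subst (0ℤ ≤_) (sym (hy i)) (at i)
        where
        at : ∀ i → 0ℤ ≤ lookup (w′ ⊖ w) i - k * lookup (e j) i
        at i with i Fin.≟ j
        ... | yes refl = 0≤-resp (room k q) (cong (λ z → lookup (w′ ⊖ w) i - z) (sym (trans (cong (k *_) (lookup-e-same i)) (ℤₚ.*-identityʳ k))))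
        ... | no ne = 0≤-resp (nonneg le i) (sym (trans (cong (λ z → lookup (w′ ⊖ w) i - z) (trans (cong (k *_) (lookup-e-diff j i ne)) (ℤₚ.*-zeroʳ k))) (ℤₚ.+-identityʳ _)))

      lowered-height : ∀ k → 0ℤ < k → ∀ {y} → (∀ i → lookup y i ≡ lookup (w′ ⊖ w) i - k * lookup (e j) i) → height y ≤ + N
      lowered-height k k>0 {y} hy = 0≤→≤ (0≤-resp (≤→0≤ hN ⊞ <→0≤ k>0) (trans (l (+ N) (height (w′ ⊖ w)) k) (cong (λ z → + N - z) (sym hy′))))
        where
        l : ∀ N a k → 1ℤ + N - a + (k - 0ℤ - 1ℤ) ≡ N - (a - k)
        l = solve-∀
        hy′ : height y ≡ height (w′ ⊖ w) - k
        hy′ = trans (∑-cong λ i → trans (hy i) (cong (λ z → lookup (w′ ⊖ w) i + z) (ℤₚ.neg-distribˡ-* k (lookup (e j) i))))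
          (trans (∑-+ (lookup (w′ ⊖ w)) (λ i → - k * lookup (e j) i)) (cong (λ z → height (w′ ⊖ w) + z) (∑-e (λ _ → - k) j)))

      above : 0ℤ < B (e j) (act w′ θ) → Goal w w′
      above gt′ γ i = I-down w′ j gt′ γ (go N w (j ∷ w′) h (W0-step w′ j h′ (λ z → ℤₚ.<-irrefl (sym z) gt′)) S′
          (lowered k q {(j ∷ w′) ⊖ w} hy) (lowered-height k (pSC>0 {act w′ θ} gt′) {(j ∷ w′) ⊖ w} hy) γ i)
        where
        k : ℤ
        k = pSC (act w′ θ) j
        -- Were w′θ = αⱼ, a positive wθ below it would be squeezed to 0, and the negative case is
        -- absurd at once. Hence w′⁻¹αⱼ has degree 1, and the reflection lowers by exactly one αⱼ^∨.
        excl : NN (act w θ) ⊎ NN (neg (act w′ θ)) → act w′ θ ≢ e j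
        excl (inj₁ a) z = root≢𝟘 (root-act w θ-root) (squeeze j a (subst (λ t → NN (t ⊕ neg (act w θ))) z le) (subst (λ t → 0ℤ < lookup (t ⊕ neg (act w θ)) j) z gt))
        excl (inj₂ a) z = ¬NN-neg (simple j) (NN-e j) (subst (NN ∘ neg) z a)
        q : D j * k ≡ M
        q = trans (sym (inner-e j (act w′ θ))) (trans (sym (p-inv w′ (e j))) (trans (cong (M *_) (p-inv-acute w′ j gt′ (excl S))) (ℤₚ.*-identityʳ M)))
        l : ∀ a k u b → a + - k * u - b ≡ a - b - k * u
        l = solve-∀
        hy : ∀ i → lookup ((j ∷ w′) ⊖ w) i ≡ lookup (w′ ⊖ w) i - k * lookup (e j) i
        hy i = trans (lookup-sub (act (j ∷ w′) θ) (act w θ) i) (trans (cong (_- lookup (act w θ) i) (lookup-s j (act w′ θ) i))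
          (trans (l (lookup (act w′ θ) i) k (lookup (e j) i) (lookup (act w θ) i)) (cong (_- k * lookup (e j) i) (sym (lookup-sub (act w′ θ) (act w θ) i)))))
        S′ : Sign w (j ∷ w′)
        S′ = [ inj₁ , (λ a → inj₂ (subst NN (s-neg j (act w′ θ)) (root-s-NN j (root-neg (root-act w′ θ-root)) a
               λ z → ℤₚ.<-asym gt′ (subst (_< 0ℤ) (trans (sym (inner-negʳ (e j) (e j))) (cong (B (e j)) (trans (cong neg (sym z)) (neg-involutive (act w′ θ))))) (ℤₚ.neg-mono-< (rootLike->0 (root⇒rootLike (simple j)))))))) ]′ S

      under : B (e j) (act w θ) < 0ℤ → Goal w w′
      under lt γ i = go N (j ∷ w) w′ (W0-step w j h (λ z → ℤₚ.<-irrefl z lt)) h′ S′ (lowered k q {w′ ⊖ (j ∷ w)} hy) (lowered-height k k>0 {w′ ⊖ (j ∷ w)} hy) γ (I-up w j lt γ i)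
        where
        k : ℤ
        k = - pSC (act w θ) j
        neg-B : 0ℤ < - B (e j) (act w θ)
        neg-B = ℤₚ.neg-mono-< lt
        Dk : D j * k ≡ - B (e j) (act w θ)
        Dk = trans (sym (ℤₚ.neg-distribʳ-* (D j) (pSC (act w θ) j))) (cong -_ (sym (inner-e j (act w θ))))
        k>0 : 0ℤ < k
        k>0 = >0-*-cancelˡ {D j} {k} (D>0 j) (subst (0ℤ <_) (sym Dk) neg-B)
        excl : NN (act w θ) ⊎ NN (neg (act w′ θ)) → act w θ ≢ neg (e j)
        excl (inj₁ a) z = ¬NN-neg (simple j) (NN-e j) (subst NN z a)
        excl (inj₂ a) z = root≢𝟘 (root-neg (root-act w′ θ-root)) (squeeze j a (subst NN eq le) (subst (λ t → 0ℤ < lookup t j) eq gt))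
          where eq : act w′ θ ⊕ neg (act w θ) ≡ e j ⊕ neg (neg (act w′ θ))
                eq = trans (cong (λ t → act w′ θ ⊕ neg t) z) (trans (cong (act w′ θ ⊕_) (neg-involutive (e j))) (trans (⊕-comm (act w′ θ) (e j)) (cong (e j ⊕_) (sym (neg-involutive (act w′ θ))))))
        q : D j * k ≡ M
        q = trans Dk (trans (cong -_ (trans (sym (p-inv w (e j))) (cong (M *_) (p-inv-obtuse w j lt (excl S))))) (l M))
          where l : ∀ m → - (m * - 1ℤ) ≡ m
                l = solve-∀
        l : ∀ a b k u → a - (b + k * u) ≡ a - b - k * u
        l = solve-∀
        hy : ∀ i → lookup (w′ ⊖ (j ∷ w)) i ≡ lookup (w′ ⊖ w) i - k * lookup (e j) i
        hy i = trans (lookup-sub (act w′ θ) (act (j ∷ w) θ) i) (trans (cong (λ z → lookup (act w′ θ) i - z) (lookup-s j (act w θ) i))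
          (trans (l (lookup (act w′ θ) i) (lookup (act w θ) i) k (lookup (e j) i)) (cong (_- k * lookup (e j) i) (sym (lookup-sub (act w′ θ) (act w θ) i)))))
        S′ : Sign (j ∷ w) w′
        S′ = [ (λ a → inj₁ (root-s-NN j (root-act w θ-root) a λ z → ℤₚ.<-asym lt (subst (0ℤ <_) (cong (B (e j)) (sym z)) (rootLike->0 (root⇒rootLike (simple j)))))) , inj₂ ]′ S

      step : 0ℤ < B (e j) (w′ ⊖ w) → Goal w w′
      step pos = by (0ℤ ℤₚ.<? B (e j) (act w′ θ))
        where
        l : ∀ a b → a + - b - 0ℤ - 1ℤ + (0ℤ - a) ≡ 0ℤ - b - 1ℤ
        l = solve-∀
        by : Dec (0ℤ < B (e j) (act w′ θ)) → Goal w w′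
        by (yes a) = above a
        by (no a) = under (0≤→< (0≤-resp (<→0≤ (subst (0ℤ <_) (trans (inner-⊕ʳ (e j) (act w′ θ) (neg (act w θ))) (cong (λ z → B (e j) (act w′ θ) + z) (inner-negʳ (e j) (act w θ)))) pos)
                      ⊞ ≤→0≤ (ℤₚ.≮⇒≥ a)) (l (B (e j) (act w′ θ)) (B (e j) (act w θ)))))

    branch : ∀ N w w′ → W0 w → W0 w′ → Sign w w′ → NN (w′ ⊖ w) → height (w′ ⊖ w) ≤ + N → Dec (w′ ⊖ w ≡ 𝟘) → Goal w w′
    go N w w′ h h′ S le hN = branch N w w′ h h′ S le hN ((w′ ⊖ w) ≟V 𝟘)
    branch N w w′ h h′ S le hN (yes z) = θ-determines-I w w′ h h′ (sym (sub≡𝟘 z))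
    branch zero w w′ h h′ S le hN (no z) = ⊥-elim (ℤₚ.<⇒≱ (height-pos le z) hN)
    branch (suc N) w w′ h h′ S le hN (no z) = let (j , gt , pos) = acute {w′ ⊖ w} (nonneg le) z in Step.step N w w′ h h′ S le hN j gt pos

  -- A crossing at αₖ is bridged by some w₃ with w₃θ = αₖ: it and sₖw₃ have the same ideal, which
  -- joins a chain of negative roots ending at -αₖ to a chain of positive roots starting at αₖ.
  ≤∼⇒I : ∀ w w′ → W0 w → W0 w′ → coact w θv ≤∼ coact w′ θv → ∀ γ → I w γ → I w′ γ
  ≤∼⇒I w w′ h h′ (x , y , xr , yr , le) γ i = by (representative w h xr) (representative w′ h′ yr)
    where
    Rep : W → V n → Set
    Rep w x = ∃ λ w₁ → W0 w₁ × coact w₁ θv ≡ x × (∀ γ → I w γ → I w₁ γ) × (∀ γ → I w₁ γ → I w γ)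
    by : Rep w x → Rep w′ y → I w′ γ
    by (w₁ , h₁ , refl , to , _) (w₂ , h₂ , refl , _ , from) = from γ (go le (to γ i))
      where
      go : _ → I w₁ γ → I w₂ γ
      go (inj₁ (P , _ , x≼y)) = monotone w₁ w₂ h₁ h₂ (inj₁ (Pplus⇒NN w₁ refl P)) (≼⇒NN (act w₁ θ) (act w₂ θ) (coact w₁ θv) (coact w₂ θv) (co-act w₁) (co-act w₂) x≼y) γ
      go (inj₂ (inj₁ (_ , P′ , x≼y))) = monotone w₁ w₂ h₁ h₂ (inj₂ (Pminus⇒NN w₂ refl P′)) (≼⇒NN (act w₁ θ) (act w₂ θ) (coact w₁ θv) (coact w₂ θv) (co-act w₁) (co-act w₂) x≼y) γ
      go (inj₂ (inj₂ (P , P′ , k , l , x≼ , ≼y))) = through (reach (e k) (simple k) (longSimple-norm k l))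
        where
        through : (∃ λ w₃ → W0 w₃ × act w₃ θ ≡ e k) → I w₁ γ → I w₂ γ
        through (w₃ , h₃ , q) a = monotone w₃ w₂ h₃ h₂ (inj₁ (subst NN (sym q) (NN-e k)))
            (subst (λ z → NN (act w₂ θ ⊕ neg z)) (sym q) (≼⇒NN (e k) (act w₂ θ) (e k) (coact w₂ θv) (co-e k l) (co-act w₂) ≼y)) γ
            (I-unflip w₃ k (inj₁ q) γ (monotone w₁ (k ∷ w₃) h₁ (W0-flip w₃ k (inj₁ q) h₃)
              (inj₂ (subst NN (trans (sym (neg-involutive (e k))) (cong neg (sym -q))) (NN-e k)))
              (subst (λ z → NN (z ⊕ neg (act w₁ θ))) (sym -q) (≼⇒NN (act w₁ θ) (neg (e k)) (coact w₁ θv) (neg (e k)) (co-act w₁) (co-neg {e k} {e k} (co-e k l)) x≼)) γ a))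
          where -q : act (k ∷ w₃) θ ≡ neg (e k)
                -q = trans (flip-θ w₃ k (inj₁ q)) (cong neg q)

  -- From inclusion of ideals to the order on classes

  ≤∼-refl : ∀ w → coact w θv ≤∼ coact w θv
  ≤∼-refl w = coact w θv , coact w θv , inj₁ refl , inj₁ refl
    , [ (λ h → inj₁ (NN⇒Pplus w h , NN⇒Pplus w h , ≼-refl {coact w θv})) , (λ h → inj₂ (inj₁ (NN⇒Pminus w h , NN⇒Pminus w h , ≼-refl {coact w θv}))) ]′ (root-sign (root-act w θ-root))

  ≤∼-respˡ : ∀ {x x′ y} → x′ ∼ x → x ≤∼ y → x′ ≤∼ y
  ≤∼-respˡ q (u , v , a , b , c) = u , v , ∼-trans q a , b , c

  ≤∼-respʳ : ∀ {x y y′} → y′ ∼ y → x ≤∼ y → x ≤∼ y′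
  ≤∼-respʳ q (u , v , a , b , c) = u , v , a , ∼-trans q b , c

  ¬Pplus-neg-e : ∀ i → ¬ Pplus (neg (e i))
  ¬Pplus-neg-e i (γ , (_ , N) , (r , pos) , co) = root≢𝟘 r (NN-antisym (nn pos) (nn λ j → subst (0ℤ ≤_) (sym (lookup-neg γ j)) (≤0⇒0≤- (lookup γ j) (γ≤0 j))))
    where
    h : LongCo γ (neg (e i))
    h = longCo {γ} {neg (e i)} (trans (B≡inner γ γ) (trans N (sym (B≡inner θ θ)))) co
    γ≤0 : ∀ j → lookup γ j ≤ 0ℤ
    γ≤0 j = 0≤-⇒≤0 (lookup γ j) (≥0-*-cancelˡ {D j} { - lookup γ j } (D>0 j) (0≤-resp (ℤₚ.<⇒≤ M>0 ⊠ lookup-e-≥0 i j)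
      (trans (trans (trans (l M (lookup (e i) j)) (cong (λ z → - (M * z)) (sym (lookup-neg (e i) j)))) (cong -_ (sym (h j)))) (ℤₚ.neg-distribʳ-* (D j) (lookup γ j)))))
      where l : ∀ m u → m * u ≡ - (m * - u)
            l = solve-∀

  -- The difficulty is that the class of the lower coroot may enter the hypothesis through its other
  -- representative. If it is αᵢ and was compared as -αᵢ, the comparison among negatives turns into
  -- a crossing at αᵢ; the opposite situation is excluded by `not-neg-e`.
  ≤∼-lower : ∀ {x} w j → 0ℤ < B (e j) (act w θ) → act w θ ≢ e j → x ≤∼ coact (j ∷ w) θv → x ≤∼ coact w θv
  ≤∼-lower {x} w j gt ne (u , v , xu , yv , c) = by (e-or-neg yv)
    where
    y y⁺ : V n
    y = coact (j ∷ w) θv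
    y⁺ = coact w θv
    k : ℤ
    k = pSC (act w θ) j
    ν-diff : NN (act w θ ⊕ neg (act (j ∷ w) θ))
    ν-diff = nn λ i → 0≤-resp (ℤₚ.<⇒≤ (pSC>0 {act w θ} gt) ⊠ lookup-e-≥0 j i)
      (trans (l (lookup (act w θ) i) k (lookup (e j) i)) (trans (cong (λ z → lookup (act w θ) i - z) (sym (lookup-s j (act w θ) i))) (sym (lookup-sub (act w θ) (act (j ∷ w) θ) i))))
      where l : ∀ a k u → k * u ≡ a - (a + - k * u)
            l = solve-∀
    y≼y⁺ : y ≼ y⁺
    y≼y⁺ = NN⇒≼ (act (j ∷ w) θ) (act w θ) y y⁺ (co-act (j ∷ w)) (co-act w) ν-diff
    plus : Pplus y → Pplus y⁺
    plus P = NN⇒Pplus w (NN-swap (Pplus⇒NN (j ∷ w) refl P) ν-diff)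
    lowered≢ : act (j ∷ w) θ ≢ neg (e j)
    lowered≢ q = ne (trans (sym (s-involutive j (act w θ))) (trans (cong (s j) q) (trans (s-neg j (e j)) (trans (cong neg (s-e j)) (neg-involutive (e j))))))
    minus : Pminus y → Pminus y⁺
    minus P = NN⇒Pminus w (subst NN (trans (s-neg j (act (j ∷ w) θ)) (cong neg (s-involutive j (act w θ))))
      (root-s-NN j (root-neg (root-act (j ∷ w) θ-root)) (Pminus⇒NN (j ∷ w) refl P) λ q → lowered≢ (trans (sym (neg-involutive (act (j ∷ w) θ))) (cong neg q))))
    -- After the reflection (αⱼ , sⱼwθ) < 0, whereas (αⱼ , -αᵢ) ≥ 0 for i ≠ j; and i = j would give
    -- wθ = αⱼ.
    not-neg-e : ∀ i → act (j ∷ w) θ ≢ neg (e i)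
    not-neg-e i q with i Fin.≟ j
    ... | yes refl = lowered≢ q
    ... | no i≢j = ℤₚ.<⇒≱ pos (subst (_≤ 0ℤ) (sym (inner-ejx j i)) (0≤→≤ (0≤-resp (ℤₚ.<⇒≤ (D>0 j) ⊠ ≤→0≤ {A j i} {0ℤ} (offdiag j i (i≢j ∘ sym))) (l (D j) (A j i)))))
      where
      l : ∀ d a → d * (0ℤ - a) ≡ 0ℤ - d * a
      l = solve-∀
      pos : 0ℤ < B (e j) (e i)
      pos = subst (0ℤ <_) (trans (sym (ℤₚ.neg-involutive (B (e j) (act w θ)))) (trans (cong -_ (trans (sym (B-s-e j (act w θ))) (trans (cong (B (e j)) q) (inner-negʳ (e j) (e i))))) (ℤₚ.neg-involutive (B (e j) (e i))))) gt
    Cases : V n → Set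
    Cases v = (Pplus u × Pplus v × u ≼ v) ⊎ (Pminus u × Pminus v × u ≼ v) ⊎ (Pminus u × Pplus v × ∃ λ i → LongSimple i × u ≼ neg (e i) × e i ≼ v)
    same : Cases y → x ≤∼ y⁺
    same (inj₁ (P , P′ , le)) = u , y⁺ , xu , inj₁ refl , inj₁ (P , plus P′ , ≼-trans {u} {y} {y⁺} le y≼y⁺)
    same (inj₂ (inj₁ (P , P′ , le))) = u , y⁺ , xu , inj₁ refl , inj₂ (inj₁ (P , minus P′ , ≼-trans {u} {y} {y⁺} le y≼y⁺))
    same (inj₂ (inj₂ (P , P′ , i , l , a , b))) = u , y⁺ , xu , inj₁ refl , inj₂ (inj₂ (P , plus P′ , i , l , a , ≼-trans {e i} {y} {y⁺} b y≼y⁺))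
    flipped : ∀ i → LongSimple i → y ≡ e i → Cases (neg (e i)) → x ≤∼ y⁺
    flipped i l q (inj₁ (_ , P , _)) = ⊥-elim (¬Pplus-neg-e i P)
    flipped i l q (inj₂ (inj₂ (_ , P , _))) = ⊥-elim (¬Pplus-neg-e i P)
    flipped i l q (inj₂ (inj₁ (P , _ , le))) = u , y⁺ , xu , inj₁ refl , inj₂ (inj₂ (P , plus Py , i , l , le , subst (_≼ y⁺) q y≼y⁺))
      where Py : Pplus y
            Py = NN⇒Pplus (j ∷ w) (subst NN (sym (coact≡⇒act≡ (j ∷ w) {e i} (co-e i l) q)) (NN-e i))
    by : y ≡ v ⊎ (∃ λ i → LongSimple i × (y ≡ e i ⊎ y ≡ neg (e i)) × v ≡ neg y) → x ≤∼ y⁺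
    by (inj₁ q) = same (subst Cases (sym q) c)
    by (inj₂ (i , l , inj₁ q , q′)) = flipped i l q (subst Cases (trans q′ (cong neg q)) c)
    by (inj₂ (i , l , inj₂ q , q′)) = ⊥-elim (not-neg-e i (coact≡⇒act≡ (j ∷ w) {neg (e i)} (co-neg {e i} {e i} (co-e i l)) q))

  ↓⇒≤∼ : ∀ {w w′} → w ↓ w′ → coact w θv ≤∼ coact w′ θv
  ↓⇒≤∼ {w} stop = ≤∼-refl w
  ↓⇒≤∼ {w} (lower {w′} j gt ne c) = ≤∼-lower w′ j gt ne (↓⇒≤∼ c)
  ↓⇒≤∼ {w} (flip {w′} j q c) = ≤∼-respʳ (≈⇒∼ w′ (j ∷ w′) (inj₂ (j , inj₁ (q , trans (flip-θ w′ j (inj₁ q)) (cong neg q))))) (↓⇒≤∼ c)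

  -- Descending from w′ to the ideal I(w) ends at some w₁ with the same ideal as w, and
  -- `I-determines-≈` identifies the two classes.
  I⇒≤∼ : ∀ w w′ → W0 w → W0 w′ → (∀ γ → I w γ → I w′ γ) → coact w θv ≤∼ coact w′ θv
  I⇒≤∼ w w′ h h′ sub = let (w₁ , h₁ , c , to , from) = descend (I w) (I? w) (I-upper w h) w′ h′ sub
                       in ≤∼-respˡ (≈⇒∼ w w₁ (I-determines-≈ w w₁ h h₁ to from)) (↓⇒≤∼ c)

  -- Antichains and the isomorphism

  InW0⇒W0 : ∀ w → InW0 w → W0 w
  InW0⇒W0 w h α r pα α≥0 = nn (proj₂ (h α ((r , trans (sym (p≡pair α)) pα) , r , nonneg α≥0)))

  W0⇒InW0 : ∀ w → W0 w → InW0 w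
  W0⇒InW0 w h α ((r , pα) , _ , α≥0) = root-act w r , nonneg (h α r (trans (p≡pair α) pα) (nn α≥0))

  Δ1-I : ∀ w γ → Δ 1ℤ γ → ¬ InN w γ → I w γ
  Δ1-I w γ (r , h) nin = r , pγ , [ (λ q → q) , (λ q → ⊥-elim (nin ((r , nonneg (p-1⇒NN r pγ)) , root-act w r , NN-neg⇒≤0 (act w γ) q))) ]′ (root-sign (root-act w r))
    where pγ = trans (p≡pair γ) h

  I-Δ1 : ∀ w γ → I w γ → Δ 1ℤ γ × ¬ InN w γ
  I-Δ1 w γ (r , pγ , q) = (r , trans (sym (p≡pair γ)) pγ) , λ (_ , _ , ≤0) → root≢𝟘 (root-act w r)
    (NN-antisym q (nn λ i → subst (0ℤ ≤_) (sym (lookup-neg (act w γ) i)) (≤0⇒0≤- (lookup (act w γ) i) (≤0 i))))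

  InMin⇒Minimal : ∀ w γ → InMinComplN w γ → Minimal w γ
  InMin⇒Minimal w γ ((a , b) , m) = Δ1-I w γ a b , λ μ i → let (c , d) = I-Δ1 w μ i in m μ c d

  Minimal⇒InMin : ∀ w γ → Minimal w γ → InMinComplN w γ
  Minimal⇒InMin w γ (i , m) = I-Δ1 w γ i , λ μ a b → m μ (Δ1-I w μ a b)

  below-minimal : ∀ w γ → I w γ → ∃ λ γ₀ → Minimal w γ₀ × γ₀ ≼₀ γ
  below-minimal w γ i = let (γ₀ , i₀ , le , m) = minimal (I w) (I? w) (I⇒pos w) γ i in γ₀ , (i₀ , m) , le

  InI⇒I : ∀ w Γ → W0 w → MinIs w Γ → ∀ γ → InI Γ γ → I w γ
  InI⇒I w Γ h mi γ ((r , q) , μ , Γμ , le) = I-upper w h μ γ (proj₁ (InMin⇒Minimal w μ (proj₁ (mi μ) Γμ))) le r (trans (p≡pair γ) q)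

  I⇒InI : ∀ w Γ → MinIs w Γ → ∀ γ → I w γ → InI Γ γ
  I⇒InI w Γ mi γ i = let (γ₀ , m , le) = below-minimal w γ i in proj₁ (I-Δ1 w γ i) , γ₀ , proj₂ (mi γ₀) (Minimal⇒InMin w γ₀ m) , le

  InI? : ∀ Γ γ → Dec (InI Γ γ)
  InI? Γ γ = (isRoot? γ ×-dec (pair γ θv ℤₚ.≟ 1ℤ)) ×-dec
    search (λ μ → proj₁ Γ μ ≡ true × μ ≼₀ γ) (λ μ → (proj₁ Γ μ Boolₚ.≟ true) ×-dec ≼₀? μ γ)
      (λ μ (Γμ , _) → let (r , q) = proj₁ (proj₂ Γ) μ Γμ in r , p-1⇒NN r (trans (p≡pair μ) q))

  -- The descent starts at the empty word, whose ideal is all of Δ(1), and stops at the ideal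
  -- generated by `Γ`.
  realize : ∀ Γ → ∃ λ w → W0 w × MinIs w Γ
  realize Γ@(G , inΔ1 , anti) = let (w , h , _ , to , from) = descend (InI Γ) (InI? Γ) up [] (λ _ _ _ q → q) start
                                in w , h , λ γ → fwd w to from γ , bwd w to from γ
    where
    up : ∀ γ γ′ → InI Γ γ → γ ≼₀ γ′ → IsRoot γ′ → p γ′ ≡ 1ℤ → InI Γ γ′
    up γ γ′ (_ , μ , Γμ , le) le′ r q = (r , trans (sym (p≡pair γ′)) q) , μ , Γμ , ≼₀-trans {μ} {γ} {γ′} le le′
    start : ∀ γ → InI Γ γ → I [] γ
    start γ ((r , q) , _) = r , trans (p≡pair γ) q , p-1⇒NN r (trans (p≡pair γ) q)
    fwd : ∀ w → (∀ γ → InI Γ γ → I w γ) → (∀ γ → I w γ → InI Γ γ) → ∀ γ → G γ ≡ true → InMinComplN w γ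
    fwd w to from γ Γγ = Minimal⇒InMin w γ (to γ (inΔ1 γ Γγ , γ , Γγ , ≼₀-refl γ) , least)
      where
      least : ∀ μ → I w μ → μ ≼₀ γ → μ ≡ γ
      least μ i le = let (_ , μ₀ , Γμ₀ , le₀) = from μ i
                         eq = anti γ μ₀ Γγ Γμ₀ (≼₀-trans {μ₀} {μ} {γ} le₀ le)
                     in ≼₀-antisym {μ} {γ} le (subst (_≼₀ μ) eq le₀)
    bwd : ∀ w → (∀ γ → InI Γ γ → I w γ) → (∀ γ → I w γ → InI Γ γ) → ∀ γ → InMinComplN w γ → G γ ≡ true
    bwd w to from γ im = let (i , m) = InMin⇒Minimal w γ im
                             (_ , μ , Γμ , le) = from γ i
                         in subst (λ z → G z ≡ true) (m μ (to μ (inΔ1 μ Γμ , μ , Γμ , ≼₀-refl μ)) le) Γμ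

  minimal? : ∀ w γ → Dec (Minimal w γ)
  minimal? w γ = map′ (λ (i , none) → i , λ μ iμ le → decidable-stable (μ ≟V γ) λ ne → none (μ , iμ , le , ne))
                      (λ (i , m) → i , λ (μ , iμ , le , ne) → ne (m μ iμ le))
    (I? w γ ×-dec ¬? (search (λ μ → I w μ × μ ≼₀ γ × μ ≢ γ) (λ μ → I? w μ ×-dec ≼₀? μ γ ×-dec ¬? (μ ≟V γ)) (λ μ (i , _) → I⇒pos w μ i)))

  minima : ∀ w → ∃ λ Γ → MinIs w Γ
  minima w = ((λ γ → ⌊ minimal? w γ ⌋) , (λ γ h → proj₁ (I-Δ1 w γ (proj₁ (m γ h)))) , λ γ μ hγ hμ le → proj₂ (m γ hγ) μ (proj₁ (m μ hμ)) le)
    , λ γ → (λ h → Minimal⇒InMin w γ (m γ h)) , λ h → ⌊⌋-true (minimal? w γ) (InMin⇒Minimal w γ h)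
    where m : ∀ γ → ⌊ minimal? w γ ⌋ ≡ true → Minimal w γ
          m γ = true-⌊⌋ (minimal? w γ)

  -- The representative depends on the word that `realize` happens to find; only its class is
  -- canonical, by `wellDefined`.
  φ : AN → LCo
  φ Γ = let (w , _) = realize Γ in coact w θv , act w θ , long-act w , isCoroot {act w θ} {coact w θv} (act-norm w) (co-act w)

  wellDefined : ∀ Γ w → InW0 w → MinIs w Γ → proj₁ (φ Γ) ∼ coact w θv
  wellDefined Γ w h mi = let (w₀ , h₀ , mi₀) = realize Γ in ≈⇒∼ w₀ w (I-determines-≈ w₀ w h₀ (InW0⇒W0 w h)
    (λ γ i → InI⇒I w Γ (InW0⇒W0 w h) mi γ (I⇒InI w₀ Γ mi₀ γ i)) (λ γ i → InI⇒I w₀ Γ h₀ mi₀ γ (I⇒InI w Γ mi γ i)))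

  injective : ∀ Γ Γ′ → proj₁ (φ Γ) ∼ proj₁ (φ Γ′) → Γ ≈AN Γ′
  injective Γ Γ′ q γ = let (w , h , mi) = realize Γ
                           (w′ , h′ , mi′) = realize Γ′
                           to = ∼⇒I w w′ h h′ q
                           from = ∼⇒I w′ w h′ h (∼-sym q)
    in true⇔⇒≡ (λ t → proj₂ (mi′ γ) (transfer w w′ to from (proj₁ (mi γ) t))) (λ t → proj₂ (mi γ) (transfer w′ w from to (proj₁ (mi′ γ) t)))
    where
    transfer : ∀ w w′ → (∀ γ → I w γ → I w′ γ) → (∀ γ → I w′ γ → I w γ) → InMinComplN w γ → InMinComplN w′ γ
    transfer w w′ to from h = let (i , m) = InMin⇒Minimal w γ h in Minimal⇒InMin w′ γ (to γ i , λ μ iμ → m μ (from μ iμ))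

  surjective : ∀ (c : LCo) → ∃ λ Γ → proj₁ (φ Γ) ∼ proj₁ c
  surjective (c , γ , (r , N) , co) = let N′ = trans (B≡inner γ γ) (trans N (sym (B≡inner θ θ)))
                                          (w , h , q) = reach γ r N′
                                          (Γ , mi) = minima w
    in Γ , subst (proj₁ (φ Γ) ∼_) (act≡⇒coact≡ w {γ} {c} (longCo {γ} {c} N′ co) q) (wellDefined Γ w (W0⇒InW0 w h) mi)

  order : ∀ Γ Γ′ → (Γ ≤up Γ′) ⇔ (proj₁ (φ Γ) ≤∼ proj₁ (φ Γ′))
  order Γ Γ′ = let (w , h , mi) = realize Γ
                   (w′ , h′ , mi′) = realize Γ′
    in mk⇔ (λ le → I⇒≤∼ w w′ h h′ λ γ i → InI⇒I w′ Γ′ h′ mi′ γ (le γ (I⇒InI w Γ mi γ i)))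
           (λ le γ i → I⇒InI w′ Γ′ mi′ γ (≤∼⇒I w w′ h h′ le γ (InI⇒I w Γ h mi γ i)))

theorem4p12 : ∀ {n : ℕ} (C : CartanData n) (θ θv : V n) →
    RS.IsHighest C θ → RS.IsCorootOf C θ θv →
    let open RS C
        open WithTheta θ θv
    in Σ (AN → LCo) λ f →
         -- every antichain arises as min(Δ(1) ∖ N(w)) for some w ∈ W^0
         (∀ Γ → ∃ λ w → InW0 w × MinIs w Γ)
         -- f Γ is the class of w(θ^∨) for any such w (well-definedness)
       × (∀ Γ w → InW0 w → MinIs w Γ → proj₁ (f Γ) ∼ coact w θv)
         -- f is injective on classes
       × (∀ Γ Γ' → proj₁ (f Γ) ∼ proj₁ (f Γ') → Γ ≈AN Γ')
         -- f is surjective onto (Δ_l)^∨/∼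
       × (∀ (c : LCo) → ∃ λ Γ → proj₁ (f Γ) ∼ proj₁ c)
         -- f is an order isomorphism
       × (∀ Γ Γ' → (Γ ≤up Γ') ⇔ (proj₁ (f Γ) ≤∼ proj₁ (f Γ')))
theorem4p12 C θ θv H Hv = φ , (λ Γ → let (w , h , mi) = realize Γ in w , W0⇒InW0 w h , mi) , wellDefined , injective , surjective , order
  where open HighestRoot C θ θv H Hv
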